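{- Suppose that for all non-negative integers $m\ge n$ and all lists $L,M$ one has $\beta(M,m,L,n)>\beta(M,n-1,L,m+1)$. Then for all non-negative integers $m_1,n_1,m_2,n_2$ with $m_1+n_1=m_2+n_2$ and $|m_1-n_1|<|m_2-n_2|$, and all lists $L,M,N$, one has $\beta(M,m_1,L,n_1,N)>\beta(M,m_2,L,n_2,N)$.
   Context: Lists may be empty. A nonempty list $(p_1,\dots,p_r)$ of non-negative integers denotes the word $\mathbf c^{p_1}\mathbf d\mathbf c^{p_2}\mathbf d\cdots\mathbf d\mathbf c^{p_r}$ in non-commuting variables $\mathbf c$ (degree 1), $\mathbf d$ (degree 2); commas denote concatenation of lists; a list with a negative entry denotes $0$ and has $\beta$ value $0$. For a graded poset $P$ of rank $r+1$ with $\hat0,\hat1$ and $S\subseteq[r]$, $f_S$ counts chains $\hat0<x_1<\dots<x_j<\hat1$ with rank set $S$, $h_S=\sum_{T\subseteq S}(-1)^{|S-T|}f_T$, and the ab-index is $\sum_S h_S u_1\cdots u_r$ with $u_i=\mathbf b$ if $i\in S$, $\mathbf a$ otherwise. For Eulerian $P$ it is uniquely a polynomial $\Psi(P)$ in $\mathbf c=\mathbf a+\mathbf b$, $\mathbf d=\mathbf a\mathbf b+\mathbf b\mathbf a$. $B_{r+1}$ is the Boolean lattice of subsets of $[r+1]$. For a word $v$ of degree $r$, $\beta(v)$ is the coefficient of $v$ in $\Psi(B_{r+1})$; $\beta$ of a list is $\beta$ of the word it denotes. -}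

module Defs where

open import Data.Bool using (Bool; true; false; if_then_else_; _∧_; not; _∨_)
open import Data.Nat as ℕ using (ℕ; zero; suc)
open import Data.Integer as ℤ using (ℤ; +_; -[1+_])
open import Data.List using (List; []; _∷_; _++_; map; filter; replicate; reverse)
open import Data.Nat.ListAction using (sum)
open import Data.Vec using (Vec; []; _∷_; toList)
open import Relation.Binary.PropositionalEquality using (_≡_)

-- Boolean lattice B_n : subsets of [n], encoded as characteristic
-- vectors Vec Bool n.  The rank of an element is its cardinality.

Subset : ℕ → Set
Subset n = Vec Bool n

allSubsets : (n : ℕ) → List (Subset n)
allSubsets zero    = [] ∷ []
allSubsets (suc n) = map (false ∷_) (allSubsets n) ++ map (true ∷_) (allSubsets n)

card : ∀ {n} → Subset n → ℕ
card []          = 0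
card (true ∷ x)  = suc (card x)
card (false ∷ x) = card x

subsetᵇ : ∀ {n} → Subset n → Subset n → Bool
subsetᵇ []      []      = true
subsetᵇ (a ∷ x) (b ∷ y) = (not a ∨ b) ∧ subsetᵇ x y

differᵇ : ∀ {n} → Subset n → Subset n → Bool
differᵇ []      []      = false
differᵇ (a ∷ x) (b ∷ y) = (if a then not b else b) ∨ differᵇ x y

ltᵇ : ∀ {n} → Subset n → Subset n → Bool
ltᵇ x y = subsetᵇ x y ∧ differᵇ x y

eqℕᵇ : ℕ → ℕ → Bool
eqℕᵇ zero    zero    = true
eqℕᵇ (suc m) (suc n) = eqℕᵇ m n
eqℕᵇ _       _       = false

emptySet : (n : ℕ) → Subset n
emptySet zero    = []
emptySet (suc n) = false ∷ emptySet n

fullSet : (n : ℕ) → Subset n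
fullSet zero    = []
fullSet (suc n) = true ∷ fullSet n

chainsAbove : ∀ {n} → Subset n → List ℕ → ℕ
chainsAbove {n} x []       = if ltᵇ x (fullSet n) then 1 else 0
chainsAbove {n} x (s ∷ ss) =
  sum (map (λ y → if ltᵇ x y ∧ eqℕᵇ (card y) s then chainsAbove y ss else 0)
           (allSubsets n))

-- Rank set encoded by a vector of Booleans of length r: position i (1-based)
-- belongs to S iff the i-th entry is true.
rankList : ∀ {r} → ℕ → Vec Bool r → List ℕ
rankList i []          = []
rankList i (true ∷ s)  = i ∷ rankList (suc i) s
rankList i (false ∷ s) = rankList (suc i) s

flagF : (r : ℕ) → Vec Bool r → ℕ
flagF r S = chainsAbove (emptySet (suc r)) (rankList 1 S)

subsetsOf : ∀ {r} → Vec Bool r → List (Vec Bool r)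
subsetsOf {r} S = filter (λ T → Data.Bool._≟_ (subsetᵇ T S) true) (allSubsets r)
  where import Data.Bool

sumℤ : List ℤ → ℤ
sumℤ []       = + 0
sumℤ (z ∷ zs) = z ℤ.+ sumℤ zs

sign : ℕ → ℤ
sign zero          = + 1
sign (suc zero)    = -[1+ 0 ]
sign (suc (suc k)) = sign k

flagH : (r : ℕ) → Vec Bool r → ℤ
flagH r S = sumℤ (map (λ T → sign (card S ℕ.∸ card T) ℤ.* + flagF r T) (subsetsOf S))

-- The ab-index of B_{r+1} is Σ_S h_S u₁⋯u_r, where an ab-word u₁⋯u_r is
-- encoded as Vec Bool r (true = b, false = a); so the coefficient of the
-- ab-word u is flagH r u.

data CD : Set where
  c d : CD

CDWord : Set
CDWord = List CD

degree : CDWord → ℕ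
degree []      = 0
degree (c ∷ w) = suc (degree w)
degree (d ∷ w) = suc (suc (degree w))

cdWords : ℕ → List CDWord
cdWords zero          = [] ∷ []
cdWords (suc zero)    = (c ∷ []) ∷ []
cdWords (suc (suc r)) = map (c ∷_) (cdWords (suc r)) ++ map (d ∷_) (cdWords r)

-- coefficient of the ab-word u in the expansion of the cd-word w,
-- using c = a + b, d = ab + ba   (true = b, false = a)
expand : CDWord → List Bool → ℕ
expand []      []           = 1
expand (c ∷ w) (_ ∷ u)      = expand w u
expand (d ∷ w) (x ∷ y ∷ u)  = if (if x then not y else y) then expand w u else 0
expand _       _            = 0

-- ψ r is (the coefficient function of) the cd-index Ψ(B_{r+1}):
-- the cd-polynomial Σ_{deg w = r} ψ r w · w equals the ab-index of B_{r+1}.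
-- (For the Eulerian poset B_{r+1} such a cd-polynomial exists and is unique.)
IsBooleanCDIndex : (ℕ → CDWord → ℤ) → Set
IsBooleanCDIndex ψ = (r : ℕ) (u : Vec Bool r) →
  sumℤ (map (λ w → ψ r w ℤ.* + expand w (toList u)) (cdWords r)) ≡ flagH r u

listWord : List ℕ → CDWord
listWord []           = []
listWord (p ∷ [])     = replicate p c
listWord (p ∷ q ∷ ps) = replicate p c ++ d ∷ listWord (q ∷ ps)

-- A list with a negative entry denotes 0 and has β value 0.
βw : (ℕ → CDWord → ℤ) → CDWord → ℤ
βw ψ v = ψ (degree v) v

β : (ℕ → CDWord → ℤ) → List ℤ → ℤ
β ψ zs = go zs []
  where
  go : List ℤ → List ℕ → ℤ
  go []            acc = βw ψ (listWord (reverse acc))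
  go (+ n ∷ zs)    acc = go zs (n ∷ acc)
  go (-[1+ _ ] ∷ _) _  = + 0

{-# OPTIONS --safe #-}

-- Divide the coefficient of a word of degree r by (r + 1)! and call the result f.  Then f satisfies
-- a size recursion, (r + 1) f(w) = Σ f(w′) over all ways of lowering an exponent of w by one or of
-- merging two neighbours p, q into p + q + 1, and a product rule,
--   f(A,p) f(q,B) = 2 f(A,p+q+1,B) + f(A,p-1,q,B) + f(A,p,q-1,B),
-- which dualises the coproduct of the cd-index.  In twice the size recursion the product rule trades
-- the merges next to a chosen exponent for products of shorter words; this makes inductions work that
-- compare words differing at that exponent only.  It yields (k + 2) f(k+1,N) ≤ f(k,N) ≤ (k + 3) f(k+1,N)
-- and then, for n < m and arbitrary P, Q, N,
--   f(P,n,N) / f(P,n) ≥ f(Q,m,N) / f(Q,m).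
-- Since n < m + 1, this ratio inequality extends the assumption β(M,m,L,n) > β(M,n-1,L,m+1) to words
-- continued by N.  Its reflection reduces β(M,m,L,n,N) > β(M,m+1,L,n-1,N), for m ≥ n, to empty M; there
-- the case m = n is the reflected assumption and the others follow by another trading induction.
-- With the reflections of these two inequalities every arrangement of {m, n} beats every arrangement
-- of {m + 1, n - 1}.

module Submission where

-- Dividing by (r + 1)! is natural because every interval of a Boolean lattice is Boolean: the
-- binomial coefficients that count elements of a given rank cancel, and cutting chains at one rank
-- becomes a plain product. The formal order is the reverse of the overview: f is defined by the
-- size recursion, the product rule is derived from it by induction, and f is recognised as the
-- normalised coefficient only afterwards, because the product rule reproduces the flag h-vector and
-- a cd-polynomial is determined by its ab-expansion. The obstacle to plain induction is the merge:
-- it raises the very exponent that a claim is about, so a bound with constant k + 3 degrades and n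
-- < m may be lost. The merged word carries the coefficient 2 in the product rule; this is why the
-- recursion is doubled before merges are exchanged for products, in which the exponent is intact.
-- Each exchange uses up one lowering, and the lowerings that remain are paid for by the two linear
-- bounds. The ratio inequality needs unrelated P and Q because the two words to be continued differ
-- at an earlier exponent as well as at the last one.

-- Rational arithmetic with sealed operations

module SealedRational where

  open import Data.Nat as ℕ using (ℕ; zero; suc)
  import Data.Nat.Properties as ℕₚ
  open import Data.Integer as ℤ using (ℤ; +_)
  import Data.Integer.Properties as ℤₚ
  open import Data.Rational as ℚ using (ℚ; 0ℚ; 1ℚ; _≤_; _<_; _/_; 1/_; toℚᵘ; NonZero; nonNegative; positive)
  open import Data.Rational.Properties as ℚₚ using (≤-refl; ≤-reflexive; ≤-trans; ≤-antisym; <⇒≤; ≤-<-trans)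
  open import Data.Rational.Unnormalised as ℚᵘ using (mkℚᵘ; *≡*)
  import Data.Rational.Unnormalised.Properties as ℚᵘₚ
  open import Data.Maybe using (Maybe; just; nothing)
  open import Data.Product using (_,_)
  open import Level using (0ℓ)
  open import Relation.Nullary using (yes; no)
  open import Relation.Binary.PropositionalEquality
  open import Tactic.RingSolver.Core.AlmostCommutativeRing using (AlmostCommutativeRing; fromCommutativeRing)
  open import Tactic.RingSolver using (solve-∀)

  ring : AlmostCommutativeRing 0ℓ 0ℓ
  ring = fromCommutativeRing ℚₚ.+-*-commutativeRing zero?
    where
    zero? : ∀ x → Maybe (0ℚ ≡ x)
    zero? x with 0ℚ ℚₚ.≟ x
    ... | yes p = just p
    ... | no  _ = nothing

  infixl 6 _+_ _-_
  infixl 7 _*_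

  -- The operations are sealed so that unification treats them as injective symbols.
  opaque
    _+_ _*_ _-_ : ℚ → ℚ → ℚ
    _+_ = ℚ._+_
    _*_ = ℚ._*_
    _-_ = ℚ._-_

    2ℚ : ℚ
    2ℚ = 1ℚ ℚ.+ 1ℚ

    ιℤ : ℤ → ℚ
    ιℤ z = z / 1

  opaque
    unfolding _+_

    +-assoc : ∀ x y z → x + y + z ≡ x + (y + z)
    +-assoc = ℚₚ.+-assoc

    +-comm : ∀ x y → x + y ≡ y + x
    +-comm = ℚₚ.+-comm

    +-identityˡ : ∀ x → 0ℚ + x ≡ x
    +-identityˡ = ℚₚ.+-identityˡ

    +-identityʳ : ∀ x → x + 0ℚ ≡ x
    +-identityʳ = ℚₚ.+-identityʳ

    *-assoc : ∀ x y z → x * y * z ≡ x * (y * z)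
    *-assoc = ℚₚ.*-assoc

    *-comm : ∀ x y → x * y ≡ y * x
    *-comm = ℚₚ.*-comm

    *-identityˡ : ∀ x → 1ℚ * x ≡ x
    *-identityˡ = ℚₚ.*-identityˡ

    *-zeroˡ : ∀ x → 0ℚ * x ≡ 0ℚ
    *-zeroˡ = ℚₚ.*-zeroˡ

    *-zeroʳ : ∀ x → x * 0ℚ ≡ 0ℚ
    *-zeroʳ = ℚₚ.*-zeroʳ

    *-distribˡ-+ : ∀ x y z → x * (y + z) ≡ x * y + x * z
    *-distribˡ-+ = ℚₚ.*-distribˡ-+

    2ℚ-def : 2ℚ ≡ 1ℚ + 1ℚ
    2ℚ-def = refl

    +-mono-≤ : ∀ {x y u v} → x ≤ y → u ≤ v → x + u ≤ y + v
    +-mono-≤ = ℚₚ.+-mono-≤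

    ιℤ-0 : ιℤ (+ 0) ≡ 0ℚ
    ιℤ-0 = refl

    ιℤ-1 : ιℤ (+ 1) ≡ 1ℚ
    ιℤ-1 = refl

    private
      ιℤ-toℚᵘ : ∀ z → toℚᵘ (ιℤ z) ℚᵘ.≃ mkℚᵘ z 0
      ιℤ-toℚᵘ z = ℚₚ.toℚᵘ-fromℚᵘ (mkℚᵘ z 0)

    ιℤ-+ : ∀ x y → ιℤ (x ℤ.+ y) ≡ ιℤ x + ιℤ y
    ιℤ-+ x y = ℚₚ.toℚᵘ-injective (ℚᵘₚ.≃-trans (ιℤ-toℚᵘ (x ℤ.+ y)) (ℚᵘₚ.≃-trans (*≡* eq)
      (ℚᵘₚ.≃-sym (ℚᵘₚ.≃-trans (ℚₚ.toℚᵘ-homo-+ (ιℤ x) (ιℤ y)) (ℚᵘₚ.+-cong (ιℤ-toℚᵘ x) (ιℤ-toℚᵘ y))))))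
      where
      eq : (x ℤ.+ y) ℤ.* + 1 ≡ (x ℤ.* + 1 ℤ.+ y ℤ.* + 1) ℤ.* + 1
      eq = cong (ℤ._* + 1) (sym (cong₂ ℤ._+_ (ℤₚ.*-identityʳ x) (ℤₚ.*-identityʳ y)))

    ιℤ-* : ∀ x y → ιℤ (x ℤ.* y) ≡ ιℤ x * ιℤ y
    ιℤ-* x y = ℚₚ.toℚᵘ-injective (ℚᵘₚ.≃-trans (ιℤ-toℚᵘ (x ℤ.* y)) (ℚᵘₚ.≃-trans (*≡* refl)
      (ℚᵘₚ.≃-sym (ℚᵘₚ.≃-trans (ℚₚ.toℚᵘ-homo-* (ιℤ x) (ιℤ y)) (ℚᵘₚ.*-cong (ιℤ-toℚᵘ x) (ιℤ-toℚᵘ y))))))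

    ιℤ-cancel-< : ∀ {x y} → ιℤ x < ιℤ y → x ℤ.< y
    ιℤ-cancel-< {x} {y} p with ℚᵘₚ.<-respˡ-≃ (ιℤ-toℚᵘ x) (ℚᵘₚ.<-respʳ-≃ (ιℤ-toℚᵘ y) (ℚₚ.toℚᵘ-mono-< p))
    ... | ℚᵘ.*<* q = subst₂ ℤ._<_ (ℤₚ.*-identityʳ x) (ℤₚ.*-identityʳ y) q

    ιℤ-mono-< : ∀ {x y} → x ℤ.< y → ιℤ x < ιℤ y
    ιℤ-mono-< {x} {y} p = ℚₚ.toℚᵘ-cancel-<
      (ℚᵘₚ.<-respˡ-≃ (ℚᵘₚ.≃-sym (ιℤ-toℚᵘ x)) (ℚᵘₚ.<-respʳ-≃ (ℚᵘₚ.≃-sym (ιℤ-toℚᵘ y))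
        (ℚᵘ.*<* (subst₂ ℤ._<_ (sym (ℤₚ.*-identityʳ x)) (sym (ℤₚ.*-identityʳ y)) p))))

    0≤* : ∀ {x y} → 0ℚ ≤ x → 0ℚ ≤ y → 0ℚ ≤ x * y
    0≤* {x} {y} p q = ≤-trans (≤-reflexive (sym (*-zeroʳ x)))
      (ℚₚ.*-monoˡ-≤-nonNeg x {{nonNegative p}} q)

    0<* : ∀ {x y} → 0ℚ < x → 0ℚ < y → 0ℚ < x * y
    0<* {x} {y} p q = ≤-<-trans (≤-reflexive (sym (*-zeroʳ x)))
      (ℚₚ.*-monoʳ-<-pos x {{positive p}} q)

    0<+ : ∀ {x y} → 0ℚ < x → 0ℚ ≤ y → 0ℚ < x + y
    0<+ p q = ℚₚ.+-mono-<-≤ p q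

    private
      -+ : ∀ x y → y - x + x ≡ y
      -+ = solve-∀ ring

    ≤⇒0≤- : ∀ {x y} → x ≤ y → 0ℚ ≤ y - x
    ≤⇒0≤- {x} {y} p = ≤-trans (≤-reflexive (sym (ℚₚ.+-inverseʳ x))) (ℚₚ.+-monoˡ-≤ (ℚ.- x) p)

    0≤-⇒≤ : ∀ {x y} → 0ℚ ≤ y - x → x ≤ y
    0≤-⇒≤ {x} {y} p = subst₂ _≤_ (+-identityˡ x) (-+ x y) (ℚₚ.+-monoˡ-≤ x p)

    <⇒0<- : ∀ {x y} → x < y → 0ℚ < y - x
    <⇒0<- {x} {y} p = ≤-<-trans (≤-reflexive (sym (ℚₚ.+-inverseʳ x))) (ℚₚ.+-monoˡ-< (ℚ.- x) p)

    0<-⇒< : ∀ {x y} → 0ℚ < y - x → x < y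
    0<-⇒< {x} {y} p = subst₂ _<_ (+-identityˡ x) (-+ x y) (ℚₚ.+-monoˡ-< x p)

    *-monoˡ : ∀ {x y} z → 0ℚ ≤ z → x ≤ y → z * x ≤ z * y
    *-monoˡ z p = ℚₚ.*-monoˡ-≤-nonNeg z {{nonNegative p}}

    *-monoʳ : ∀ {x y} z → 0ℚ ≤ z → x ≤ y → x * z ≤ y * z
    *-monoʳ z p = ℚₚ.*-monoʳ-≤-nonNeg z {{nonNegative p}}

    cancel-≤ : ∀ z {x y} → 0ℚ < z → z * x ≤ z * y → x ≤ y
    cancel-≤ z p = ℚₚ.*-cancelˡ-≤-pos z {{positive p}}

    cancel-< : ∀ z {x y} → 0ℚ < z → z * x < z * y → x < y
    cancel-< z p = ℚₚ.*-cancelˡ-<-nonNeg z {{nonNegative (<⇒≤ p)}}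

  ι : ℕ → ℚ
  ι n = ιℤ (+ n)

  ι-suc : ∀ n → ι (suc n) ≡ 1ℚ + ι n
  ι-suc n = trans (ιℤ-+ (+ 1) (+ n)) (cong (_+ ι n) ιℤ-1)

  ι-+ : ∀ m n → ι (m ℕ.+ n) ≡ ι m + ι n
  ι-+ m n = ιℤ-+ (+ m) (+ n)

  ι-* : ∀ m n → ι (m ℕ.* n) ≡ ι m * ι n
  ι-* m n = trans (cong ιℤ (ℤₚ.pos-* m n)) (ιℤ-* (+ m) (+ n))

  ι>0 : ∀ n → 0ℚ < ι (suc n)
  ι>0 n = subst (_< ι (suc n)) ιℤ-0 (ιℤ-mono-< (ℤ.+<+ (ℕ.s≤s ℕ.z≤n)))

  ι≥0 : ∀ n → 0ℚ ≤ ι n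
  ι≥0 zero    = ≤-reflexive (sym ιℤ-0)
  ι≥0 (suc n) = <⇒≤ (ι>0 n)

  0<1 : 0ℚ < 1ℚ
  0<1 = subst (0ℚ <_) ιℤ-1 (ι>0 0)

  0≤+ : ∀ {x y} → 0ℚ ≤ x → 0ℚ ≤ y → 0ℚ ≤ x + y
  0≤+ p q = ≤-trans (≤-reflexive (sym (+-identityˡ 0ℚ))) (+-mono-≤ p q)

  ι-mono : ∀ {m n} → m ℕ.≤ n → ι m ≤ ι n
  ι-mono {m} m≤n with ℕₚ.m≤n⇒∃[o]m+o≡n m≤n
  ... | o , refl = ≤-trans (≤-reflexive (sym (+-identityʳ (ι m))))
    (≤-trans (+-mono-≤ (≤-refl {ι m}) (ι≥0 o)) (≤-reflexive (sym (ι-+ m o))))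

  cancel-≡ : ∀ z {x y} → 0ℚ < z → z * x ≡ z * y → x ≡ y
  cancel-≡ z p e = ≤-antisym (cancel-≤ z p (≤-reflexive e)) (cancel-≤ z p (≤-reflexive (sym e)))

  private
    ι-suc-nonZero : ∀ n → NonZero (ι (suc n))
    ι-suc-nonZero n = ℚₚ.pos⇒nonZero (ι (suc n)) {{positive (ι>0 n)}}

  opaque
    unfolding _+_

    recip : ℕ → ℚ
    recip n = 1/_ (ι (suc n)) {{ι-suc-nonZero n}}

    recip-inverse : ∀ n → ι (suc n) * recip n ≡ 1ℚ
    recip-inverse n = ℚₚ.*-inverseʳ (ι (suc n)) {{ι-suc-nonZero n}}

  +-congˡ : ∀ {x y z} → y ≡ z → x + y ≡ x + z
  +-congˡ refl = refl

  +-congʳ : ∀ {x y z} → y ≡ z → y + x ≡ z + x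
  +-congʳ refl = refl

  *-congˡ : ∀ {x y z} → y ≡ z → x * y ≡ x * z
  *-congˡ refl = refl

  *-congʳ : ∀ {x y z} → y ≡ z → y * x ≡ z * x
  *-congʳ refl = refl

  opaque
    unfolding _+_

    *-identityʳ : ∀ x → x * 1ℚ ≡ x
    *-identityʳ = ℚₚ.*-identityʳ

    0-diff : ∀ {x y} → x ≡ y → x - y ≡ 0ℚ
    0-diff {x} refl = ℚₚ.+-inverseʳ x

    diff-0 : ∀ {x y} → x - y ≡ 0ℚ → x ≡ y
    diff-0 {x} {y} p = trans (sym (-+ y x)) (trans (cong (ℚ._+ y) p) (ℚₚ.+-identityˡ y))

  opaque
    unfolding _+_

    +-mono-<-≤ : ∀ {x y u v} → x < y → u ≤ v → x + u < y + v
    +-mono-<-≤ = ℚₚ.+-mono-<-≤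

  *-monoˡ-< : ∀ {x y} z → 0ℚ < z → x < y → z * x < z * y
  *-monoˡ-< {x} {y} z p q = 0<-⇒< (subst (0ℚ <_) (r z y x) (0<* p (<⇒0<- q)))
    where
    opaque
      unfolding _+_
      r : ∀ z y x → z * (y - x) ≡ z * y - z * x
      r = solve-∀ ring

-- The normalised coefficient: size recursion, reversal, product rule

module Coefficient where

  open SealedRational
  open import Data.Nat as ℕ using (ℕ; zero; suc)
  import Data.Nat.Properties as ℕₚ
  open import Data.Nat.Tactic.RingSolver using () renaming (solve-∀ to solveℕ)
  open import Data.Rational using (ℚ; 0ℚ; 1ℚ)
  open import Data.List using (List; []; _∷_; _ʳ++_)
  open import Relation.Binary.PropositionalEquality
  open import Tactic.RingSolver using (solve-∀)

  -- An entry p preceded or followed by d counts p + 2, so that the word (p,B) of degree r has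
  -- r + 1 = suc (p + wt B).
  wt : List ℕ → ℕ
  wt []      = 0
  wt (b ∷ B) = suc (suc (b ℕ.+ wt B))

  -- lowering 0 would give a negative entry and contributes 0
  low : (ℕ → ℚ) → ℕ → ℚ
  low g zero    = 0ℚ
  low g (suc n) = g n

  -- Σ of h over the reductions of (p,B) other than the lowering of p itself
  side : (ℕ → List ℕ → ℚ) → ℕ → List ℕ → ℚ
  side h p []      = 0ℚ
  side h p (b ∷ B) = h (suc (p ℕ.+ b)) B
    + (low (λ b′ → h p (b′ ∷ B)) b + side (λ y Y → h p (y ∷ Y)) b B)

  -- One induction for all termwise comparisons: R becomes equality, non-negativity, or an
  -- inequality between multiples. The head never drops below p, because the lowering of p is left
  -- out and a merge only raises it; the size drops by exactly one, which feeds the inductions on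
  -- size.
  side-lift : (R : ℚ → ℚ → Set) → R 0ℚ 0ℚ →
    (∀ {a b c d} → R a b → R c d → R (a + c) (b + d)) →
    ∀ {h h′} p B → (∀ y Y → p ℕ.≤ y → suc (y ℕ.+ wt Y) ≡ p ℕ.+ wt B → R (h y Y) (h′ y Y)) →
    R (side h p B) (side h′ p B)
  side-lift R R0 R+ p []      H = R0
  side-lift R R0 R+ {h} {h′} p (b ∷ B) H =
    R+ (H (suc (p ℕ.+ b)) B (ℕₚ.m≤n⇒m≤1+n (ℕₚ.m≤m+n p b)) (e₁ p b (wt B)))
       (R+ (lowR b refl)
           (side-lift R R0 R+ b B λ y Y _ e → H p (y ∷ Y) ℕₚ.≤-refl
             (trans (e₂ p y (wt Y)) (cong (λ k → p ℕ.+ suc (suc k)) e))))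
    where
    e₁ : ∀ p b w → suc (suc (p ℕ.+ b) ℕ.+ w) ≡ p ℕ.+ suc (suc (b ℕ.+ w))
    e₁ = solveℕ
    e₂ : ∀ p y w → suc (p ℕ.+ suc (suc (y ℕ.+ w))) ≡ p ℕ.+ suc (suc (suc (y ℕ.+ w)))
    e₂ = solveℕ
    lowR : ∀ c → c ≡ b → R (low (λ b′ → h p (b′ ∷ B)) c) (low (λ b′ → h′ p (b′ ∷ B)) c)
    lowR zero    _    = R0
    lowR (suc c) refl = H p (c ∷ B) ℕₚ.≤-refl (e₂ p c (wt B))

  side-cong : ∀ {h h′} p B → (∀ y Y → suc (y ℕ.+ wt Y) ≡ p ℕ.+ wt B → h y Y ≡ h′ y Y) →
    side h p B ≡ side h′ p B
  side-cong p B e = side-lift _≡_ refl (cong₂ _+_) p B λ y Y _ → e y Y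

  side-cong′ : ∀ {h h′} p B → (∀ y Y → h y Y ≡ h′ y Y) → side h p B ≡ side h′ p B
  side-cong′ p B e = side-cong p B λ y Y _ → e y Y

  low-cong : ∀ {g g′} n → (∀ m → suc m ≡ n → g m ≡ g′ m) → low g n ≡ low g′ n
  low-cong zero    e = refl
  low-cong (suc n) e = e n refl

  side-0 : ∀ p B → side (λ _ _ → 0ℚ) p B ≡ 0ℚ
  side-0 p []      = refl
  side-0 p (b ∷ B) = trans (+-identityˡ _) (trans (cong₂ _+_ (low-0 b) (side-0 b B)) (+-identityˡ 0ℚ))
    where
    low-0 : ∀ b → low (λ _ → 0ℚ) b ≡ 0ℚ
    low-0 zero    = refl
    low-0 (suc b) = refl

  private
    opaque
      unfolding _+_
      swap₄ : ∀ a b c d → (a + b) + (c + d) ≡ (a + c) + (b + d)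
      swap₄ = solve-∀ ring

  side-+ : ∀ {h h′} p B → side (λ y Y → h y Y + h′ y Y) p B ≡ side h p B + side h′ p B
  side-+ p []      = sym (+-identityˡ 0ℚ)
  side-+ {h} {h′} p (b ∷ B) =
    trans (+-congˡ (trans (cong₂ _+_ (low-+ b) (side-+ b B)) (swap₄ _ _ _ _))) (swap₄ _ _ _ _)
    where
    low-+ : ∀ c → low (λ b′ → h p (b′ ∷ B) + h′ p (b′ ∷ B)) c
                ≡ low (λ b′ → h p (b′ ∷ B)) c + low (λ b′ → h′ p (b′ ∷ B)) c
    low-+ zero    = sym (+-identityˡ 0ℚ)
    low-+ (suc c) = refl

  low-*ˡ : ∀ x {g} n → low (λ m → x * g m) n ≡ x * low g n
  low-*ˡ x zero    = sym (*-zeroʳ x)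
  low-*ˡ x (suc n) = refl

  low-*ʳ : ∀ x {g} n → low (λ m → g m * x) n ≡ low g n * x
  low-*ʳ x zero    = sym (*-zeroˡ x)
  low-*ʳ x (suc n) = refl

  side-*ˡ : ∀ x {h} p B → side (λ y Y → x * h y Y) p B ≡ x * side h p B
  side-*ˡ x p []      = sym (*-zeroʳ x)
  side-*ˡ x {h} p (b ∷ B) = trans
    (+-congˡ (trans (cong₂ _+_ (low-*ˡ x b) (side-*ˡ x b B)) (sym (*-distribˡ-+ x _ _))))
    (sym (*-distribˡ-+ x _ _))

  side-*ʳ : ∀ x {h} p B → side (λ y Y → h y Y * x) p B ≡ side h p B * x
  side-*ʳ x p B = trans (side-cong′ p B (λ _ _ → *-comm _ x)) (trans (side-*ˡ x p B) (*-comm x _))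

  side-shift : ∀ {h} k p B → side (λ y Y → h (suc (y ℕ.+ k)) Y) p B ≡ side h (suc (p ℕ.+ k)) B
  side-shift k p []      = refl
  side-shift {h} k p (b ∷ B) = +-congʳ (cong (λ j → h j B) (e p b k))
    where
    e : ∀ p b k → suc (suc (p ℕ.+ b) ℕ.+ k) ≡ suc (suc (p ℕ.+ k) ℕ.+ b)
    e = solveℕ

  side-low-suc : ∀ {h : ℕ → List ℕ → ℚ} p B → side (λ y Y → low (λ z → h z Y) y) (suc p) B ≡ side h p B
  side-low-suc p []      = refl
  side-low-suc p (b ∷ B) = refl

  -- Only the merge of 0 with b changes the head 0 into something that can be lowered; the merged
  -- head suc b is then lowered back to b.
  side-low-zero : ∀ {h : ℕ → List ℕ → ℚ} b B → side (λ y Y → low (λ z → h z Y) y) zero (b ∷ B) ≡ h b B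
  side-low-zero {h} b B = trans (+-congˡ {h b B} (trans (cong₂ _+_ (low-0 b) (side-0 b B)) (+-identityˡ 0ℚ))) (+-identityʳ _)
    where
    low-0 : ∀ b → low (λ _ → 0ℚ) b ≡ 0ℚ
    low-0 zero    = refl
    low-0 (suc b) = refl

  -- The word c⁰ = (0) has no reducts; its value 1 is put into the size recursion by hand.
  unit : List ℕ → ℕ → List ℕ → ℚ
  unit A       p       (b ∷ B) = 0ℚ
  unit (a ∷ A) p       []      = 0ℚ
  unit []      (suc p) []      = 0ℚ
  unit []      zero    []      = 1ℚ

  unit-suc : ∀ A p B → unit A (suc p) B ≡ 0ℚ
  unit-suc A       p (b ∷ B) = refl
  unit-suc (a ∷ A) p []      = refl
  unit-suc []      p []      = refl

  unit-left : ∀ a A p B → unit (a ∷ A) p B ≡ 0ℚ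
  unit-left a A p []      = refl
  unit-left a A p (b ∷ B) = refl

  unit-comm : ∀ A p B → unit A p B ≡ unit B p A
  unit-comm []      p       []      = refl
  unit-comm []      p       (b ∷ B) = sym (unit-left b B p [])
  unit-comm (a ∷ A) p       []      = refl
  unit-comm (a ∷ A) p       (b ∷ B) = refl

  opaque
    -- The first argument is recursion depth. Every reduct has size exactly one less, so `fw` can
    -- fix the depth at r + 1 and independence of the depth never has to be proved.
    F : ℕ → List ℕ → ℚ
    F zero    _       = 0ℚ
    F (suc k) []      = 0ℚ
    F (suc k) (p ∷ B) = recip k * (unit [] p B + (low (λ y → F k (y ∷ B)) p + side (λ y Y → F k (y ∷ Y)) p B))

    fw : List ℕ → ℚ
    fw []      = 0ℚ
    fw (p ∷ B) = F (suc (p ℕ.+ wt B)) (p ∷ B)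

    fw-eq : ∀ p B → ι (suc (p ℕ.+ wt B)) * fw (p ∷ B)
      ≡ unit [] p B + (low (λ y → fw (y ∷ B)) p + side (λ y Y → fw (y ∷ Y)) p B)
    fw-eq p B = trans (sym (*-assoc _ _ _)) (trans (*-congʳ (recip-inverse _)) (trans (*-identityˡ _)
      (+-congˡ {unit [] p B} (cong₂ _+_
        (low-cong {λ y → F (p ℕ.+ wt B) (y ∷ B)} p λ { m refl → refl })
        (side-cong p B λ y Y e → cong (λ k → F k (y ∷ Y)) (sym e))))))

  -- A is stored nearest entry first: this is the value at (reverse A, p, B).
  f : List ℕ → ℕ → List ℕ → ℚ
  f A p B = fw (A ʳ++ (p ∷ B))

  sz : List ℕ → ℕ → List ℕ → ℕ
  sz A p B = suc (wt A ℕ.+ (p ℕ.+ wt B))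

  -- The sum runs over all reductions of the whole word, so the focus may sit anywhere. Moving it
  -- from a to its right neighbour p only regroups the terms: the merge of a and p passes from the
  -- right part to the left part.
  f-eq : ∀ A p B → ι (sz A p B) * f A p B
    ≡ unit A p B + (side (λ y Y → f Y y B) p A + (low (λ y → f A y B) p + side (λ y Y → f A y Y) p B))
  f-eq []      p B = trans (fw-eq p B) (cong (unit [] p B +_) (sym (+-identityˡ _)))
  f-eq (a ∷ A) p B =
    trans (cong (λ k → ι k * f A a (p ∷ B)) (e (wt A) a p (wt B)))
    (trans (f-eq A a (p ∷ B))
    (trans (cong (λ k → 0ℚ + (side (λ y Y → f Y y (p ∷ B)) a A + (low (λ y → f A y (p ∷ B)) a
               + (f A (suc k) B + (low (λ y → f A a (y ∷ B)) p + side (λ y Y → f A a (y ∷ Y)) p B)))))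
               (ℕₚ.+-comm a p))
    (trans (r _ _ _ _ _) (+-congʳ (sym (unit-left a A p B))))))
    where
    e : ∀ A a p B → suc (suc (suc (a ℕ.+ A)) ℕ.+ (p ℕ.+ B)) ≡ suc (A ℕ.+ (a ℕ.+ suc (suc (p ℕ.+ B))))
    e = solveℕ
    opaque
      unfolding _+_
      r : ∀ s l m lp sb → 0ℚ + (s + (l + (m + (lp + sb)))) ≡ 0ℚ + ((m + (l + s)) + (lp + sb))
      r = solve-∀ ring

  sz-comm : ∀ A p B → sz A p B ≡ sz B p A
  sz-comm A p B = e (wt A) p (wt B)
    where
    e : ∀ a p b → suc (a ℕ.+ (p ℕ.+ b)) ≡ suc (b ℕ.+ (p ℕ.+ a))
    e = solveℕ

  sz-right : ∀ {k} A p B y Y → sz A p B ≡ suc k → suc (y ℕ.+ wt Y) ≡ p ℕ.+ wt B → sz A y Y ≡ k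
  sz-right A p B y Y e e′ = ℕₚ.suc-injective (trans (r (wt A) y (wt Y)) (trans (cong (λ j → suc (wt A ℕ.+ j)) e′) e))
    where
    r : ∀ a y w → suc (suc (a ℕ.+ (y ℕ.+ w))) ≡ suc (a ℕ.+ suc (y ℕ.+ w))
    r = solveℕ

  sz-left : ∀ {k} A p B y Y → sz A p B ≡ suc k → suc (y ℕ.+ wt Y) ≡ p ℕ.+ wt A → sz Y y B ≡ k
  sz-left A p B y Y e e′ = trans (sz-comm Y y B) (sz-right B p A y Y (trans (sz-comm B p A) e) e′)

  sz-mid : ∀ {k} A p B y → sz A p B ≡ suc k → suc y ≡ p → sz A y B ≡ k
  sz-mid A p B y e refl = sz-right A p B y B e refl

  private
    f-rev′ : ∀ k A p B → sz A p B ≡ k → f A p B ≡ f B p A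
    f-rev′ zero    A p B ()
    f-rev′ (suc k) A p B e = cancel-≡ (ι (sz A p B)) (ι>0 _)
      (trans (f-eq A p B)
      (trans (cong₂ _+_ (unit-comm A p B) (cong₂ _+_
                (side-cong p A λ y Y e′ → f-rev′ k Y y B (sz-left A p B y Y e e′))
                (cong₂ _+_ (low-cong p λ m e′ → f-rev′ k A m B (sz-mid A p B m e e′))
                           (side-cong p B λ y Y e′ → f-rev′ k A y Y (sz-right A p B y Y e e′)))))
      (trans (r _ _ _ _) (sym (trans (cong (λ j → ι j * f B p A) (sz-comm A p B)) (f-eq B p A))))))
      where
      opaque
        unfolding _+_
        r : ∀ u a l b → u + (a + (l + b)) ≡ u + (b + (l + a))
        r = solve-∀ ring

  f-rev : ∀ A p B → f A p B ≡ f B p A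
  f-rev A p B = f-rev′ _ A p B refl

  f-eq-suc : ∀ A p B → ι (sz A (suc p) B) * f A (suc p) B
    ≡ side (λ y Y → f Y y B) (suc p) A + (f A p B + side (λ y Y → f A y Y) (suc p) B)
  f-eq-suc A p B = trans (f-eq A (suc p) B) (trans (+-congʳ (unit-suc A p B)) (+-identityˡ _))

  -- Under the coproduct, c yields twice the empty pair, and d yields (1, c) and (c, 1). The three
  -- terms are the words that split into (A,p) and (q,B) by removing a c, or by breaking a d that
  -- leaves its c on the left or on the right. The second factor is written reversed, which makes
  -- the rule symmetric in (A,p) and (B,q).
  ProductRule : List ℕ → ℕ → List ℕ → ℕ → Set
  ProductRule A p B q = f A p [] * f B q [] ≡
    2ℚ * f A (suc (p ℕ.+ q)) B + (low (λ y → f A y (q ∷ B)) p + low (λ y → f B y (p ∷ A)) q)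

  -- For p = 0 the missing lowering of p is compensated by the merge of 0 with its left neighbour,
  -- or by the unit if there is none.
  private
    leftLow : List ℕ → ℕ → List ℕ → ℕ → ℚ
    leftLow A zero    B q = f A q B
    leftLow A (suc p) B q = side (λ y Y → f Y y (q ∷ B)) p A

    rightLow : List ℕ → ℕ → List ℕ → ℕ → ℚ
    rightLow A p B zero    = 0ℚ
    rightLow A p B (suc q) = side (λ y Y → f B q (y ∷ Y)) p A

    rule : List ℕ → ℕ → List ℕ → ℕ → ℚ
    rule A p B q = 2ℚ * f A (suc (p ℕ.+ q)) B + (low (λ y → f A y (q ∷ B)) p + low (λ y → f B y (p ∷ A)) q)

    -- The size recursion acts on the first factor only, and the inductive product rule is applied
    -- to each reduct. The mirrored instance treats the second factor; the two are added in
    -- `product-rule′`.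
    half : ∀ A p B q → (∀ Y y → suc (y ℕ.+ wt Y) ≡ p ℕ.+ wt A → ProductRule Y y B q) →
      ι (sz A p []) * (f A p [] * f B q []) ≡
        2ℚ * side (λ y Y → f Y y B) (suc (p ℕ.+ q)) A
        + (leftLow A p B q + (rightLow A p B q + low (λ y → rule A y B q) p))
    half A p B q IH = trans (sym (*-assoc _ _ _)) (trans (cong (_* f B q []) (f-eq A p []))
      (trans (r₁ _ _ _ _)
      (trans (cong₂ _+_ refl (cong₂ _+_ sideEq lowEq))
      (trans (r₂ _ _ _ _ _) (+-congˡ (+-congʳ (leftEq p)))))))
      where
      opaque
        unfolding _+_
        r₁ : ∀ u s l c → (u + (s + (l + 0ℚ))) * c ≡ u * c + (s * c + l * c)
        r₁ = solve-∀ ring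
      opaque
        unfolding _+_
        r₂ : ∀ u a b c d → u + ((a + (b + c)) + d) ≡ a + ((u + b) + (c + d))
        r₂ = solve-∀ ring
      rightEq : ∀ q → side (λ y Y → low (λ z → f B z (y ∷ Y)) q) p A ≡ rightLow A p B q
      rightEq zero    = side-0 p A
      rightEq (suc q) = refl
      sideEq : side (λ y Y → f Y y []) p A * f B q [] ≡
        2ℚ * side (λ y Y → f Y y B) (suc (p ℕ.+ q)) A
        + (side (λ y Y → low (λ z → f Y z (q ∷ B)) y) p A + rightLow A p B q)
      sideEq = trans (sym (side-*ʳ (f B q []) p A))
        (trans (side-cong p A λ y Y e → IH Y y e)
        (trans (side-+ p A) (cong₂ _+_
          (trans (side-*ˡ 2ℚ p A) (cong (2ℚ *_) (side-shift {λ y Y → f Y y B} q p A)))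
          (trans (side-+ p A) (+-congˡ (rightEq q))))))
      lowEq : low (λ y → f A y []) p * f B q [] ≡ low (λ y → rule A y B q) p
      lowEq = trans (sym (low-*ʳ (f B q []) p)) (low-cong p λ { y refl → IH A y refl })
      leftEq : ∀ p → unit A p [] * f B q [] + side (λ y Y → low (λ z → f Y z (q ∷ B)) y) p A
        ≡ leftLow A p B q
      leftEq (suc p) = trans (cong₂ _+_ (trans (cong (_* f B q []) (unit-suc A p [])) (*-zeroˡ (f B q [])))
                                        (side-low-suc {λ z Y → f Y z (q ∷ B)} p A)) (+-identityˡ _)
      leftEq zero = z A
        where
        z : ∀ A → unit A zero [] * f B q [] + side (λ y Y → low (λ z → f Y z (q ∷ B)) y) zero A ≡ f A q B
        z []      = trans (+-identityʳ _) (trans (*-identityˡ _) (f-rev B q []))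
        z (a ∷ A) = trans (cong₂ _+_ (*-zeroˡ (f B q [])) (side-low-zero {λ z Y → f Y z (q ∷ B)} a A)) (+-identityˡ _)

    product-rule′ : ∀ k A p B q → sz A p [] ℕ.+ sz B q [] ≡ k → ProductRule A p B q
    product-rule′ zero    A p B q ()
    -- All three words of the rule have size s, the sum of the sizes of the two factors.
    -- Multiplication by s therefore lets the size recursion act on both sides.
    product-rule′ (suc k) A p B q e = cancel-≡ (ι s) (ι>0 _)
      (trans (r₀ (ι (sz A p [])) (ι (sz B q [])) _ _ (ι s) (sym (ι-+ (sz A p []) (sz B q []))))
      (trans (cong₂ _+_ (half A p B q IHl) (half B q A p IHr)) (final p q refl refl)))
      where
      s = sz A p [] ℕ.+ sz B q []
      r₀ : ∀ a b x y c → a + b ≡ c → c * (x * y) ≡ a * (x * y) + b * (y * x)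
      r₀ a b x y c refl = r a b x y
        where
        opaque
          unfolding _+_
          r : ∀ a b x y → (a + b) * (x * y) ≡ a * (x * y) + b * (y * x)
          r = solve-∀ ring
      IHl : ∀ Y y → suc (y ℕ.+ wt Y) ≡ p ℕ.+ wt A → ProductRule Y y B q
      IHl Y y e′ = product-rule′ k Y y B q
        (ℕₚ.suc-injective (trans (cong (λ j → suc (j ℕ.+ sz B q [])) (sz-left A p [] y Y refl e′)) e))
      IHr : ∀ Y y → suc (y ℕ.+ wt Y) ≡ q ℕ.+ wt B → ProductRule Y y A p
      IHr Y y e′ = product-rule′ k Y y A p
        (ℕₚ.suc-injective (trans (cong (λ j → suc (j ℕ.+ sz A p [])) (sz-left B q [] y Y refl e′))
          (trans (ℕₚ.+-comm (sz B q []) (sz A p [])) e)))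
      mergeEq : ∀ x p q → x ≡ p ℕ.+ q → f B x A ≡ f A (p ℕ.+ q) B
      mergeEq x p q refl = f-rev B _ A
      szm : ∀ a p b q → suc (a ℕ.+ (suc (p ℕ.+ q) ℕ.+ b)) ≡ suc (a ℕ.+ (p ℕ.+ 0)) ℕ.+ suc (b ℕ.+ (q ℕ.+ 0))
      szm = solveℕ
      szl : ∀ a p b q → suc (a ℕ.+ (p ℕ.+ suc (suc (q ℕ.+ b)))) ≡ suc (a ℕ.+ (suc p ℕ.+ 0)) ℕ.+ suc (b ℕ.+ (q ℕ.+ 0))
      szl = solveℕ
      szr : ∀ a p b q → suc (b ℕ.+ (q ℕ.+ suc (suc (p ℕ.+ a)))) ≡ suc (a ℕ.+ (p ℕ.+ 0)) ℕ.+ suc (b ℕ.+ (suc q ℕ.+ 0))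
      szr = solveℕ
      sideRev : ∀ p q → side (λ y Y → f Y y A) (suc (q ℕ.+ p)) B ≡ side (λ y Y → f A y Y) (suc (p ℕ.+ q)) B
      sideRev p q = trans (side-cong′ _ B λ y Y → f-rev Y y A)
                          (cong (λ j → side (λ y Y → f A y Y) (suc j) B) (ℕₚ.+-comm q p))
      mEq : ∀ p q → ι (sz A p [] ℕ.+ sz B q []) * f A (suc (p ℕ.+ q)) B ≡
        side (λ y Y → f Y y B) (suc (p ℕ.+ q)) A + (f A (p ℕ.+ q) B + side (λ y Y → f Y y A) (suc (q ℕ.+ p)) B)
      mEq p q = trans (cong (λ j → ι j * f A (suc (p ℕ.+ q)) B) (sym (szm (wt A) p (wt B) q)))
        (trans (f-eq-suc A (p ℕ.+ q) B) (+-congˡ (+-congˡ (sym (sideRev p q)))))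
      lEq : ∀ p q → ι (sz A (suc p) [] ℕ.+ sz B q []) * f A p (q ∷ B) ≡
        side (λ y Y → f Y y (q ∷ B)) p A + (low (λ y → f A y (q ∷ B)) p
        + (f A (suc p ℕ.+ q) B + (low (λ y → f A p (y ∷ B)) q + side (λ y Y → f A p (y ∷ Y)) q B)))
      lEq p q = trans (cong (λ j → ι j * f A p (q ∷ B)) (sym (szl (wt A) p (wt B) q)))
        (trans (f-eq A p (q ∷ B)) (+-identityˡ _))
      rEq : ∀ p q → ι (sz A p [] ℕ.+ sz B (suc q) []) * f B q (p ∷ A) ≡
        side (λ y Y → f Y y (p ∷ A)) q B + (low (λ y → f B y (p ∷ A)) q
        + (f A (p ℕ.+ suc q) B + (low (λ y → f B q (y ∷ A)) p + side (λ y Y → f B q (y ∷ Y)) p A)))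
      rEq p q = trans (cong (λ j → ι j * f B q (p ∷ A)) (sym (szr (wt A) p (wt B) q)))
        (trans (trans (f-eq B q (p ∷ A)) (+-identityˡ _))
          (+-congˡ (+-congˡ (+-congʳ (mergeEq (suc (q ℕ.+ p)) p (suc q) (ℕₚ.+-comm (suc q) p))))))
      rev2 : ∀ p q → 2ℚ * f B (suc (q ℕ.+ p)) A ≡ 2ℚ * f A (p ℕ.+ suc q) B
      rev2 p q = cong (2ℚ *_) (mergeEq (suc (q ℕ.+ p)) p (suc q) (ℕₚ.+-comm (suc q) p))
      -- The delicate term is f(A,p+q,B). For positive p and q it occurs four times: twice in each
      -- half, and on the other side twice from lowering p + q + 1 and once from each of the two
      -- merges. If an exponent is 0, its half supplies one copy through `leftLow`, and one merge is
      -- missing on the other side. The split is on copies of p and q so that the lemmas above stay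
      -- in scope.
      final : ∀ p′ q′ → p′ ≡ p → q′ ≡ q →
        (2ℚ * side (λ y Y → f Y y B) (suc (p ℕ.+ q)) A
          + (leftLow A p B q + (rightLow A p B q + low (λ y → rule A y B q) p)))
        + (2ℚ * side (λ y Y → f Y y A) (suc (q ℕ.+ p)) B
          + (leftLow B q A p + (rightLow B q A p + low (λ y → rule B y A p) q)))
        ≡ ι s * rule A p B q
      final zero zero refl refl = trans (+-congˡ (+-congˡ (+-congʳ (f-rev B 0 A))))
        (sym (trans (*-distribˡ-+ (ι s) _ _)
        (trans (+-congʳ (trans (x2 (ι s) _) (*-congˡ (mEq 0 0)))) (r _ _ _ _))))
        where
        opaque
          unfolding _+_
          x2 : ∀ s x → s * (2ℚ * x) ≡ 2ℚ * (s * x)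
          x2 = solve-∀ ring
        opaque
          unfolding _+_
          r : ∀ a m b s → 2ℚ * (a + (m + b)) + s * (0ℚ + 0ℚ)
            ≡ (2ℚ * a + (m + (0ℚ + 0ℚ))) + (2ℚ * b + (m + (0ℚ + 0ℚ)))
          r = solve-∀ ring
      final zero (suc q) refl refl =
        trans (+-congˡ (+-congˡ (+-congˡ (+-congˡ (+-congʳ (rev2 0 q))))))
        (sym (trans (x (ι s) _ _)
        (trans (cong₂ (λ u v → 2ℚ * u + v) (mEq 0 (suc q)) (rEq 0 q)) (r _ _ _ _ _ _))))
        where
        opaque
          unfolding _+_
          x : ∀ s a c → s * (2ℚ * a + (0ℚ + c)) ≡ 2ℚ * (s * a) + s * c
          x = solve-∀ ring
        opaque
          unfolding _+_
          r : ∀ a m b c l d → 2ℚ * (a + (m + b)) + (c + (l + (m + (0ℚ + d))))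
            ≡ (2ℚ * a + (m + (d + 0ℚ))) + (2ℚ * b + (c + (0ℚ + (2ℚ * m + (l + 0ℚ)))))
          r = solve-∀ ring
      final (suc p) zero refl refl =
        trans (+-congˡ (+-congˡ (+-congʳ (mergeEq (suc p) (suc p) 0 (sym (ℕₚ.+-identityʳ (suc p)))))))
        (sym (trans (x (ι s) _ _)
        (trans (cong₂ (λ u v → 2ℚ * u + v) (mEq (suc p) 0) (lEq p 0)) (r _ _ _ _ _ _))))
        where
        opaque
          unfolding _+_
          x : ∀ s a c → s * (2ℚ * a + (c + 0ℚ)) ≡ 2ℚ * (s * a) + s * c
          x = solve-∀ ring
        opaque
          unfolding _+_
          r : ∀ a m b c l d → 2ℚ * (a + (m + b)) + (c + (l + (m + (0ℚ + d))))
            ≡ (2ℚ * a + (c + (0ℚ + (2ℚ * m + (l + 0ℚ))))) + (2ℚ * b + (m + (d + 0ℚ)))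
          r = solve-∀ ring
      final (suc p) (suc q) refl refl =
        trans (+-congˡ (+-congˡ (+-congˡ (+-congˡ (+-congʳ (rev2 (suc p) q))))))
        (sym (trans (x (ι s) _ _ _)
        (trans (cong₂ (λ u v → 2ℚ * u + v) (mEq (suc p) (suc q)) (cong₂ _+_ (lEq p (suc q)) (rEq (suc p) q)))
          (r _ _ _ _ _ _ _ _ _ _ _))))
        where
        opaque
          unfolding _+_
          x : ∀ s a b c → s * (2ℚ * a + (b + c)) ≡ 2ℚ * (s * a) + (s * b + s * c)
          x = solve-∀ ring
        opaque
          unfolding _+_
          r : ∀ a m b c l d e g n j k →
            2ℚ * (a + (m + b)) + ((c + (l + (m + (d + e)))) + (g + (n + (m + (j + k)))))
            ≡ (2ℚ * a + (c + (k + (2ℚ * m + (l + j))))) + (2ℚ * b + (g + (e + (2ℚ * m + (n + d)))))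
          r = solve-∀ ring

  product-rule : ∀ A p B q → ProductRule A p B q
  product-rule A p B q = product-rule′ _ A p B q refl

-- Positivity, linear bounds for one step of an exponent, and the traded recursion

module Bounds where

  open SealedRational
  open Coefficient
  open import Data.Nat as ℕ using (ℕ; zero; suc)
  import Data.Nat.Properties as ℕₚ
  open import Data.Nat.Tactic.RingSolver using () renaming (solve-∀ to solveℕ)
  open import Data.Rational using (ℚ; 0ℚ; 1ℚ; _≤_; _<_)
  open import Data.Rational.Properties using (≤-refl; ≤-reflexive; ≤-trans; <⇒≤)
  open import Data.List using (List; []; _∷_)
  open import Data.Sum using (inj₁; inj₂)
  open import Relation.Binary.PropositionalEquality
  open import Tactic.RingSolver using (solve-∀)

  low-nonneg : ∀ {g} n → (∀ m → suc m ≡ n → 0ℚ ≤ g m) → 0ℚ ≤ low g n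
  low-nonneg zero    H = ≤-refl
  low-nonneg (suc n) H = H n refl

  side-nonneg : ∀ {h} p B → (∀ y Y → suc (y ℕ.+ wt Y) ≡ p ℕ.+ wt B → 0ℚ ≤ h y Y) → 0ℚ ≤ side h p B
  side-nonneg {h} p B H = side-lift (λ _ y → 0ℚ ≤ y) ≤-refl 0≤+ {h} p B λ y Y _ → H y Y

  side-mono : ∀ c d {h h′} p B →
    (∀ y Y → p ℕ.≤ y → suc (y ℕ.+ wt Y) ≡ p ℕ.+ wt B → h y Y * c ≤ h′ y Y * d) →
    side h p B * c ≤ side h′ p B * d
  side-mono c d = side-lift (λ x y → x * c ≤ y * d)
    (≤-reflexive (trans (*-zeroˡ c) (sym (*-zeroˡ d))))
    (λ {x} {y} {u} {v} p q → subst₂ _≤_ (sym (dist x u c)) (sym (dist y v d)) (+-mono-≤ p q))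
    where
    opaque
      unfolding _+_
      dist : ∀ x y z → (x + y) * z ≡ x * z + y * z
      dist = solve-∀ ring

  side-suc : ∀ {h} p B → side (λ y Y → h (suc y) Y) p B ≡ side h (suc p) B
  side-suc p []      = refl
  side-suc p (b ∷ B) = refl

  0≤2 : 0ℚ ≤ 2ℚ
  0≤2 = subst (0ℚ ≤_) (sym 2ℚ-def) (0≤+ (<⇒≤ 0<1) (<⇒≤ 0<1))

  0<2 : 0ℚ < 2ℚ
  0<2 = subst (0ℚ <_) (sym 2ℚ-def) (0<+ 0<1 (<⇒≤ 0<1))

  -- e n = 1 / (n + 1)!
  e : ℕ → ℚ
  e n = f [] n []

  private
    -- Every word except c⁰ has a reduct: p can be lowered, or p = 0 has a neighbour to merge with.
    -- For c⁰ the `unit` is positive.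
    f-pos′ : ∀ k A p B → sz A p B ≡ k → 0ℚ < f A p B
    f-pos′ zero    A p B ()
    f-pos′ (suc k) A p B eq = cancel-< (ι (sz A p B)) (ι>0 _)
      (subst₂ _<_ (sym (*-zeroʳ _)) (sym (f-eq A p B)) (pos A p B refl refl refl))
      where
      left≥0 : 0ℚ ≤ side (λ y Y → f Y y B) p A
      left≥0 = side-nonneg p A λ y Y e′ → <⇒≤ (f-pos′ k Y y B (sz-left A p B y Y eq e′))
      right≥0 : 0ℚ ≤ side (λ y Y → f A y Y) p B
      right≥0 = side-nonneg p B λ y Y e′ → <⇒≤ (f-pos′ k A y Y (sz-right A p B y Y eq e′))
      low≥0 : 0ℚ ≤ low (λ y → f A y B) p
      low≥0 = low-nonneg p λ m e′ → <⇒≤ (f-pos′ k A m B (sz-mid A p B m eq e′))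
      0≤unit : ∀ A p B → 0ℚ ≤ unit A p B
      0≤unit A       p       (b ∷ B) = ≤-refl
      0≤unit (a ∷ A) p       []      = ≤-refl
      0≤unit []      (suc p) []      = ≤-refl
      0≤unit []      zero    []      = <⇒≤ 0<1
      drop : ∀ {x y} → 0ℚ ≤ x → 0ℚ < y → 0ℚ < x + y
      drop {x} {y} p q = subst (0ℚ <_) (+-comm y x) (0<+ q p)
      merge : ∀ p b B → suc (suc (p ℕ.+ b) ℕ.+ wt B) ≡ p ℕ.+ wt (b ∷ B)
      merge p b B = r p b (wt B)
        where
        r : ∀ p b w → suc (suc (p ℕ.+ b) ℕ.+ w) ≡ p ℕ.+ suc (suc (b ℕ.+ w))
        r = solveℕ
      pos : ∀ A′ p′ B′ → A′ ≡ A → p′ ≡ p → B′ ≡ B →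
        0ℚ < unit A p B + (side (λ y Y → f Y y B) p A + (low (λ y → f A y B) p + side (λ y Y → f A y Y) p B))
      pos A′ (suc p′) B′ refl refl refl = drop (0≤unit A p B) (drop left≥0 (0<+ (f-pos′ k A p′ B (sz-mid A p B p′ eq refl)) right≥0))
      pos [] zero [] refl refl refl = 0<+ 0<1 (0≤+ left≥0 (0≤+ low≥0 right≥0))
      pos [] zero (b ∷ B′) refl refl refl = drop (0≤unit A p B) (drop left≥0 (drop low≥0
        (0<+ (f-pos′ k A (suc (p ℕ.+ b)) B′ (sz-right A p B _ B′ eq (merge p b B′)))
          (0≤+ (low-nonneg b λ m e′ → <⇒≤ (f-pos′ k A p (m ∷ B′) (sz-right A p B p (m ∷ B′) eq (shr m e′))))
            (side-nonneg b B′ λ y Y e′ → <⇒≤ (f-pos′ k A p (y ∷ Y) (sz-right A p B p (y ∷ Y) eq (cong (λ j → suc (suc j)) e′))))))))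
        where
        shr : ∀ m → suc m ≡ b → suc (suc (suc (m ℕ.+ wt B′))) ≡ suc (suc (b ℕ.+ wt B′))
        shr m refl = refl
      pos (a ∷ A′) zero B′ refl refl refl = drop (0≤unit A p B) (0<+
        (0<+ (f-pos′ k A′ (suc (p ℕ.+ a)) B (sz-left A p B _ A′ eq (merge p a A′)))
          (0≤+ (low-nonneg a λ m e′ → <⇒≤ (f-pos′ k (m ∷ A′) p B (sz-left A p B p (m ∷ A′) eq (shr m e′))))
            (side-nonneg a A′ λ y Y e′ → <⇒≤ (f-pos′ k (y ∷ Y) p B (sz-left A p B p (y ∷ Y) eq (cong (λ j → suc (suc j)) e′))))))
        (0≤+ low≥0 right≥0))
        where
        shr : ∀ m → suc m ≡ a → suc (suc (suc (m ℕ.+ wt A′))) ≡ suc (suc (a ℕ.+ wt A′))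
        shr m refl = refl

  f>0 : ∀ A p B → 0ℚ < f A p B
  f>0 A p B = f-pos′ _ A p B refl

  f≥0 : ∀ A p B → 0ℚ ≤ f A p B
  f≥0 A p B = <⇒≤ (f>0 A p B)

  e-suc : ∀ n → ι (suc (suc n)) * e (suc n) ≡ e n
  e-suc n = trans (cong (λ j → ι (suc (suc j)) * e (suc n)) (sym (ℕₚ.+-identityʳ n)))
    (trans (f-eq-suc [] n []) (r _))
    where
    opaque
      unfolding _+_
      r : ∀ x → 0ℚ + (x + 0ℚ) ≡ x
      r = solve-∀ ring

  e-zero : e 0 ≡ 1ℚ
  e-zero = trans (sym (*-identityˡ _)) (trans (*-congʳ (sym ιℤ-1)) (trans (f-eq [] 0 []) r))
    where
    opaque
      unfolding _+_
      r : 1ℚ + (0ℚ + (0ℚ + 0ℚ)) ≡ 1ℚ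
      r = refl

  ι2 : ι 2 ≡ 2ℚ
  ι2 = trans (ι-suc 1) (trans (+-congˡ ιℤ-1) (sym 2ℚ-def))

  -- the product rule at (0|q+1), (0|q+2) and (1|q+1)
  f-one : ∀ q B → 2ℚ * f [] 1 (q ∷ B) ≡ f [] 0 (q ∷ B)
  f-one q B = r _ _ _ _ _ _
    (trans (cong₂ _*_ (sym e-zero) (f-rev [] (suc q) B))
      (trans (product-rule [] 0 B (suc q)) (+-congˡ (+-congˡ (f-rev B q (0 ∷ []))))))
    (trans (cong₂ _*_ (sym e-zero) (f-rev [] (suc (suc q)) B))
      (trans (product-rule [] 0 B (suc (suc q))) (+-congˡ (+-congˡ (f-rev B (suc q) (0 ∷ []))))))
    (trans (*-congˡ (f-rev [] (suc q) B)) (trans (product-rule [] 1 B (suc q)) (+-congˡ (+-congˡ (f-rev B q (1 ∷ []))))))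
    (trans (trans (*-congʳ (sym ι2)) (e-suc 0)) e-zero)
    where
    opaque
      unfolding _+_
      r′ : ∀ x₁ x₂ x₃ y₀ y₁ z e₁ →
        2ℚ * z - y₀ ≡ (1ℚ * x₁ - (2ℚ * x₂ + (0ℚ + y₀))) + 2ℚ * (1ℚ * x₂ - (2ℚ * x₃ + (0ℚ + y₁)))
          + (2ℚ * e₁ - 1ℚ) * x₁ - 2ℚ * (e₁ * x₁ - (2ℚ * x₃ + (y₁ + z)))
      r′ = solve-∀ ring
    r : ∀ x₁ x₂ x₃ y₁ e₁ z {y₀} → 1ℚ * x₁ ≡ 2ℚ * x₂ + (0ℚ + y₀) → 1ℚ * x₂ ≡ 2ℚ * x₃ + (0ℚ + y₁) →
      e₁ * x₁ ≡ 2ℚ * x₃ + (y₁ + z) → 2ℚ * e₁ ≡ 1ℚ → 2ℚ * z ≡ y₀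
    r x₁ x₂ x₃ y₁ e₁ z {y₀} p₁ p₂ p₃ p₄ = diff-0 (trans (r′ x₁ x₂ x₃ y₀ y₁ z e₁)
      (trans (cong₂ _-_ (cong₂ _+_ (cong₂ _+_ (0-diff p₁) (*-congˡ (0-diff p₂))) (*-congʳ (0-diff p₄))) (*-congˡ (0-diff p₃))) (z0 x₁)))
      where
      opaque
        unfolding _+_
        z0 : ∀ x → 0ℚ + 2ℚ * 0ℚ + 0ℚ * x - 2ℚ * 0ℚ ≡ 0ℚ
        z0 = solve-∀ ring

  private
    upper-kernel : ∀ s x y z S₁ S₂ c → (1ℚ + s) * x ≡ 0ℚ + (y + S₂) → s * y ≡ 0ℚ + (z + S₁) →
      0ℚ < 1ℚ + s → S₂ * (1ℚ + c) ≤ S₁ * 1ℚ → c * y ≤ z → (1ℚ + c) * x ≤ y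
    upper-kernel s x y z S₁ S₂ c p q s>0 h₁ h₂ = 0≤-⇒≤ (cancel-≤ (1ℚ + s) s>0
      (subst₂ _≤_ (sym (*-zeroʳ _)) (sym (trans (r s x y c) (trans (cong₂ (λ u v → y + u - (1ℚ + c) * v) q p) (r₂ y z S₁ S₂ c))))
        (0≤+ (≤⇒0≤- h₁) (≤⇒0≤- h₂))))
      where
      opaque
        unfolding _+_
        r : ∀ s x y c → (1ℚ + s) * (y - (1ℚ + c) * x) ≡ y + s * y - (1ℚ + c) * ((1ℚ + s) * x)
        r = solve-∀ ring
      opaque
        unfolding _+_
        r₂ : ∀ y z S₁ S₂ c → y + (0ℚ + (z + S₁)) - (1ℚ + c) * (0ℚ + (y + S₂)) ≡ (S₁ * 1ℚ - S₂ * (1ℚ + c)) + (z - c * y)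
        r₂ = solve-∀ ring

    -- Subtract j + 3 times the recursion for head j + 2 from the recursions for head j + 1. The
    -- side reducts pair up with heads y ≥ j + 1, where the inductive constant y + 2 is at least j +
    -- 3, so merges do no harm in this direction. A head 0 has no lowering to start the comparison;
    -- there the product rule gives equality.
    upper′ : ∀ k j N → j ℕ.+ wt N ≡ k → ι (suc (suc j)) * f [] (suc j) N ≤ f [] j N
    upper′ k zero [] _ = ≤-reflexive (e-suc 0)
    upper′ k zero (q ∷ B) _ = ≤-reflexive (trans (*-congʳ ι2) (f-one q B))
    upper′ zero (suc j) N ()
    upper′ (suc k) (suc j) N eq = subst (λ c → c * f [] (suc (suc j)) N ≤ f [] (suc j) N) (sym (ι-suc (suc (suc j))))
      (upper-kernel (ι (sz [] (suc j) N)) _ _ _ _ _ (ι (suc (suc j)))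
        (trans (*-congʳ (sym (ι-suc (sz [] (suc j) N)))) (f-eq-suc [] (suc j) N))
        (f-eq-suc [] j N)
        (subst (0ℚ <_) (ι-suc (sz [] (suc j) N)) (ι>0 _))
        (subst (λ t → t * (1ℚ + ι (suc (suc j))) ≤ side (λ y Y → f [] y Y) (suc j) N * 1ℚ) (side-suc {λ y Y → f [] y Y} (suc j) N)
          (side-mono _ _ {λ y Y → f [] (suc y) Y} {λ y Y → f [] y Y} (suc j) N λ y Y j<y e′ →
            ≤-trans (≤-reflexive (trans (*-comm _ _) (*-congʳ (sym (ι-suc (suc (suc j)))))))
            (≤-trans (*-monoʳ _ (f≥0 [] (suc y) Y) (ι-mono (ℕ.s≤s (ℕ.s≤s j<y))))
            (≤-trans (upper′ k y Y (ℕₚ.suc-injective (trans e′ eq))) (≤-reflexive (sym (*-identityʳ _)))))))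
        (upper′ k j N (ℕₚ.suc-injective eq)))

  upper : ∀ j N → ι (suc (suc j)) * f [] (suc j) N ≤ f [] j N
  upper j N = upper′ _ j N refl

  -- Twice the reductions within (b,B), less the lowering of b that the product rule uses up.
  trade : (ℕ → List ℕ → ℚ) → ℕ → List ℕ → ℚ
  trade h b B = low (λ y → h y B) b + 2ℚ * side h b B

  trade-mono : ∀ c d {h h′} b B →
    (∀ y Y → suc (y ℕ.+ wt Y) ≡ b ℕ.+ wt B → h y Y * c ≤ h′ y Y * d) →
    trade h b B * c ≤ trade h′ b B * d
  trade-mono c d {h} {h′} b B H = subst₂ _≤_ (r _ _ c) (r _ _ d)
    (+-mono-≤ (lowm b refl) (*-monoˡ 2ℚ 0≤2 (side-mono c d {h} {h′} b B λ y Y _ → H y Y)))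
    where
    opaque
      unfolding _+_
      r : ∀ l s c → l * c + 2ℚ * (s * c) ≡ (l + 2ℚ * s) * c
      r = solve-∀ ring
    lowm : ∀ b′ → b′ ≡ b → low (λ y → h y B) b′ * c ≤ low (λ y → h′ y B) b′ * d
    lowm zero     _    = ≤-reflexive (trans (*-zeroˡ c) (sym (*-zeroˡ d)))
    lowm (suc b′) refl = H b′ B refl

  trade-cong : ∀ {h h′} b B → (∀ y Y → h y Y ≡ h′ y Y) → trade h b B ≡ trade h′ b B
  trade-cong b B e = cong₂ _+_ (low-cong b λ m _ → e m B) (*-congˡ (side-cong′ b B e))

  -- Twice the size recursion with the merges at n eliminated by the product rule; every neighbour of n
  -- also uses up one of the two lowerings of n.
  traded₁ : ∀ n b B → 2ℚ * (ι (sz [] n (b ∷ B)) * f [] n (b ∷ B)) ≡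
    e n * f [] b B + (low (λ y → f [] y (b ∷ B)) n + trade (λ y Y → f (n ∷ []) y Y) b B)
  traded₁ n b B = trans (*-congˡ (f-eq [] n (b ∷ B))) (r _ _ _ _ _
    (trans (*-congˡ (f-rev [] b B)) (trans (product-rule [] n B b) (+-congˡ (+-congˡ (low-cong b λ y _ → f-rev B y (n ∷ [])))))))
    where
    opaque
      unfolding _+_
      r′ : ∀ l m lb s → 2ℚ * (0ℚ + (0ℚ + (l + (m + (lb + s))))) ≡ (2ℚ * m + (l + lb)) + (l + (lb + 2ℚ * s))
      r′ = solve-∀ ring
    r : ∀ l m lb s x → x ≡ 2ℚ * m + (l + lb) →
      2ℚ * (0ℚ + (0ℚ + (l + (m + (lb + s))))) ≡ x + (l + (lb + 2ℚ * s))
    r l m lb s x refl = r′ l m lb s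

  traded₁ˡ : ∀ a A n → 2ℚ * (ι (sz (a ∷ A) n []) * f (a ∷ A) n []) ≡
    e n * f A a [] + (low (λ y → f (a ∷ A) y []) n + trade (λ y Y → f Y y (n ∷ [])) a A)
  traded₁ˡ a A n = trans (*-congˡ (cong₂ (λ s x → ι s * x) (sz-comm (a ∷ A) n []) (f-rev (a ∷ A) n [])))
    (trans (traded₁ n a A) (cong₂ _+_ (*-congˡ (f-rev [] a A)) (cong₂ _+_
      (low-cong n λ y _ → f-rev [] y (a ∷ A)) (trade-cong a A λ y Y → f-rev (n ∷ []) y Y))))

  traded₂ : ∀ a A n b B → 2ℚ * (ι (sz (a ∷ A) n (b ∷ B)) * f (a ∷ A) n (b ∷ B)) ≡
    f A a [] * f [] n (b ∷ B) + (f (a ∷ A) n [] * f [] b B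
      + (trade (λ y Y → f Y y (n ∷ b ∷ B)) a A + trade (λ y Y → f (n ∷ a ∷ A) y Y) b B))
  traded₂ a A n b B = trans (*-congˡ (f-eq (a ∷ A) n (b ∷ B))) (r _ _ _ _ _ _ _ _ _
    (trans (*-congˡ (f-rev [] n (b ∷ B))) (trans (product-rule A a (b ∷ B) n)
      (cong₂ (λ u v → 2ℚ * u + (low (λ y → f A y (n ∷ b ∷ B)) a + v))
        (cong (λ j → f A (suc j) (b ∷ B)) (ℕₚ.+-comm a n)) (low-cong n λ y _ → f-rev (b ∷ B) y (a ∷ A)))))
    (trans (*-congˡ (f-rev [] b B)) (trans (product-rule (a ∷ A) n B b) (+-congˡ (+-congˡ (low-cong b λ y _ → f-rev B y (n ∷ a ∷ A)))))))
    where
    opaque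
      unfolding _+_
      r′ : ∀ m₁ la sa ln m₂ lb sb →
        2ℚ * (0ℚ + ((m₁ + (la + sa)) + (ln + (m₂ + (lb + sb))))) ≡
        (2ℚ * m₁ + (la + ln)) + ((2ℚ * m₂ + (ln + lb)) + ((la + 2ℚ * sa) + (lb + 2ℚ * sb)))
      r′ = solve-∀ ring
    r : ∀ m₁ la sa ln m₂ lb sb x y → x ≡ 2ℚ * m₁ + (la + ln) → y ≡ 2ℚ * m₂ + (ln + lb) →
      2ℚ * (0ℚ + ((m₁ + (la + sa)) + (ln + (m₂ + (lb + sb))))) ≡ x + (y + ((la + 2ℚ * sa) + (lb + 2ℚ * sb)))
    r m₁ la sa ln m₂ lb sb x y refl refl = r′ m₁ la sa ln m₂ lb sb

  private
    lower-kernel : ∀ s e₁ w x y l T₁ T₀ c →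
      2ℚ * ((1ℚ + s) * x) ≡ e₁ * w + (y + T₁) →
      2ℚ * (s * y) ≡ (c * e₁) * w + (l + T₀) →
      0ℚ < 1ℚ + s → y ≤ e₁ * w → l ≤ c * y → T₀ * 1ℚ ≤ T₁ * (1ℚ + c) → y ≤ (1ℚ + c) * x
    lower-kernel s e₁ w x y l T₁ T₀ c p q s>0 h₁ h₂ h₃ = 0≤-⇒≤ (cancel-≤ 2ℚ 0<2 (cancel-≤ (1ℚ + s) s>0
      (subst₂ _≤_ (sym (trans (*-congˡ (*-zeroʳ _)) (*-zeroʳ _)))
        (sym (trans (r s x y c) (trans (cong₂ (λ u v → (1ℚ + c) * u - (2ℚ * y + v)) p q) (r₂ e₁ w y l T₁ T₀ c))))
        (0≤+ (0≤+ (≤⇒0≤- h₁) (≤⇒0≤- h₂)) (≤⇒0≤- h₃)))))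
      where
      opaque
        unfolding _+_
        r : ∀ s x y c → (1ℚ + s) * (2ℚ * ((1ℚ + c) * x - y)) ≡ (1ℚ + c) * (2ℚ * ((1ℚ + s) * x)) - (2ℚ * y + 2ℚ * (s * y))
        r = solve-∀ ring
      opaque
        unfolding _+_
        r₂ : ∀ e₁ w y l T₁ T₀ c → (1ℚ + c) * (e₁ * w + (y + T₁)) - (2ℚ * y + ((c * e₁) * w + (l + T₀)))
          ≡ (e₁ * w - y) + (c * y - l) + (T₁ * (1ℚ + c) - T₀ * 1ℚ)
        r₂ = solve-∀ ring

    -- In the plain recursion the merge of j with b would come with the constant j + b + 4, which is
    -- too large. The traded recursions for j and j + 1 contain no such merge; their products differ
    -- by the exact factor e j / e (j + 1) = j + 2, and the surplus product bounds f(j,b,B) by the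
    -- product rule.
    lower′ : ∀ k j N → j ℕ.+ wt N ≡ k → f [] j N ≤ ι (suc (suc (suc j))) * f [] (suc j) N
    lower′ k j [] _ = ≤-trans (≤-reflexive (sym (e-suc j))) (*-monoʳ _ (f≥0 [] (suc j) []) (ι-mono (ℕₚ.n≤1+n _)))
    lower′ zero j (b ∷ B) eq with ℕₚ.m+n≡0⇒n≡0 j eq
    ... | ()
    lower′ (suc k) j (b ∷ B) eq = subst (λ c → f [] j (b ∷ B) ≤ c * f [] (suc j) (b ∷ B)) (sym (ι-suc (suc (suc j))))
      (lower-kernel (ι (sz [] j (b ∷ B))) (e (suc j)) (f [] b B) _ _ _ _ _ (ι (suc (suc j)))
        (trans (*-congˡ (*-congʳ (sym (ι-suc (sz [] j (b ∷ B)))))) (traded₁ (suc j) b B))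
        (trans (traded₁ j b B) (+-congʳ (*-congʳ (sym (e-suc j)))))
        (subst (0ℚ <_) (ι-suc (sz [] j (b ∷ B))) (ι>0 _))
        (≤-trans (0≤-⇒≤ (subst (0ℚ ≤_) (r _ _ _)
            (0≤+ (0≤* 0≤2 (f≥0 [] (suc (suc j ℕ.+ b)) B)) (low-nonneg b λ m _ → f≥0 B m (suc j ∷ [])))))
          (≤-reflexive (trans (sym (product-rule [] (suc j) B b)) (*-congˡ (f-rev B b [])))))
        (low≤ j eq)
        (trade-mono 1ℚ (1ℚ + ι (suc (suc j))) {λ y Y → f (j ∷ []) y Y} {λ y Y → f (suc j ∷ []) y Y} b B λ y Y e′ →
          ≤-trans (≤-reflexive (*-identityʳ _)) (≤-trans (lower′ k j (y ∷ Y) (ℕₚ.suc-injective (trans (s3 j y (wt Y)) (trans (cong (λ i → j ℕ.+ suc (suc i)) e′) eq))))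
            (≤-reflexive (trans (*-comm _ _) (*-congˡ (ι-suc (suc (suc j)))))))))
      where
      s3 : ∀ j y w → suc (j ℕ.+ suc (suc (y ℕ.+ w))) ≡ j ℕ.+ suc (suc (suc (y ℕ.+ w)))
      s3 = solveℕ
      opaque
        unfolding _+_
        r : ∀ m y l → 2ℚ * m + l ≡ (2ℚ * m + (y + l)) - y
        r = solve-∀ ring
      low≤ : ∀ j′ → j′ ℕ.+ wt (b ∷ B) ≡ suc k → low (λ y → f [] y (b ∷ B)) j′ ≤ ι (suc (suc j′)) * f [] j′ (b ∷ B)
      low≤ zero     _  = 0≤* (ι≥0 2) (f≥0 [] 0 (b ∷ B))
      low≤ (suc j′) eq′ = lower′ k j′ (b ∷ B) (ℕₚ.suc-injective eq′)

  lower : ∀ j N → f [] j N ≤ ι (suc (suc (suc j))) * f [] (suc j) N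
  lower j N = lower′ _ j N refl

  low-lower : ∀ A n → low (λ y → f A y []) n ≤ ι (suc (suc n)) * f A n []
  low-lower A zero    = 0≤* (ι≥0 2) (f≥0 A 0 [])
  low-lower A (suc n) = subst₂ (λ x y → x ≤ ι (suc (suc (suc n))) * y) (f-rev [] n A) (f-rev [] (suc n) A) (lower n A)

  upperˡ : ∀ A n → ι (suc (suc n)) * f A (suc n) [] ≤ f A n []
  upperˡ A n = subst₂ (λ x y → ι (suc (suc n)) * x ≤ y) (f-rev [] (suc n) A) (f-rev [] n A) (upper n A)

  -- Raising the exponent m by one divides e by exactly m + 2 and f(m,N) by at least m + 2.
  end-ratio : ∀ n m N → n ℕ.≤ m → e n * f [] m N ≤ f [] n N * e m
  end-ratio n zero    N ℕ.z≤n = ≤-reflexive (*-comm _ _)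
  end-ratio n (suc m) N n≤m with ℕₚ.m≤n⇒m<n∨m≡n n≤m
  ... | inj₂ refl = ≤-reflexive (*-comm _ _)
  ... | inj₁ (ℕ.s≤s n≤m′) = cancel-≤ (ι (suc (suc m))) (ι>0 _)
    (≤-trans (≤-reflexive (r _ _ _)) (≤-trans (*-monoˡ (e n) (f≥0 [] n []) (upper m N))
      (≤-trans (end-ratio n m N n≤m′) (≤-reflexive (trans (*-congˡ (sym (e-suc m))) (r _ _ _))))))
    where
    opaque
      unfolding _+_
      r : ∀ x y z → x * (y * z) ≡ y * (x * z)
      r = solve-∀ ring

-- The ratio inequality for continued words

module EndRatio where

  open SealedRational
  open Coefficient
  open Bounds
  open import Data.Nat as ℕ using (ℕ; zero; suc)
  import Data.Nat.Properties as ℕₚ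
  open import Data.Nat.Tactic.RingSolver using () renaming (solve-∀ to solveℕ)
  open import Data.Rational using (0ℚ; _≤_; _<_)
  open import Data.Rational.Properties using (≤-refl; ≤-reflexive; ≤-trans)
  open import Data.List using (List; []; _∷_)
  open import Data.Sum using (_⊎_; inj₁; inj₂)
  open import Relation.Binary.PropositionalEquality
  open import Tactic.RingSolver using (solve-∀)

  private
    -- The terms of 2 S D that lower n or m contribute at least K D, which is moved to the left-hand side.
    conclude : ∀ S K D R → 0ℚ < 2ℚ * S - K → 2ℚ * (S * D) ≡ K * D + R → 0ℚ ≤ R → 0ℚ ≤ D
    conclude S K D R pos eq R≥0 = cancel-≤ (2ℚ * S - K) pos
      (subst₂ _≤_ (sym (*-zeroʳ _)) (trans (r₂ (K * D) R) (trans (cong (_- K * D) (sym eq)) (r S K D))) R≥0)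
      where
      opaque
        unfolding _+_
        r : ∀ S K D → 2ℚ * (S * D) - K * D ≡ (2ℚ * S - K) * D
        r = solve-∀ ring
      opaque
        unfolding _+_
        r₂ : ∀ k R → R ≡ (k + R) - k
        r₂ = solve-∀ ring

    -- Both products in the difference have the same total size, so one factor scales the difference
    -- while each product distributes its total over the recursions of its two factors.
    split : ∀ s₁ s₂ s₃ s₄ X₁ X₂ x₃ X₄ {E₁ E₂ E₃ E₄} → s₁ + s₂ ≡ s₃ + s₄ →
      2ℚ * (s₁ * X₁) ≡ E₁ → 2ℚ * (s₂ * X₂) ≡ E₂ → 2ℚ * (s₃ * x₃) ≡ E₃ → 2ℚ * (s₄ * X₄) ≡ E₄ →
      2ℚ * ((s₃ + s₄) * (X₁ * X₂ - x₃ * X₄)) ≡ (E₁ * X₂ + X₁ * E₂) - (E₃ * X₄ + x₃ * E₄)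
    split s₁ s₂ s₃ s₄ X₁ X₂ x₃ X₄ eq refl refl refl refl =
      trans (r _ _ _) (trans (cong (λ S → 2ℚ * (S * (X₁ * X₂)) - 2ℚ * ((s₃ + s₄) * (x₃ * X₄))) (sym eq)) (r₂ _ _ _ _ _ _ _ _))
      where
      opaque
        unfolding _+_
        r : ∀ S x y → 2ℚ * (S * (x - y)) ≡ 2ℚ * (S * x) - 2ℚ * (S * y)
        r = solve-∀ ring
      opaque
        unfolding _+_
        r₂ : ∀ s₁ s₂ s₃ s₄ X₁ X₂ x₃ X₄ → 2ℚ * ((s₁ + s₂) * (X₁ * X₂)) - 2ℚ * ((s₃ + s₄) * (x₃ * X₄))
          ≡ ((2ℚ * (s₁ * X₁)) * X₂ + X₁ * (2ℚ * (s₂ * X₂))) - ((2ℚ * (s₃ * x₃)) * X₄ + x₃ * (2ℚ * (s₄ * X₄)))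
        r₂ = solve-∀ ring

    sizes : ∀ a n b c m → suc (a ℕ.+ (n ℕ.+ b)) ℕ.+ suc (c ℕ.+ (m ℕ.+ 0)) ≡ suc (a ℕ.+ (n ℕ.+ 0)) ℕ.+ suc (c ℕ.+ (m ℕ.+ b))
    sizes = solveℕ

    ι-sizes : ∀ A n N C m → ι (sz A n N) + ι (sz C m []) ≡ ι (sz A n []) + ι (sz C m N)
    ι-sizes A n N C m = trans (sym (ι-+ (sz A n N) (sz C m [])))
      (trans (cong ι (sizes (wt A) n (wt N) (wt C) m)) (ι-+ (sz A n []) (sz C m N)))

    room : ∀ K x y → 0ℚ ≤ K → 0ℚ < x → K ≤ y → 0ℚ < 2ℚ * (x + y) - K
    room K x y K≥0 x>0 K≤y = subst (0ℚ <_) (r K x y)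
      (0<+ (0<* 0<2 x>0) (0≤+ (0≤* 0≤2 (≤⇒0≤- K≤y)) K≥0))
      where
      opaque
        unfolding _+_
        r : ∀ K x y → 2ℚ * x + (2ℚ * (y - K) + K) ≡ 2ℚ * (x + y) - K
        r = solve-∀ ring

    opaque
      unfolding _+_
      -- The two letters tell whether A and C are cons or nil. Every bracket behind the multiple of
      -- the difference is non-negative: the brackets at pA and pC are ratio inequalities with one
      -- left context removed, those of the T terms follow by induction through `trade-mono`, and
      -- those with l₂ and l₃ are linear bounds.
      id-cc : ∀ K X₁ X₂ x X₄ pA g w TA₁ TB₁ em pC l₂ TC₂ en l₃ TA₃ h TC₄ TB₄ →
        ((pA * g + (x * w + (TA₁ + TB₁))) * X₂ + X₁ * (em * pC + (l₂ + TC₂)))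
          - ((en * pA + (l₃ + TA₃)) * X₄ + x * (pC * h + (X₂ * w + (TC₄ + TB₄))))
        ≡ K * (X₁ * X₂ - x * X₄) +
          (pA * (g * X₂ - en * X₄) + (pC * (X₁ * em - x * h) + ((TA₁ * X₂ - TA₃ * X₄) + ((TB₁ * X₂ - TB₄ * x)
            + ((TC₂ * X₁ - TC₄ * x) + (X₁ * (l₂ - K * X₂) + X₄ * (K * x - l₃)))))))
      id-cc = solve-∀ ring

    opaque
      unfolding _+_
      -- With A empty the word (n) has no neighbour to trade. Its term stays unexpanded as 2 s e(n),
      -- with s = n + 1, and 2 s plays the role of K.
      id-nc : ∀ s X₁ X₂ en X₄ w l₁ TB₁ em pC l₂ TC₂ h TC₄ TB₄ →
        ((en * w + (l₁ + TB₁)) * X₂ + X₁ * (em * pC + (l₂ + TC₂)))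
          - ((2ℚ * (s * en)) * X₄ + en * (pC * h + (X₂ * w + (TC₄ + TB₄))))
        ≡ (2ℚ * s) * (X₁ * X₂ - en * X₄) +
          (pC * (X₁ * em - en * h) + ((TB₁ * X₂ - TB₄ * en) + ((TC₂ * X₁ - TC₄ * en)
            + (l₁ * X₂ + X₁ * l₂ - (2ℚ * s) * (X₁ * X₂)))))
      id-nc = solve-∀ ring

    opaque
      unfolding _+_
      -- With C empty it is e(m + 1) that stays unexpanded, so s = m + 2. Both remaining lowerings
      -- enter with a negative sign here, which makes this the tight case.
      id-cn : ∀ s X₁ em x h pA g w TA₁ TB₁ en l₃ TA₃ l₄ TB₄ →
        ((pA * g + (x * w + (TA₁ + TB₁))) * em + X₁ * (2ℚ * (s * em)))
          - ((en * pA + (l₃ + TA₃)) * h + x * (em * w + (l₄ + TB₄)))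
        ≡ (2ℚ * s) * (X₁ * em - x * h) +
          ((TA₁ * em - TA₃ * h) + ((TB₁ * em - TB₄ * x)
            + (pA * (g * em - en * h) + ((2ℚ * s) * (x * h) - (h * l₃ + x * l₄)))))
      id-cn = solve-∀ ring

    lower-sum₁ : ∀ {w w′ k} r → suc w ≡ w′ → w′ ℕ.+ r ℕ.≤ suc k → w ℕ.+ r ℕ.≤ k
    lower-sum₁ r refl (ℕ.s≤s p) = p

    lower-sum₂ : ∀ {w w′ k} a r → suc w ≡ w′ → a ℕ.+ (w′ ℕ.+ r) ℕ.≤ suc k → a ℕ.+ (w ℕ.+ r) ℕ.≤ k
    lower-sum₂ {w} {k = k} a r refl p = ℕₚ.≤-pred (subst (ℕ._≤ suc k) (ℕₚ.+-suc a (w ℕ.+ r)) p)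

    lower-sum₃ : ∀ {w w′ k} a c → suc w ≡ w′ → a ℕ.+ (c ℕ.+ w′) ℕ.≤ suc k → a ℕ.+ (c ℕ.+ w) ℕ.≤ k
    lower-sum₃ {w} {k = k} a c refl p = ℕₚ.≤-pred (subst (ℕ._≤ suc k) (r a c w) p)
      where
      r : ∀ a c w → a ℕ.+ (c ℕ.+ suc w) ≡ suc (a ℕ.+ (c ℕ.+ w))
      r = solveℕ

    x≤K : ∀ {n m} c r → n ℕ.≤ m → suc (suc n) ℕ.≤ suc (c ℕ.+ (suc m ℕ.+ r))
    x≤K {n} {m} c r n≤m = ℕ.s≤s (ℕₚ.≤-trans (ℕ.s≤s n≤m) (ℕₚ.≤-trans (ℕₚ.m≤m+n (suc m) r) (ℕₚ.m≤n+m _ c)))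

    flip-≤ : ∀ {a b c d} → a * b ≤ c * d → b * a ≤ d * c
    flip-≤ p = subst₂ _≤_ (*-comm _ _) (*-comm _ _) p

    flipˡ : ∀ {a b c d} → a * b ≤ c * d → b * a ≤ c * d
    flipˡ p = subst (_≤ _) (*-comm _ _) p

    -- For m = n the linear estimates of the lowered terms fall short by a margin, which is covered by
    -- p (g - c h), the gain from the product obtained by cutting on the left of n.
    equal-kernel : ∀ c p g h x l → 0ℚ < c → c * h ≤ g → g ≤ 2ℚ * c * h → l ≤ c * x → l ≤ c * p →
      0ℚ ≤ p * (g - c * h) + ((2ℚ * c) * (x * h) - (h * l + x * g))
    equal-kernel c p g h x l c>0 h₁ h₂ h₃ h₄ = cancel-≤ c c>0 (subst₂ _≤_ (sym (*-zeroʳ c)) (r c p g h x l)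
      (0≤+ (0≤* (≤⇒0≤- h₄) (≤⇒0≤- h₁)) (0≤* (≤⇒0≤- h₃) (≤⇒0≤- h₂))))
      where
      opaque
        unfolding _+_
        r : ∀ c p g h x l → (c * p - l) * (g - c * h) + (c * x - l) * (2ℚ * c * h - g)
          ≡ c * (p * (g - c * h) + ((2ℚ * c) * (x * h) - (h * l + x * g)))
        r = solve-∀ ring

    module Ratio (n m : ℕ) (n≤m : n ℕ.≤ m) where

      -- The induction is on the contexts alone: trading removes the merges at n and m + 1, and the
      -- lowerings of these exponents are estimated by the linear bounds instead of by induction.
      -- Hence n and m stay fixed.
      ratio : ∀ k A C b B → wt A ℕ.+ (wt C ℕ.+ wt (b ∷ B)) ℕ.≤ k →
        f A n [] * f C (suc m) (b ∷ B) ≤ f A n (b ∷ B) * f C (suc m) []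
      ratio zero A C b B lt with ℕₚ.m+n≡0⇒n≡0 (wt C) (ℕₚ.m+n≡0⇒n≡0 (wt A) (ℕₚ.n≤0⇒n≡0 lt))
      ... | ()
      ratio (suc k) [] [] b B lt = end-ratio n (suc m) (b ∷ B) (ℕₚ.m≤n⇒m≤1+n n≤m)
      ratio (suc k) (a ∷ A) (c ∷ C) b B lt = 0≤-⇒≤ (conclude (s₃ + s₄) K _ _
        (room K s₃ s₄ (ι≥0 _) (ι>0 _) (ι-mono (x≤K (wt (c ∷ C)) (wt (b ∷ B)) n≤m)))
        (trans (split (ι (sz (a ∷ A) n N)) (ι (sz (c ∷ C) (suc m) [])) s₃ s₄ X₁ X₂ x X₄ (ι-sizes (a ∷ A) n N (c ∷ C) (suc m))
            (traded₂ a A n b B) (traded₁ˡ c C (suc m)) (traded₁ˡ a A n) (traded₂ c C (suc m) b B))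
          (id-cc K X₁ X₂ x X₄ _ _ _ _ _ _ _ _ _ _ _ _ _ _ _))
        (0≤+ (0≤* (f≥0 A a []) (≤⇒0≤- (ratio k [] (c ∷ C) b B (ℕₚ.≤-trans (ℕₚ.m≤n+m (wt (c ∷ C) ℕ.+ wt N) (suc (a ℕ.+ wt A))) (ℕₚ.≤-pred lt)))))
        (0≤+ (0≤* (f≥0 C c []) (≤⇒0≤- (ratio k (a ∷ A) [] b B
               (ℕₚ.≤-trans (ℕₚ.+-monoʳ-≤ (wt (a ∷ A)) (ℕₚ.m≤n+m (wt N) (suc (c ℕ.+ wt C))))
                 (lower-sum₂ {suc (c ℕ.+ wt C)} (wt (a ∷ A)) (wt N) refl lt)))))
        (0≤+ (≤⇒0≤- (trade-mono X₄ X₂ {λ y Y → f Y y (n ∷ [])} {λ y Y → f Y y (n ∷ b ∷ B)} a A λ y Y e′ →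
               ratio k (y ∷ Y) (c ∷ C) b B (lower-sum₁ _ (cong (λ j → suc (suc j)) e′) lt)))
        (0≤+ (≤⇒0≤- (trade-mono x X₂ {λ y Y → f (suc m ∷ c ∷ C) y Y} {λ y Y → f (n ∷ a ∷ A) y Y} b B λ y Y e′ →
               flipˡ (ratio k (a ∷ A) (c ∷ C) y Y (lower-sum₃ (wt (a ∷ A)) (wt (c ∷ C)) (cong (λ j → suc (suc j)) e′) lt))))
        (0≤+ (≤⇒0≤- (trade-mono x X₁ {λ y Y → f Y y (suc m ∷ b ∷ B)} {λ y Y → f Y y (suc m ∷ [])} c C λ y Y e′ →
               flip-≤ (ratio k (a ∷ A) (y ∷ Y) b B (lower-sum₂ (wt (a ∷ A)) (wt N) (cong (λ j → suc (suc j)) e′) lt))))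
        (0≤+ (0≤* (f≥0 (a ∷ A) n N) (≤⇒0≤- (≤-trans (*-monoʳ X₂ (f≥0 (c ∷ C) (suc m) []) (ι-mono (ℕ.s≤s (ℕ.s≤s n≤m))))
               (upperˡ (c ∷ C) m))))
          (0≤* (f≥0 (c ∷ C) (suc m) N) (≤⇒0≤- (low-lower (a ∷ A) n))))))))))
        where
        N = b ∷ B
        -- The constant n + 2 separates the two lowerings: from m + 1 to m the value grows by a
        -- factor of at least m + 2, from n to n - 1 by at most n + 2, and n ≤ m.
        K = ι (suc (suc n))
        X₁ = f (a ∷ A) n N
        X₂ = f (c ∷ C) (suc m) []
        x = f (a ∷ A) n []
        X₄ = f (c ∷ C) (suc m) N
        s₃ = ι (sz (a ∷ A) n [])
        s₄ = ι (sz (c ∷ C) (suc m) N)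
      ratio (suc k) [] (c ∷ C) b B lt = 0≤-⇒≤ (conclude (s₃ + s₄) (2ℚ * s₃) _ _
        (subst (0ℚ <_) (r s₃ s₄) (0<* 0<2 (ι>0 _)))
        (trans (split (ι (sz [] n N)) (ι (sz (c ∷ C) (suc m) [])) s₃ s₄ X₁ X₂ (e n) X₄ (ι-sizes [] n N (c ∷ C) (suc m))
            (traded₁ n b B) (traded₁ˡ c C (suc m)) refl (traded₂ c C (suc m) b B))
          (id-nc s₃ X₁ X₂ (e n) X₄ _ _ _ _ _ _ _ _ _ _))
        (0≤+ (0≤* (f≥0 C c []) (≤⇒0≤- (ratio k [] [] b B
               (ℕₚ.≤-trans (ℕₚ.m≤n+m _ (suc (c ℕ.+ wt C))) (ℕₚ.≤-pred lt)))))
        (0≤+ (≤⇒0≤- (trade-mono (e n) X₂ {λ y Y → f (suc m ∷ c ∷ C) y Y} {λ y Y → f (n ∷ []) y Y} b B λ y Y e′ →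
               flipˡ (ratio k [] (c ∷ C) y Y (lower-sum₃ 0 (wt (c ∷ C)) (cong (λ j → suc (suc j)) e′) lt))))
        (0≤+ (≤⇒0≤- (trade-mono (e n) X₁ {λ y Y → f Y y (suc m ∷ b ∷ B)} {λ y Y → f Y y (suc m ∷ [])} c C λ y Y e′ →
               flip-≤ (ratio k [] (y ∷ Y) b B (lower-sum₂ 0 (wt N) (cong (λ j → suc (suc j)) e′) lt))))
          (≤⇒0≤- (last n n≤m refl))))))
        where
        N = b ∷ B
        X₁ = f [] n N
        X₂ = f (c ∷ C) (suc m) []
        X₄ = f (c ∷ C) (suc m) N
        s₃ = ι (sz [] n [])
        s₄ = ι (sz (c ∷ C) (suc m) N)
        opaque
          unfolding _+_
          r : ∀ x y → 2ℚ * y ≡ 2ℚ * (x + y) - 2ℚ * x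
          r = solve-∀ ring
        opaque
          unfolding _+_
          r₀ : ∀ l X₁ X₂ s → 0ℚ * X₂ + X₁ * l - (2ℚ * s) * (X₁ * X₂) ≡ X₁ * (l - (2ℚ * s) * X₂)
          r₀ = solve-∀ ring
        opaque
          unfolding _+_
          r₁ : ∀ g l X₁ X₂ s → g * X₂ + X₁ * l - (2ℚ * s) * (X₁ * X₂) ≡ (g - s * X₁) * X₂ + X₁ * (l - s * X₂)
          r₁ = solve-∀ ring
        -- for n = 0 there is no lowering of n, but then 2 ≤ m + 1
        last : ∀ n′ → n′ ℕ.≤ m → n′ ≡ n → (2ℚ * s₃) * (X₁ * X₂) ≤ low (λ y → f [] y N) n * X₂ + X₁ * f (c ∷ C) m []
        last zero    _ refl = 0≤-⇒≤ (subst (0ℚ ≤_) (sym (r₀ _ X₁ X₂ s₃))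
          (0≤* (f≥0 [] n N) (≤⇒0≤- (≤-trans (*-monoʳ X₂ (f≥0 (c ∷ C) (suc m) [])
            (≤-trans (≤-reflexive (trans (*-congˡ ιℤ-1) (trans (*-identityʳ 2ℚ) (sym ι2)))) (ι-mono (ℕ.s≤s (ℕ.s≤s ℕ.z≤n)))))
            (upperˡ (c ∷ C) m)))))
        last (suc n′) n≤ refl = 0≤-⇒≤ (subst (0ℚ ≤_) (sym (r₁ _ _ X₁ X₂ s₃))
          (0≤+ (0≤* (≤⇒0≤- (subst (λ j → ι (suc (suc j)) * X₁ ≤ f [] n′ N) (sym (ℕₚ.+-identityʳ n′)) (upper n′ N))) (f≥0 (c ∷ C) (suc m) []))
               (0≤* (f≥0 [] n N) (≤⇒0≤- (≤-trans (*-monoʳ X₂ (f≥0 (c ∷ C) (suc m) [])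
                 (ι-mono (ℕ.s≤s (ℕₚ.≤-trans (ℕₚ.≤-reflexive (ℕₚ.+-identityʳ n)) (ℕₚ.m≤n⇒m≤1+n n≤)))))
                 (upperˡ (c ∷ C) m))))))
      ratio (suc k) (a ∷ A) [] b B lt = 0≤-⇒≤ (conclude (s₃ + s₄) (2ℚ * s₂) _ _
        (subst (0ℚ <_) (trans (r s₁ s₂) (cong (λ S → 2ℚ * S - 2ℚ * s₂) (ι-sizes (a ∷ A) n N [] (suc m)))) (0<* 0<2 (ι>0 _)))
        (trans (split s₁ s₂ s₃ s₄ X₁ (e (suc m)) x h (ι-sizes (a ∷ A) n N [] (suc m))
            (traded₂ a A n b B) refl (traded₁ˡ a A n) (traded₁ (suc m) b B))
          (id-cn s₂ X₁ (e (suc m)) x h _ _ _ _ _ _ _ _ _ _))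
        (0≤+ (≤⇒0≤- (trade-mono h (e (suc m)) {λ y Y → f Y y (n ∷ [])} {λ y Y → f Y y (n ∷ b ∷ B)} a A λ y Y e′ →
               ratio k (y ∷ Y) [] b B (lower-sum₁ _ (cong (λ j → suc (suc j)) e′) lt)))
        (0≤+ (≤⇒0≤- (trade-mono x (e (suc m)) {λ y Y → f (suc m ∷ []) y Y} {λ y Y → f (n ∷ a ∷ A) y Y} b B λ y Y e′ →
               flipˡ (ratio k (a ∷ A) [] y Y (lower-sum₃ (wt (a ∷ A)) 0 (cong (λ j → suc (suc j)) e′) lt))))
          (last (ℕₚ.m≤n⇒m<n∨m≡n n≤m)))))
        where
        N = b ∷ B
        X₁ = f (a ∷ A) n N
        x = f (a ∷ A) n []
        h = f [] (suc m) N
        g = f [] n N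
        pA = f A a []
        s₁ = ι (sz (a ∷ A) n N)
        s₂ = ι (sz [] (suc m) [])
        s₃ = ι (sz (a ∷ A) n [])
        s₄ = ι (sz [] (suc m) N)
        l₃ = low (λ y → f (a ∷ A) y []) n
        opaque
          unfolding _+_
          r : ∀ x y → 2ℚ * x ≡ 2ℚ * (x + y) - 2ℚ * y
          r = solve-∀ ring
        last : (n ℕ.< m) ⊎ (n ≡ m) → 0ℚ ≤ pA * (g * e (suc m) - e n * h) + ((2ℚ * s₂) * (x * h) - (h * l₃ + x * f [] m N))
        -- The two lowerings cost at most n + 2 and m + 3; the sum fits into 2 (m + 2) precisely
        -- when n < m.
        last (inj₁ n<m) = 0≤+ (0≤* (f≥0 A a []) (≤⇒0≤- (end-ratio n (suc m) N (ℕₚ.m≤n⇒m≤1+n n≤m))))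
          (subst (0ℚ ≤_) (r₁ _ _ _ _ _ _ _)
            (0≤+ (0≤+ (0≤* (f≥0 [] (suc m) N) (≤⇒0≤- (low-lower (a ∷ A) n)))
                      (0≤* (f≥0 (a ∷ A) n []) (≤⇒0≤- (lower m N))))
                 (0≤* (0≤* (f≥0 (a ∷ A) n []) (f≥0 [] (suc m) N)) (≤⇒0≤- coeff))))
          where
          opaque
            unfolding _+_
            r₁ : ∀ h l x g c₁ c₂ s → h * (c₁ * x - l) + x * (c₂ * h - g) + (x * h) * ((2ℚ * s) - (c₁ + c₂))
              ≡ (2ℚ * s) * (x * h) - (h * l + x * g)
            r₁ = solve-∀ ring
          coeff : ι (suc (suc n)) + ι (suc (suc (suc m))) ≤ 2ℚ * s₂
          coeff = subst₂ _≤_ (ι-+ (suc (suc n)) (suc (suc (suc m)))) (trans (ι-* 2 (sz [] (suc m) [])) (*-congʳ ι2))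
            (ι-mono (ℕₚ.≤-trans (ℕₚ.+-monoˡ-≤ (suc (suc (suc m))) (ℕ.s≤s n<m)) (ℕₚ.≤-reflexive (r₂ m))))
            where
            r₂ : ∀ m → suc m ℕ.+ suc (suc (suc m)) ≡ 2 ℕ.* suc (suc (m ℕ.+ 0))
            r₂ = solveℕ
        last (inj₂ refl) = subst (λ t → 0ℚ ≤ t + ((2ℚ * s₂) * (x * h) - (h * l₃ + x * g)))
          (trans (r₁ _ _ _ _ _) (cong (λ t → pA * (g * e (suc n) - t * h)) en))
          (equal-kernel s₂ (pA * e (suc n)) g h x l₃ (ι>0 _)
            (subst (λ c → c * h ≤ g) (sym c≡) (upper n N))
            (≤-trans (lower n N) (*-monoʳ h (f≥0 [] (suc n) N) c≤))
            (subst (λ c → l₃ ≤ c * x) (sym c≡) (low-lower (a ∷ A) n))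
            (≤-trans low≤ (≤-reflexive (trans (*-congˡ (sym en)) (r₃ _ _ _)))))
          where
          c≡ : s₂ ≡ ι (suc (suc n))
          c≡ = cong (λ j → ι (suc (suc j))) (ℕₚ.+-identityʳ n)
          en : s₂ * e (suc n) ≡ e n
          en = trans (*-congʳ c≡) (e-suc n)
          opaque
            unfolding _+_
            r₁ : ∀ p q g c h → p * q * (g - c * h) ≡ p * (g * q - c * q * h)
            r₁ = solve-∀ ring
          opaque
            unfolding _+_
            r₃ : ∀ p c q → p * (c * q) ≡ c * (p * q)
            r₃ = solve-∀ ring
          c≤ : ι (suc (suc (suc n))) ≤ 2ℚ * s₂
          c≤ = subst (ι (suc (suc (suc n))) ≤_) (trans (ι-* 2 (sz [] (suc n) [])) (*-congʳ ι2)) (ι-mono (subst (suc (suc (suc n)) ℕ.≤_) (r₂ n) (ℕₚ.m≤m+n (suc (suc (suc n))) (suc n))))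
            where
            r₂ : ∀ n → suc (suc (suc n)) ℕ.+ suc n ≡ 2 ℕ.* suc (suc (n ℕ.+ 0))
            r₂ = solveℕ
          low≤ : l₃ ≤ pA * e n
          low≤ = 0≤-⇒≤ (subst (0ℚ ≤_) (trans (r₄ _ _ _) (cong (_- l₃)
              (trans (cong (λ t → 2ℚ * f A (suc (a ℕ.+ n)) [] + (low (λ y → f A y (n ∷ [])) a + t))
                       (low-cong n λ y _ → f-rev (a ∷ A) y []))
                     (sym (product-rule A a [] n)))))
            (0≤+ (0≤* 0≤2 (f≥0 A (suc (a ℕ.+ n)) [])) (low-nonneg a λ y _ → f≥0 A y (n ∷ []))))
            where
            opaque
              unfolding _+_
              r₄ : ∀ m l k → 2ℚ * m + l ≡ (2ℚ * m + (l + k)) - k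
              r₄ = solve-∀ ring

  ratio : ∀ n m A C N → n ℕ.< m → f A n [] * f C m N ≤ f A n N * f C m []
  ratio n (suc m) A C []      _ = ≤-refl
  ratio n (suc m) A C (b ∷ B) (ℕ.s≤s n≤m) = Ratio.ratio n m n≤m _ A C b B ℕₚ.≤-refl

-- Moving one unit between two exponents

module Balance where

  open SealedRational
  open Coefficient
  open Bounds
  open EndRatio using (ratio)
  open import Data.Nat as ℕ using (ℕ; zero; suc; ∣_-_∣)
  import Data.Nat.Properties as ℕₚ
  open import Data.Nat.Tactic.RingSolver using () renaming (solve-∀ to solveℕ)
  open import Data.Integer as ℤ using (+_)
  open import Data.Rational using (ℚ; 0ℚ; 1ℚ; _≤_; _<_)
  open import Data.Rational.Properties using (≤-refl; ≤-reflexive; ≤-trans; <⇒≤; ≤-<-trans; <-trans)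
  open import Data.List using (List; []; _∷_; _++_; _ʳ++_; reverse)
  open import Data.List.Properties using (ʳ++-defn; reverse-involutive; ++-assoc; reverse-++; unfold-reverse)
  open import Data.Product using (_×_; _,_; ∃)
  open import Data.Sum using (inj₁; inj₂)
  open import Relation.Nullary using (contradiction)
  open import Relation.Binary.PropositionalEquality
  open import Tactic.RingSolver using (solve-∀)

  -- The lists p ∷ P below are left contexts, stored nearest entry first, so the last entry is the
  -- first exponent of the word.
  last : ℕ → List ℕ → ℕ
  last p []      = p
  last p (b ∷ B) = last b B

  -- bump p B is the list p ∷ B with its last entry increased by one.
  bumpHead : ℕ → List ℕ → ℕ
  bumpHead p []      = suc p
  bumpHead p (b ∷ B) = p

  bumpTail : ℕ → List ℕ → List ℕ
  bumpTail p []      = []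
  bumpTail p (b ∷ B) = bumpHead b B ∷ bumpTail b B

  bump : ℕ → List ℕ → List ℕ
  bump p B = bumpHead p B ∷ bumpTail p B

  bump-wt : ∀ p B → wt (bump p B) ≡ suc (wt (p ∷ B))
  bump-wt p []      = refl
  bump-wt p (b ∷ B) = trans (cong (λ j → suc (suc (p ℕ.+ j))) (bump-wt b B)) (r p (wt (b ∷ B)))
    where
    r : ∀ p w → suc (suc (p ℕ.+ suc w)) ≡ suc (suc (suc (p ℕ.+ w)))
    r = solveℕ

  bump-ʳ++ : ∀ p B R → ∃ λ Q → ((p ∷ B) ʳ++ R ≡ last p B ∷ Q) × (bump p B ʳ++ R ≡ suc (last p B) ∷ Q)
  bump-ʳ++ p []      R = R , refl , refl
  bump-ʳ++ p (b ∷ B) R = bump-ʳ++ b B (p ∷ R)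

  private
    wt-low : ∀ p b c w → suc c ≡ b → suc (p ℕ.+ suc (suc (c ℕ.+ w))) ≡ p ℕ.+ suc (suc (b ℕ.+ w))
    wt-low p _ c w refl = r p c w
      where
      r : ∀ p c w → suc (p ℕ.+ suc (suc (c ℕ.+ w))) ≡ p ℕ.+ suc (suc (suc c ℕ.+ w))
      r = solveℕ

    wt-merge : ∀ p b w → suc (suc (p ℕ.+ b) ℕ.+ w) ≡ p ℕ.+ suc (suc (b ℕ.+ w))
    wt-merge = solveℕ

    wt-tail : ∀ p x y → suc x ≡ y → suc (p ℕ.+ suc (suc x)) ≡ p ℕ.+ suc (suc y)
    wt-tail p x _ refl = r p x
      where
      r : ∀ p x → suc (p ℕ.+ suc (suc x)) ≡ p ℕ.+ suc (suc (suc x))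
      r = solveℕ

  low-mono : ∀ {g g′} n → (∀ m → suc m ≡ n → g m ≤ g′ m) → low g n ≤ low g′ n
  low-mono zero    H = ≤-refl
  low-mono (suc n) H = H n refl

  low-bump : ∀ {g g′ : ℕ → ℚ} n → 1 ℕ.≤ n → (∀ m → suc m ≡ n → g′ (suc m) ≤ g m) → low g′ (suc n) ≤ low g n
  low-bump (suc n) _ H = H n refl

  -- Reduction commutes with raising the last entry, so the reducts pair up. The one possible
  -- exception is a last entry 0, which becomes lowerable only after being raised; it is excluded by
  -- 1 ≤ `last b B`. A reduction lowers the last entry by at most one, which the caller needs to
  -- keep it large enough.
  side-bump : ∀ {g g′ : List ℕ → ℚ} p b B → 1 ℕ.≤ last b B →
    (∀ y Y → suc (y ℕ.+ wt Y) ≡ p ℕ.+ wt (b ∷ B) → last b B ℕ.≤ suc (last y Y) → g′ (bump y Y) ≤ g (y ∷ Y)) →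
    side (λ y Y → g′ (y ∷ Y)) p (bump b B) ≤ side (λ y Y → g (y ∷ Y)) p (b ∷ B)
  side-bump {g} {g′} p b [] 1≤b H = +-mono-≤
    (subst (λ j → g′ (suc j ∷ []) ≤ g (suc (p ℕ.+ b) ∷ [])) (sym (ℕₚ.+-suc p b))
      (H (suc (p ℕ.+ b)) [] (wt-merge p b 0) (ℕₚ.m≤n⇒m≤1+n (ℕₚ.m≤n⇒m≤1+n (ℕₚ.m≤n+m b p)))))
    (+-mono-≤ (low-bump {λ m → g (p ∷ m ∷ [])} {λ m → g′ (p ∷ m ∷ [])} b 1≤b λ { m refl → H p (m ∷ []) (wt-low p b m 0 refl) ℕₚ.≤-refl }) ≤-refl)
  side-bump {g} {g′} p b (b₂ ∷ B) 1≤b H = +-mono-≤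
    (H (suc (p ℕ.+ b)) (b₂ ∷ B) (wt-merge p b (wt (b₂ ∷ B))) (ℕₚ.n≤1+n _))
    (+-mono-≤ (low-mono b λ m e → H p (m ∷ b₂ ∷ B) (wt-low p b m (wt (b₂ ∷ B)) e) (ℕₚ.n≤1+n _))
      (side-bump {λ Y → g (p ∷ Y)} {λ Y → g′ (p ∷ Y)} b b₂ B 1≤b λ y Y e l → H p (y ∷ Y) (wt-tail p _ _ e) l))

  trade-bump : ∀ {g g′ : List ℕ → ℚ} p B → 1 ℕ.≤ last p B →
    (∀ y Y → suc (y ℕ.+ wt Y) ≡ p ℕ.+ wt B → last p B ℕ.≤ suc (last y Y) → g′ (bump y Y) ≤ g (y ∷ Y)) →
    trade (λ y Y → g′ (y ∷ Y)) (bumpHead p B) (bumpTail p B) ≤ trade (λ y Y → g (y ∷ Y)) p B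
  trade-bump {g} {g′} p [] 1≤p H = +-mono-≤ (low-bump {λ m → g (m ∷ [])} {λ m → g′ (m ∷ [])} p 1≤p λ { m refl → H m [] refl ℕₚ.≤-refl }) ≤-refl
  trade-bump {g} {g′} p (b ∷ B) 1≤b H = +-mono-≤
    (low-mono p λ { m refl → H m (b ∷ B) refl (ℕₚ.n≤1+n _) })
    (*-monoˡ 2ℚ 0≤2 (side-bump {g} {g′} p b B 1≤b H))

  trade-≤ : ∀ {h h′} b B → (∀ y Y → suc (y ℕ.+ wt Y) ≡ b ℕ.+ wt B → h y Y ≤ h′ y Y) → trade h b B ≤ trade h′ b B
  trade-≤ b B H = subst₂ _≤_ (*-identityʳ _) (*-identityʳ _) (trade-mono 1ℚ 1ℚ b B λ y Y e →
    subst₂ _≤_ (sym (*-identityʳ _)) (sym (*-identityʳ _)) (H y Y e))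

  -- With l the first exponent, raising l costs a factor of at least l + 2 and passing from n + 1 to
  -- n gains at most n + 3. This decides the comparison when n + 1 < l; for n + 1 = l the two bounds
  -- meet and another source is required.
  cut-< : ∀ p P n N → suc n ℕ.< last p P →
    f (bumpTail p P) (bumpHead p P) [] * f [] n N < f P p [] * f [] (suc n) N
  cut-< p P n N lt with bump-ʳ++ p P []
  ... | Q , e₁ , e₂ = cancel-< (ι (suc (suc (last p P)))) (ι>0 _)
    (≤-<-trans (≤-trans (≤-reflexive (sym (*-assoc _ _ _)))
      (≤-trans (*-monoʳ (f [] n N) (f≥0 [] n N)
        (subst₂ (λ u v → ι (suc (suc (last p P))) * fw u ≤ fw v) (sym e₂) (sym e₁) (upper (last p P) Q)))
      (≤-trans (*-monoˡ (f P p []) (f≥0 P p []) (lower n N)) (≤-reflexive (r _ _ _)))))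
     (0<-⇒< (subst (0ℚ <_) (r₂ _ _ _) (0<* (<⇒0<- (ι-< (ℕ.s≤s (ℕ.s≤s lt)))) (0<* (f>0 P p []) (f>0 [] (suc n) N))))))
    where
    opaque
      unfolding _+_
      r : ∀ x y z → x * (y * z) ≡ y * (x * z)
      r = solve-∀ ring
    opaque
      unfolding _+_
      r₂ : ∀ x y z → (x - y) * z ≡ x * z - y * z
      r₂ = solve-∀ ring
    ι-< : ∀ {m n} → m ℕ.< n → ι m < ι n
    ι-< p = ιℤ-mono-< (ℤ.+<+ p)

  -- The parameter is the boundary case in which the estimate of `cut-<` is not strict; it will come
  -- from the assumption of the theorem.
  module Bump
    (diagonal : ∀ p P n N → last p P ≡ suc n → f (bump p P) n N < f (p ∷ P) (suc n) N)
    where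

    private
      size : ∀ p P n N → sz (p ∷ P) (suc n) N ≡ sz (bump p P) n N
      size p P n N = trans (r (wt (p ∷ P)) n (wt N)) (cong (λ w → suc (w ℕ.+ (n ℕ.+ wt N))) (sym (bump-wt p P)))
        where
        r : ∀ a n b → suc (a ℕ.+ (suc n ℕ.+ b)) ≡ suc (suc a ℕ.+ (n ℕ.+ b))
        r = solveℕ

      -- Both words have the same size, so their doubled traded recursions are compared term by
      -- term. Strictness comes from the product cut to the left of n. A reduct of the left context
      -- can bring the first exponent down to n + 1, where `diagonal` applies, but not lower, since
      -- the inequality is strict at this point.
      bump-<′ : ∀ k p P n N → wt (p ∷ P) ℕ.+ (n ℕ.+ wt N) ℕ.≤ k → suc n ℕ.≤ last p P →
        f (bump p P) n N < f (p ∷ P) (suc n) N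
      bump-<′ zero    p P n N ()
      bump-<′ (suc k) p P n N μ lt with ℕₚ.m≤n⇒m<n∨m≡n lt
      ... | inj₂ eq = diagonal p P n N (sym eq)
      ... | inj₁ lt′ = cancel-< (ι (sz (p ∷ P) (suc n) N)) (ι>0 _) (cancel-< 2ℚ 0<2
        (subst (λ s → 2ℚ * (ι s * f (bump p P) n N) < 2ℚ * (ι (sz (p ∷ P) (suc n) N) * f (p ∷ P) (suc n) N))
          (sym (size p P n N)) (cases N refl)))
        where
        left : ∀ N′ → N′ ≡ N → trade (λ y Y → f Y y (n ∷ N′)) (bumpHead p P) (bumpTail p P) ≤ trade (λ y Y → f Y y (suc n ∷ N′)) p P
        left N′ refl = trade-bump {λ Y → f Y (suc n) N} {λ Y → f Y n N} p P (ℕₚ.≤-trans (ℕ.s≤s ℕ.z≤n) lt) λ y Y e l →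
          <⇒≤ (bump-<′ k y Y n N (lower-left y Y e) (ℕₚ.≤-pred (ℕₚ.≤-trans lt′ l)))
          where
          lower-left : ∀ y Y → suc (y ℕ.+ wt Y) ≡ p ℕ.+ wt P → wt (y ∷ Y) ℕ.+ (n ℕ.+ wt N) ℕ.≤ k
          lower-left y Y e = ℕₚ.≤-pred (subst (λ w → suc (suc w) ℕ.+ (n ℕ.+ wt N) ℕ.≤ suc k) (sym e) μ)
        cases : ∀ N′ → N′ ≡ N → 2ℚ * (ι (sz (bump p P) n N) * f (bump p P) n N) < 2ℚ * (ι (sz (p ∷ P) (suc n) N) * f (p ∷ P) (suc n) N)
        cases [] refl = subst₂ _<_ (sym (traded₁ˡ (bumpHead p P) (bumpTail p P) n)) (sym (traded₁ˡ p P (suc n)))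
          (+-mono-<-≤ (subst₂ _<_ (*-comm _ _) (*-comm _ _) (cut-< p P n [] lt′)) (+-mono-≤ (lowest n refl) (left [] refl)))
          where
          lowest : ∀ n′ → n′ ≡ n → low (λ y → f (bump p P) y []) n ≤ f (p ∷ P) n []
          lowest zero     refl = f≥0 (p ∷ P) n []
          lowest (suc n′) refl = <⇒≤ (bump-<′ k p P n′ [] (ℕₚ.≤-pred (subst (ℕ._≤ suc k) (ℕₚ.+-suc (wt (p ∷ P)) (n′ ℕ.+ 0)) μ)) (ℕₚ.≤-trans (ℕₚ.n≤1+n _) lt))
        cases (b ∷ B) refl = subst₂ _<_ (sym (traded₂ (bumpHead p P) (bumpTail p P) n b B)) (sym (traded₂ p P (suc n) b B))
          (+-mono-<-≤ (cut-< p P n N lt′) (+-mono-≤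
            (*-monoʳ _ (f≥0 [] b B) (<⇒≤ (bump-<′ k p P n [] shorter lt)))
            (+-mono-≤ (left N refl) (trade-≤ {λ y Y → f (n ∷ bump p P) y Y} {λ y Y → f (suc n ∷ p ∷ P) y Y} b B λ y Y e →
              <⇒≤ (bump-<′ k p P n (y ∷ Y) (lower-right y Y e) lt)))))
          where
          r : ∀ a n x → suc (a ℕ.+ (n ℕ.+ suc (suc x))) ≡ a ℕ.+ (n ℕ.+ suc (suc (suc x)))
          r = solveℕ
          lower-right : ∀ y Y → suc (y ℕ.+ wt Y) ≡ b ℕ.+ wt B → wt (p ∷ P) ℕ.+ (n ℕ.+ wt (y ∷ Y)) ℕ.≤ k
          lower-right y Y e = ℕₚ.≤-pred (subst (ℕ._≤ suc k)
            (trans (cong (λ w → wt (p ∷ P) ℕ.+ (n ℕ.+ suc (suc w))) (sym e)) (sym (r (wt (p ∷ P)) n (y ℕ.+ wt Y)))) μ)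
          shorter : wt (p ∷ P) ℕ.+ (n ℕ.+ 0) ℕ.≤ k
          shorter = ℕₚ.≤-pred (ℕₚ.≤-trans (ℕₚ.+-monoʳ-< (wt (p ∷ P)) (ℕₚ.+-monoʳ-< n (ℕ.s≤s ℕ.z≤n))) μ)

    bump-< : ∀ p P n N → suc n ℕ.≤ last p P → f (bump p P) n N < f (p ∷ P) (suc n) N
    bump-< p P n N = bump-<′ _ p P n N ℕₚ.≤-refl

  word : List ℕ → ℕ → List ℕ → ℕ → List ℕ → List ℕ
  word M m L n N = M ++ m ∷ L ++ n ∷ N

  fw-reverse : ∀ w → fw (reverse w) ≡ fw w
  fw-reverse []      = refl
  fw-reverse (p ∷ B) = f-rev B p []

  f-reverse : ∀ A p B → f (reverse A) p B ≡ fw (A ++ p ∷ B)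
  f-reverse A p B = cong fw (trans (ʳ++-defn (reverse A)) (cong (_++ p ∷ B) (reverse-involutive A)))

  zip-right : ∀ M m L n N → f (reverse (M ++ m ∷ L)) n N ≡ fw (word M m L n N)
  zip-right M m L n N = trans (f-reverse (M ++ m ∷ L) n N) (cong fw (++-assoc M (m ∷ L) (n ∷ N)))

  zip-left : ∀ M m L n N → f (L ++ n ∷ N) m (reverse M) ≡ fw (word M m L n N)
  zip-left M m L n N = trans (f-rev (L ++ n ∷ N) m (reverse M)) (f-reverse M m (L ++ n ∷ N))

  reverse-word : ∀ M m L n N → reverse (word M m L n N) ≡ word (reverse N) n (reverse L) m (reverse M)
  reverse-word M m L n N = begin
    reverse (M ++ m ∷ L ++ n ∷ N)
      ≡⟨ reverse-++ M (m ∷ L ++ n ∷ N) ⟩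
    reverse (m ∷ L ++ n ∷ N) ++ reverse M
      ≡⟨ cong (_++ reverse M) (reverse-++ (m ∷ L) (n ∷ N)) ⟩
    (reverse (n ∷ N) ++ reverse (m ∷ L)) ++ reverse M
      ≡⟨ ++-assoc (reverse (n ∷ N)) (reverse (m ∷ L)) (reverse M) ⟩
    reverse (n ∷ N) ++ reverse (m ∷ L) ++ reverse M
      ≡⟨ cong₂ (λ u v → u ++ v ++ reverse M) (unfold-reverse n N) (unfold-reverse m L) ⟩
    (reverse N ++ n ∷ []) ++ (reverse L ++ m ∷ []) ++ reverse M
      ≡⟨ ++-assoc (reverse N) (n ∷ []) _ ⟩
    reverse N ++ n ∷ (reverse L ++ m ∷ []) ++ reverse M
      ≡⟨ cong (λ u → reverse N ++ n ∷ u) (++-assoc (reverse L) (m ∷ []) (reverse M)) ⟩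
    reverse N ++ n ∷ reverse L ++ m ∷ reverse M ∎
    where open ≡-Reasoning

  fw-mirror : ∀ M m L n N → fw (word M m L n N) ≡ fw (word (reverse N) n (reverse L) m (reverse M))
  fw-mirror M m L n N = trans (sym (fw-reverse (word M m L n N))) (cong fw (reverse-word M m L n N))

  unmirror : ∀ M m L n N → fw (word (reverse N) m (reverse L) n (reverse M)) ≡ fw (word M n L m N)
  unmirror M m L n N = sym (fw-mirror M n L m N)

  last-ʳ++ : ∀ x P → ∃ λ p → ∃ λ Q → (reverse (x ∷ P) ≡ p ∷ Q) × (reverse (suc x ∷ P) ≡ bump p Q) × (last p Q ≡ x)
  last-ʳ++ x P = subst₂ (λ u v → ∃ λ p → ∃ λ Q → (u ≡ p ∷ Q) × (v ≡ bump p Q) × (last p Q ≡ x))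
    (sym (unfold-reverse x P)) (sym (unfold-reverse (suc x) P)) (snoc (reverse P))
    where
    snoc : ∀ R → ∃ λ p → ∃ λ Q → (R ++ x ∷ [] ≡ p ∷ Q) × (R ++ suc x ∷ [] ≡ bump p Q) × (last p Q ≡ x)
    snoc []      = x , [] , refl , refl , refl
    snoc (r ∷ R) with snoc R
    ... | p , Q , e₁ , e₂ , e₃ = r , p ∷ Q , cong (r ∷_) e₁ , cong (r ∷_) e₂ , e₃

  -- Here a and c are the values before a continuation, X and Y those after it. The ratio inequality
  -- says that continuing is at least as favourable for the larger word.
  cross-< : ∀ {a c X Y} → 0ℚ < a → 0ℚ < X → c < a → a * Y ≤ X * c → Y < X
  cross-< {a} {c} {X} {Y} a>0 X>0 c<a h = cancel-< a a>0 (≤-<-trans h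
    (subst (X * c <_) (*-comm X a) (0<-⇒< (subst (0ℚ <_) (r X a c) (0<* X>0 (<⇒0<- c<a))))))
    where
    opaque
      unfolding _+_
      r : ∀ X a c → X * (a - c) ≡ X * a - X * c
      r = solve-∀ ring

  -- From the assumption to every arrangement of two exponents

  module Chain
    (hyp : ∀ m n L M → suc n ℕ.≤ m → fw (word M n L (suc m) []) < fw (word M m L (suc n) []))
    where

    crossing : ∀ m n L M N → suc n ℕ.≤ m → fw (word M n L (suc m) N) < fw (word M m L (suc n) N)
    crossing m n L M N lt = subst₂ _<_ (zip-right M n L (suc m) N) (zip-right M m L (suc n) N)
      (cross-< (f>0 A (suc n) []) (f>0 A (suc n) N)
        (subst₂ _<_ (sym (zip-right M n L (suc m) [])) (sym (zip-right M m L (suc n) [])) (hyp m n L M lt))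
        (ratio (suc n) (suc m) A C N (ℕ.s≤s lt)))
      where
      A = reverse (M ++ m ∷ L)
      C = reverse (M ++ n ∷ L)

    private
      diagonal : ∀ p P n N → last p P ≡ suc n → f (bump p P) n N < f (p ∷ P) (suc n) N
      diagonal p P n N eq with bump-ʳ++ p P []
      -- The crossing of n and n + 2 against n + 1 and n + 1, read backwards: the continuation N
      -- becomes the prefix, and the continuation of the crossed word is empty.
      ... | Q , e₁ , e₂ = subst₂ _<_ (lhs n) (rhs (suc n)) (crossing (suc n) n (reverse Q) (reverse N) [] ℕₚ.≤-refl)
        where
        open ≡-Reasoning
        word′ : ∀ k K Z → Z ʳ++ [] ≡ k ∷ K → ∀ j → fw (word (reverse N) j (reverse K) k []) ≡ f Z j N
        word′ k K Z e j = begin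
          fw (word (reverse N) j (reverse K) k []) ≡⟨ unmirror [] j K k N ⟩
          fw (k ∷ K ++ j ∷ N)                      ≡⟨ cong (λ z → fw (z ++ j ∷ N)) e ⟨
          fw ((Z ʳ++ []) ++ j ∷ N)                 ≡⟨ cong fw (ʳ++-defn Z) ⟨
          f Z j N                                  ∎
        lhs : ∀ j → fw (word (reverse N) j (reverse Q) (suc (suc n)) []) ≡ f (bump p P) j N
        lhs = word′ (suc (suc n)) Q (bump p P) (trans e₂ (cong (λ l → suc l ∷ Q) eq))
        rhs : ∀ j → fw (word (reverse N) j (reverse Q) (suc n) []) ≡ f (p ∷ P) j N
        rhs = word′ (suc n) Q (p ∷ P) (trans e₁ (cong (_∷ Q) eq))

    open Bump diagonal

    private
      widening₀ : ∀ m n L N → suc n ℕ.≤ m → fw (word [] (suc m) L n N) < fw (word [] m L (suc n) N)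
      widening₀ m n L N lt with last-ʳ++ m L
      ... | p , Q , e₁ , e₂ , e₃ = subst₂ _<_
        (trans (cong (λ Z → f Z n N) (sym e₂)) (zip-right [] (suc m) L n N))
        (trans (cong (λ Z → f Z (suc n) N) (sym e₁)) (zip-right [] m L (suc n) N))
        (bump-< p Q n N (subst (suc n ℕ.≤_) (sym e₃) lt))

    widening : ∀ m n L M N → suc n ℕ.≤ m → fw (word M (suc m) L n N) < fw (word M m L (suc n) N)
    widening m n L M N lt = subst₂ _<_ (zip-left M (suc m) L n N) (zip-left M m L (suc n) N)
      (cross-< (f>0 A m []) (f>0 A m (reverse M))
        (subst₂ _<_ (sym (zip-left [] (suc m) L n N)) (sym (zip-left [] m L (suc n) N)) (widening₀ m n L N lt))
        (ratio m (suc m) A C (reverse M) ℕₚ.≤-refl))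
      where
      A = L ++ suc n ∷ N
      C = L ++ n ∷ N

    crossing′ : ∀ m n L M N → suc n ℕ.≤ m → fw (word M (suc m) L n N) < fw (word M (suc n) L m N)
    crossing′ m n L M N lt = subst₂ _<_ (unmirror M n L (suc m) N) (unmirror M m L (suc n) N)
      (crossing m n (reverse L) (reverse N) (reverse M) lt)

    widening′ : ∀ m n L M N → suc n ℕ.≤ m → fw (word M n L (suc m) N) < fw (word M (suc n) L m N)
    widening′ m n L M N lt = subst₂ _<_ (unmirror M (suc m) L n N) (unmirror M m L (suc n) N)
      (widening m n (reverse L) (reverse N) (reverse M) lt)

    module _ (L M N : List ℕ) where

      -- Records which place receives a, meant as the larger entry, so that one descent covers all
      -- combinations of orders.
      data Value (a b : ℕ) : ℚ → Set where
        straight : Value a b (fw (word M a L b N))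
        crossed  : Value a b (fw (word M b L a N))

      step : ∀ {m n v w} → suc n ℕ.≤ m → Value m (suc n) v → Value (suc m) n w → w < v
      step lt straight straight = widening _ _ L M N lt
      step lt straight crossed  = crossing _ _ L M N lt
      step lt crossed  straight = crossing′ _ _ L M N lt
      step lt crossed  crossed  = widening′ _ _ L M N lt

      -- A unit step compares any two orders, so the order of the intermediate pairs is free;
      -- `straight` is chosen. Moving apart preserves the side condition of `step`.
      steps : ∀ t {m n v w} → suc t ℕ.+ n ℕ.≤ m → Value m (suc t ℕ.+ n) v → Value (suc t ℕ.+ m) n w → w < v
      steps zero    lt v w = step lt v w
      steps (suc t) {m} {n} {w = x} lt v w =
        <-trans (steps t (ℕₚ.≤-trans (ℕₚ.n≤1+n _) (ℕₚ.m≤n⇒m≤1+n lt)) straight (subst (λ j → Value j n x) (sym (ℕₚ.+-suc (suc t) m)) w))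
                (step lt v straight)

      private
        gap : ∀ {a b a′ b′} → a ℕ.+ b ≡ a′ ℕ.+ b′ → b ℕ.≤ a → a ℕ.∸ b ℕ.< a′ ℕ.∸ b′ → a ℕ.< a′
        gap {a} {b} {a′} {b′} s _ d with ℕₚ.≤-total a′ a
        ... | inj₂ a≤a′ with ℕₚ.m≤n⇒m<n∨m≡n a≤a′
        ...   | inj₁ lt   = lt
        ...   | inj₂ refl with ℕₚ.+-cancelˡ-≡ a b b′ s
        ...     | refl = contra d
          where
          contra : a ℕ.∸ b ℕ.< a ℕ.∸ b → a ℕ.< a
          contra d = contradiction d (ℕₚ.<-irrefl refl)
        gap {a} {b} {a′} {b′} s _ d | inj₁ a′≤a = contradiction (ℕₚ.<-≤-trans d (ℕₚ.∸-mono a′≤a b≤b′)) (ℕₚ.<-irrefl refl)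
          where
          b≤b′ : b ℕ.≤ b′
          b≤b′ = ℕₚ.+-cancelˡ-≤ a b b′ (ℕₚ.≤-trans (ℕₚ.≤-reflexive s) (ℕₚ.+-monoˡ-≤ b′ a′≤a))

        ordered : ∀ {a b a′ b′ v w} → a ℕ.+ b ≡ a′ ℕ.+ b′ → b ℕ.≤ a → a ℕ.∸ b ℕ.< a′ ℕ.∸ b′ →
          Value a b v → Value a′ b′ w → w < v
        ordered {a} {b} {a′} {b′} {w = x} s b≤a d v w with ℕₚ.m≤n⇒∃[o]m+o≡n (gap {a} {b} {a′} {b′} s b≤a d)
        ... | t , refl = steps t (subst (ℕ._≤ a) b≡ b≤a) (subst (λ j → Value a j _) b≡ v)
                                 (subst (λ j → Value j b′ x) (cong suc (ℕₚ.+-comm a t)) w)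
          where
          r : ∀ a t b → suc (a ℕ.+ t) ℕ.+ b ≡ a ℕ.+ (suc t ℕ.+ b)
          r = solveℕ
          b≡ : b ≡ suc t ℕ.+ b′
          b≡ = ℕₚ.+-cancelˡ-≡ a b _ (trans s (r a t b′))

        arrange : ∀ m n → ∃ λ a → ∃ λ b → (b ℕ.≤ a) × (a ℕ.+ b ≡ m ℕ.+ n) × (∣ m - n ∣ ≡ a ℕ.∸ b) × Value a b (fw (word M m L n N))
        arrange m n with ℕₚ.≤-total n m
        ... | inj₁ n≤m = m , n , n≤m , refl , ℕₚ.m≤n⇒∣n-m∣≡n∸m n≤m , straight
        ... | inj₂ m≤n = n , m , m≤n , ℕₚ.+-comm n m , ℕₚ.m≤n⇒∣m-n∣≡n∸m m≤n , crossed

      balanced : ∀ m₁ n₁ m₂ n₂ → m₁ ℕ.+ n₁ ≡ m₂ ℕ.+ n₂ → ∣ m₁ - n₁ ∣ ℕ.< ∣ m₂ - n₂ ∣ →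
        fw (word M m₂ L n₂ N) < fw (word M m₁ L n₁ N)
      balanced m₁ n₁ m₂ n₂ s d with arrange m₁ n₁ | arrange m₂ n₂
      ... | a , b , b≤a , s₁ , d₁ , v | a′ , b′ , _ , s₂ , d₂ , w =
        ordered (trans s₁ (trans s (sym s₂))) b≤a (subst₂ ℕ._<_ d₁ d₂ d) v w

-- Flag f-vector and flag h-vector of the Boolean lattice

module FlagVector where

  open import Defs hiding (c; d)
  open import Data.Bool as Bool using (Bool; true; false; if_then_else_; _∧_)
  import Data.Bool.Properties as Boolₚ
  open import Data.Nat as ℕ using (ℕ; zero; suc; _!)
  import Data.Nat.Properties as ℕₚ
  open import Data.Nat.Tactic.RingSolver using () renaming (solve-∀ to solveℕ)
  open import Data.Nat.ListAction using (sum)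
  open import Data.Nat.ListAction.Properties using (sum-++)
  open import Data.Integer as ℤ using (ℤ; +_)
  import Data.Integer.Properties as ℤₚ
  open import Data.Integer.Tactic.RingSolver using () renaming (solve-∀ to solveℤ)
  open import Data.List as List using (List; []; _∷_; map; filter)
  import Data.List.Properties as Listₚ
  open import Data.Vec using (Vec; []; _∷_; replicate; _++_)
  open import Relation.Nullary using (contradiction)
  open import Relation.Binary.PropositionalEquality

  choose : ℕ → ℕ → ℕ
  choose m       zero    = 1
  choose zero    (suc j) = 0
  choose (suc m) (suc j) = choose m j ℕ.+ choose m (suc j)

  choose-above : ∀ m j → choose m (suc m ℕ.+ j) ≡ 0
  choose-above zero    j = refl
  choose-above (suc m) j = cong₂ ℕ._+_ (choose-above m j)
    (trans (cong (λ i → choose m (suc i)) (sym (ℕₚ.+-suc m j))) (choose-above m (suc j)))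

  choose-! : ∀ a b → choose (a ℕ.+ b) a ℕ.* (a ! ℕ.* b !) ≡ (a ℕ.+ b) !
  choose-! zero    b       = trans (ℕₚ.*-identityˡ _) (ℕₚ.*-identityˡ _)
  choose-! (suc a) zero    = trans (cong (λ i → (choose i a ℕ.+ choose i (suc a)) ℕ.* (suc a ! ℕ.* 1)) (ℕₚ.+-identityʳ a))
    (trans (cong₂ (λ x y → (x ℕ.+ y) ℕ.* (suc a ! ℕ.* 1)) (diagonal a)
      (trans (cong (λ i → choose a (suc i)) (sym (ℕₚ.+-identityʳ a))) (choose-above a 0)))
      (trans (r (suc a !)) (cong (λ i → suc i !) (sym (ℕₚ.+-identityʳ a)))))
    where
    r : ∀ x → (1 ℕ.+ 0) ℕ.* (x ℕ.* 1) ≡ x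
    r = solveℕ
    diagonal : ∀ a → choose a a ≡ 1
    diagonal zero    = refl
    diagonal (suc a) = cong₂ ℕ._+_ (diagonal a)
      (trans (cong (λ i → choose a (suc i)) (sym (ℕₚ.+-identityʳ a))) (choose-above a 0))
  choose-! (suc a) (suc b) = trans (r₁ a b (choose (a ℕ.+ suc b) a) (choose (a ℕ.+ suc b) (suc a)) (a !) (b !))
    (trans (cong₂ (λ x y → suc a ℕ.* x ℕ.+ suc b ℕ.* y) (choose-! a (suc b))
      (trans (cong (λ i → choose i (suc a) ℕ.* (suc a ! ℕ.* b !)) (ℕₚ.+-suc a b)) (trans (choose-! (suc a) b) (cong _! (sym (ℕₚ.+-suc a b))))))
      (r₂ a b ((a ℕ.+ suc b) !)))
    where
    r₁ : ∀ a b x y u v → (x ℕ.+ y) ℕ.* ((u ℕ.+ a ℕ.* u) ℕ.* (v ℕ.+ b ℕ.* v)) ≡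
      suc a ℕ.* (x ℕ.* (u ℕ.* (v ℕ.+ b ℕ.* v))) ℕ.+ suc b ℕ.* (y ℕ.* ((u ℕ.+ a ℕ.* u) ℕ.* v))
    r₁ = solveℕ
    r₂ : ∀ a b z → suc a ℕ.* z ℕ.+ suc b ℕ.* z ≡ suc (a ℕ.+ suc b) ℕ.* z
    r₂ = solveℕ

  corank : ∀ {n} → Subset n → ℕ
  corank []          = 0
  corank (true ∷ x)  = corank x
  corank (false ∷ x) = suc (corank x)

  card+corank : ∀ {n} (x : Subset n) → card x ℕ.+ corank x ≡ n
  card+corank []          = refl
  card+corank (true ∷ x)  = cong suc (card+corank x)
  card+corank (false ∷ x) = trans (ℕₚ.+-suc (card x) (corank x)) (cong suc (card+corank x))

  sumOver : ∀ {n} → (Subset n → ℕ) → ℕ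
  sumOver {n} g = sum (map g (allSubsets n))

  sumOver-cong : ∀ {n} {g h : Subset n → ℕ} → (∀ y → g y ≡ h y) → sumOver g ≡ sumOver h
  sumOver-cong {n} e = cong sum (Listₚ.map-cong e (allSubsets n))

  sumOver-∷ : ∀ {n} (g : Subset (suc n) → ℕ) →
    sumOver g ≡ sumOver (λ y → g (false ∷ y)) ℕ.+ sumOver (λ y → g (true ∷ y))
  sumOver-∷ {n} g = trans (cong sum (Listₚ.map-++ g (map (false ∷_) xs) (map (true ∷_) xs)))
    (trans (sum-++ (map g (map (false ∷_) xs)) _)
      (cong₂ (λ u v → sum u ℕ.+ sum v) (sym (Listₚ.map-∘ xs)) (sym (Listₚ.map-∘ xs))))
    where xs = allSubsets n

  sumOver-*ʳ : ∀ {n} (g : Subset n → ℕ) k → sumOver (λ y → g y ℕ.* k) ≡ sumOver g ℕ.* k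
  sumOver-*ʳ {n} g k = go (allSubsets n)
    where
    go : ∀ xs → sum (map (λ y → g y ℕ.* k) xs) ≡ sum (map g xs) ℕ.* k
    go []       = refl
    go (x ∷ xs) = trans (cong (g x ℕ.* k ℕ.+_) (go xs)) (sym (ℕₚ.*-distribʳ-+ k (g x) (sum (map g xs))))

  sumOver-0 : ∀ n → sumOver {n} (λ _ → 0) ≡ 0
  sumOver-0 n = trans (sumOver-*ʳ {n} (λ _ → 0) 0) (ℕₚ.*-zeroʳ (sumOver {n} (λ _ → 0)))

  indicator : Bool → ℕ
  indicator b = if b then 1 else 0

  above : ∀ {n} → Subset n → ℕ → ℕ
  above x s = sumOver (λ y → indicator (subsetᵇ x y ∧ eqℕᵇ (card y) s))

  above-low : ∀ {n} (x : Subset n) s → s ℕ.< card x → above x s ≡ 0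
  above-low {suc n} (true ∷ x) zero    lt = trans (sumOver-∷ (λ y → indicator (subsetᵇ (true ∷ x) y ∧ eqℕᵇ (card y) 0)))
    (cong₂ ℕ._+_ (sumOver-0 n) (trans (sumOver-cong λ y → cong indicator (Boolₚ.∧-zeroʳ (subsetᵇ x y))) (sumOver-0 n)))
  above-low {suc n} (true ∷ x) (suc s) (ℕ.s≤s lt) = trans (sumOver-∷ (λ y → indicator (subsetᵇ (true ∷ x) y ∧ eqℕᵇ (card y) (suc s))))
    (cong₂ ℕ._+_ (sumOver-0 n) (above-low x s lt))
  above-low {suc n} (false ∷ x) zero    lt = trans (sumOver-∷ (λ y → indicator (subsetᵇ (false ∷ x) y ∧ eqℕᵇ (card y) 0)))
    (cong₂ ℕ._+_ (above-low x 0 lt) (trans (sumOver-cong λ y → cong indicator (Boolₚ.∧-zeroʳ (subsetᵇ x y))) (sumOver-0 n)))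
  above-low {suc n} (false ∷ x) (suc s) lt = trans (sumOver-∷ (λ y → indicator (subsetᵇ (false ∷ x) y ∧ eqℕᵇ (card y) (suc s))))
    (cong₂ ℕ._+_ (above-low x (suc s) lt) (above-low x s (ℕₚ.<-trans (ℕₚ.n<1+n s) lt)))

  above-choose : ∀ {n} (x : Subset n) j → above x (card x ℕ.+ j) ≡ choose (corank x) j
  above-choose []          zero    = refl
  above-choose []          (suc j) = refl
  above-choose {suc n} (true ∷ x)  j       = trans (sumOver-∷ (λ y → indicator (subsetᵇ (true ∷ x) y ∧ eqℕᵇ (card y) (suc (card x ℕ.+ j)))))
    (cong₂ ℕ._+_ (sumOver-0 n) (above-choose x j))
  above-choose {suc n} (false ∷ x) zero    = trans (sumOver-∷ (λ y → indicator (subsetᵇ (false ∷ x) y ∧ eqℕᵇ (card y) (card x ℕ.+ 0))))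
    (trans (cong₂ ℕ._+_ (above-choose x 0) (vanish (card x ℕ.+ 0) (ℕₚ.+-identityʳ (card x)))) refl)
    where
    vanish : ∀ s → s ≡ card x → sumOver (λ y → indicator (subsetᵇ x y ∧ eqℕᵇ (suc (card y)) s)) ≡ 0
    vanish zero    _ = trans (sumOver-cong λ y → cong indicator (Boolₚ.∧-zeroʳ (subsetᵇ x y))) (sumOver-0 n)
    vanish (suc s) e = above-low x s (ℕₚ.≤-reflexive e)
  above-choose {suc n} (false ∷ x) (suc j) = trans (sumOver-∷ (λ y → indicator (subsetᵇ (false ∷ x) y ∧ eqℕᵇ (card y) (card x ℕ.+ suc j))))
    (trans (cong₂ ℕ._+_ (above-choose x (suc j))
      (trans (cong (λ s → sumOver (λ y → indicator (subsetᵇ x y ∧ eqℕᵇ (suc (card y)) s))) (ℕₚ.+-suc (card x) j)) (above-choose x j)))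
      (ℕₚ.+-comm (choose (corank x) (suc j)) (choose (corank x) j)))

  eqℕᵇ-sound : ∀ m n → eqℕᵇ m n ≡ true → m ≡ n
  eqℕᵇ-sound zero    zero    _ = refl
  eqℕᵇ-sound (suc m) (suc n) e = cong suc (eqℕᵇ-sound m n e)

  equal-card : ∀ {n} (x y : Subset n) → subsetᵇ x y ≡ true → differᵇ x y ≡ false → card x ≡ card y
  equal-card []          []          _ _ = refl
  equal-card (true ∷ x)  (true ∷ y)  s e = cong suc (equal-card x y s e)
  equal-card (false ∷ x) (false ∷ y) s e = equal-card x y s e

  -- Inclusion between sets of different cardinality is automatically proper, so chains can be
  -- counted with plain inclusion, which is what the binomial count of supersets needs.
  strict : ∀ {n} (x y : Subset n) s → card x ℕ.< s →
    ltᵇ x y ∧ eqℕᵇ (card y) s ≡ subsetᵇ x y ∧ eqℕᵇ (card y) s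
  strict x y s lt with subsetᵇ x y in sub | differᵇ x y in dif | eqℕᵇ (card y) s in eq
  ... | false | _     | _     = refl
  ... | true  | true  | _     = refl
  ... | true  | false | false = refl
  ... | true  | false | true  = contradiction (trans (equal-card x y sub dif) (eqℕᵇ-sound (card y) s eq)) (ℕₚ.<⇒≢ lt)

  data Increasing : ℕ → List ℕ → Set where
    []  : ∀ {k} → Increasing k []
    _∷_ : ∀ {k s ss} → k ℕ.< s → Increasing s ss → Increasing k (s ∷ ss)

  -- Upper intervals of a Boolean lattice are Boolean, so the count depends only on the rank k of
  -- the starting set and each further rank contributes a binomial coefficient.
  chainCount : ℕ → ℕ → List ℕ → ℕ
  chainCount n k []       = indicator (k ℕ.<ᵇ n)
  chainCount n k (s ∷ ss) = choose (n ℕ.∸ k) (s ℕ.∸ k) ℕ.* chainCount n s ss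

  proper : ∀ {n} (x : Subset n) → ltᵇ x (fullSet n) ≡ (card x ℕ.<ᵇ n)
  proper []          = refl
  proper (true ∷ x)  = proper x
  proper {suc n} (false ∷ x) = trans (cong (_∧ true) (below x)) (sym (Tᵇ (card x) n (card≤ x)))
    where
    below : ∀ {n} (x : Subset n) → subsetᵇ x (fullSet n) ≡ true
    below []          = refl
    below (true ∷ x)  = below x
    below (false ∷ x) = below x
    card≤ : ∀ {n} (x : Subset n) → card x ℕ.≤ n
    card≤ x = subst (card x ℕ.≤_) (card+corank x) (ℕₚ.m≤m+n (card x) (corank x))
    Tᵇ : ∀ m n → m ℕ.≤ n → (m ℕ.<ᵇ suc n) ≡ true
    Tᵇ zero    n       _          = refl
    Tᵇ (suc m) (suc n) (ℕ.s≤s le) = Tᵇ m n le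

  chainsAbove-count : ∀ {n} (x : Subset n) ss → Increasing (card x) ss → chainsAbove x ss ≡ chainCount n (card x) ss
  chainsAbove-count {n} x []       []         = cong indicator (proper x)
  chainsAbove-count {n} x (s ∷ ss) (lt ∷ inc) = begin
    sumOver (λ y → if ltᵇ x y ∧ eqℕᵇ (card y) s then chainsAbove y ss else 0)
      ≡⟨ sumOver-cong term ⟩
    sumOver (λ y → indicator (subsetᵇ x y ∧ eqℕᵇ (card y) s) ℕ.* chainCount n s ss)
      ≡⟨ sumOver-*ʳ (λ y → indicator (subsetᵇ x y ∧ eqℕᵇ (card y) s)) (chainCount n s ss) ⟩
    above x s ℕ.* chainCount n s ss
      ≡⟨ cong (λ t → above x t ℕ.* chainCount n s ss) (ℕₚ.m+[n∸m]≡n (ℕₚ.<⇒≤ lt)) ⟨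
    above x (card x ℕ.+ (s ℕ.∸ card x)) ℕ.* chainCount n s ss
      ≡⟨ cong (ℕ._* chainCount n s ss) (trans (above-choose x (s ℕ.∸ card x)) (cong (λ m → choose m (s ℕ.∸ card x)) co)) ⟩
    choose (n ℕ.∸ card x) (s ℕ.∸ card x) ℕ.* chainCount n s ss ∎
    where
    open ≡-Reasoning
    co : corank x ≡ n ℕ.∸ card x
    co = trans (sym (ℕₚ.m+n∸m≡n (card x) (corank x))) (cong (ℕ._∸ card x) (card+corank x))
    term : ∀ y → (if ltᵇ x y ∧ eqℕᵇ (card y) s then chainsAbove y ss else 0)
      ≡ indicator (subsetᵇ x y ∧ eqℕᵇ (card y) s) ℕ.* chainCount n s ss
    term y rewrite strict x y s lt with subsetᵇ x y | eqℕᵇ (card y) s in eq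
    ... | false | _     = refl
    ... | true  | false = refl
    ... | true  | true  with eqℕᵇ-sound (card y) s eq
    ...   | refl = trans (chainsAbove-count y ss inc) (sym (ℕₚ.+-identityʳ _))

  chainCount-shift : ∀ j n k ss → chainCount (j ℕ.+ n) (j ℕ.+ k) (map (j ℕ.+_) ss) ≡ chainCount n k ss
  chainCount-shift j n k []       = cong indicator (shift j)
    where
    shift : ∀ j → (j ℕ.+ k ℕ.<ᵇ j ℕ.+ n) ≡ (k ℕ.<ᵇ n)
    shift zero    = refl
    shift (suc j) = shift j
  chainCount-shift j n k (s ∷ ss) = cong₂ ℕ._*_
    (cong₂ choose (ℕₚ.[m+n]∸[m+o]≡n∸o j n k) (ℕₚ.[m+n]∸[m+o]≡n∸o j s k)) (chainCount-shift j n s ss)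

  rankList-increasing : ∀ {r} k i (T : Vec Bool r) → k ℕ.< i → Increasing k (rankList i T)
  rankList-increasing k i []          lt = []
  rankList-increasing k i (true ∷ T)  lt = lt ∷ rankList-increasing i (suc i) T ℕₚ.≤-refl
  rankList-increasing k i (false ∷ T) lt = rankList-increasing k (suc i) T (ℕₚ.m≤n⇒m≤1+n lt)

  rankList-shift : ∀ {r} j i (T : Vec Bool r) → rankList (j ℕ.+ i) T ≡ map (j ℕ.+_) (rankList i T)
  rankList-shift j i []          = refl
  rankList-shift j i (true ∷ T)  = cong (j ℕ.+ i ∷_) (trans (cong (λ k → rankList k T) (sym (ℕₚ.+-suc j i))) (rankList-shift j (suc i) T))
  rankList-shift j i (false ∷ T) = trans (cong (λ k → rankList k T) (sym (ℕₚ.+-suc j i))) (rankList-shift j (suc i) T)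

  rankList-replicate : ∀ k i {r} (T : Vec Bool r) → rankList i (replicate k false ++ true ∷ T) ≡ k ℕ.+ i ∷ rankList (suc (k ℕ.+ i)) T
  rankList-replicate zero    i T = refl
  rankList-replicate (suc k) i T = trans (rankList-replicate k (suc i) T) (cong (λ j → j ∷ rankList (suc j) T) (ℕₚ.+-suc k i))

  rankList-empty : ∀ r i → rankList i (replicate r false) ≡ []
  rankList-empty zero    i = refl
  rankList-empty (suc r) i = rankList-empty r (suc i)

  card-empty : ∀ n → card (emptySet n) ≡ 0
  card-empty zero    = refl
  card-empty (suc n) = card-empty n

  flagF-count : ∀ r (T : Vec Bool r) → flagF r T ≡ chainCount (suc r) 0 (rankList 1 T)
  flagF-count r T = trans
    (chainsAbove-count (emptySet (suc r)) (rankList 1 T) (subst (λ k → Increasing k (rankList 1 T)) (sym (card-empty (suc r))) (rankList-increasing 0 1 T (ℕ.s≤s ℕ.z≤n))))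
    (cong (λ k → chainCount (suc r) k (rankList 1 T)) (card-empty (suc r)))

  flagF-empty : ∀ r → flagF r (replicate r false) ≡ 1
  flagF-empty r = trans (flagF-count r (replicate r false)) (cong (chainCount (suc r) 0) (rankList-empty r 1))

  -- The least rank of the chain is k + 1. The interval above an element of this rank is a Boolean
  -- lattice of rank s + 1, with all later ranks shifted by k + 1.
  flagF-first : ∀ k s (T : Vec Bool s) →
    flagF (k ℕ.+ suc s) (replicate k false ++ true ∷ T) ≡ choose (suc k ℕ.+ suc s) (suc k) ℕ.* flagF s T
  flagF-first k s T = trans (flagF-count (k ℕ.+ suc s) (replicate k false ++ true ∷ T))
    (trans (cong (chainCount n 0) (trans (rankList-replicate k 1 T) (cong (λ j → j ∷ rankList (suc j) T) (ℕₚ.+-comm k 1))))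
      (cong (choose n (suc k) ℕ.*_)
        (trans (cong₂ (chainCount n) (sym (ℕₚ.+-identityʳ (suc k)))
                  (trans (cong (λ j → rankList j T) (ℕₚ.+-comm 1 (suc k))) (rankList-shift (suc k) 1 T)))
        (trans (chainCount-shift (suc k) (suc s) 0 (rankList 1 T)) (sym (flagF-count s T))))))
    where n = suc k ℕ.+ suc s

  -- Inclusion-exclusion one rank at a time: the sign of a subset turns into a subtraction at each
  -- rank of S that may be omitted.
  alternating : ∀ {r} → Vec Bool r → (Vec Bool r → ℤ) → ℤ
  alternating []          g = g []
  alternating (false ∷ S) g = alternating S (λ T → g (false ∷ T))
  alternating (true ∷ S)  g = alternating S (λ T → g (true ∷ T)) ℤ.- alternating S (λ T → g (false ∷ T))

  sumℤ-++ : ∀ xs ys → sumℤ (xs List.++ ys) ≡ sumℤ xs ℤ.+ sumℤ ys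
  sumℤ-++ []       ys = sym (ℤₚ.+-identityˡ (sumℤ ys))
  sumℤ-++ (x ∷ xs) ys = trans (cong (λ t → x ℤ.+ t) (sumℤ-++ xs ys)) (sym (ℤₚ.+-assoc x (sumℤ xs) (sumℤ ys)))

  sumIf : {A : Set} → (A → Bool) → (A → ℤ) → List A → ℤ
  sumIf p g []       = + 0
  sumIf p g (x ∷ xs) = (if p x then g x else + 0) ℤ.+ sumIf p g xs

  sumIf-filter : {A : Set} (p : A → Bool) (g : A → ℤ) (xs : List A) →
    sumℤ (map g (filter (λ x → p x Bool.≟ true) xs)) ≡ sumIf p g xs
  sumIf-filter p g []       = refl
  sumIf-filter p g (x ∷ xs) with p x
  ... | true  = cong (λ t → g x ℤ.+ t) (sumIf-filter p g xs)
  ... | false = trans (sumIf-filter p g xs) (sym (ℤₚ.+-identityˡ _))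

  sumIf-cong : {A : Set} {p q : A → Bool} {g h : A → ℤ} (xs : List A) → (∀ x → p x ≡ q x) → (∀ x → q x ≡ true → g x ≡ h x) →
    sumIf p g xs ≡ sumIf q h xs
  sumIf-cong []       e e′ = refl
  sumIf-cong {p = p} {q} {g} {h} (x ∷ xs) e e′ = cong₂ ℤ._+_ (term x) (sumIf-cong xs e e′)
    where
    term : ∀ x → (if p x then g x else + 0) ≡ (if q x then h x else + 0)
    term x rewrite e x with q x in eq
    ... | true  = e′ x eq
    ... | false = refl

  sumIf-++ : {A : Set} (p : A → Bool) (g : A → ℤ) (xs ys : List A) → sumIf p g (xs List.++ ys) ≡ sumIf p g xs ℤ.+ sumIf p g ys
  sumIf-++ p g []       ys = sym (ℤₚ.+-identityˡ _)
  sumIf-++ p g (x ∷ xs) ys = trans (cong (λ t → (if p x then g x else + 0) ℤ.+ t) (sumIf-++ p g xs ys)) (sym (ℤₚ.+-assoc (if p x then g x else + 0) _ _))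

  sumIf-map : {A B : Set} (p : B → Bool) (g : B → ℤ) (h : A → B) (xs : List A) → sumIf p g (map h xs) ≡ sumIf (λ x → p (h x)) (λ x → g (h x)) xs
  sumIf-map p g h []       = refl
  sumIf-map p g h (x ∷ xs) = cong (λ t → (if p (h x) then g (h x) else + 0) ℤ.+ t) (sumIf-map p g h xs)

  sumIf-false : {A : Set} (g : A → ℤ) (xs : List A) → sumIf (λ _ → false) g xs ≡ + 0
  sumIf-false g []       = refl
  sumIf-false g (x ∷ xs) = trans (ℤₚ.+-identityˡ _) (sumIf-false g xs)

  sumIf-neg : {A : Set} (p : A → Bool) (g : A → ℤ) (xs : List A) → sumIf p (λ x → ℤ.- g x) xs ≡ ℤ.- sumIf p g xs
  sumIf-neg p g []       = refl
  sumIf-neg p g (x ∷ xs) = trans (cong₂ ℤ._+_ (term (p x)) (sumIf-neg p g xs)) (sym (ℤₚ.neg-distrib-+ (if p x then g x else + 0) (sumIf p g xs)))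
    where
    term : ∀ b → (if b then ℤ.- g x else + 0) ≡ ℤ.- (if b then g x else + 0)
    term true  = refl
    term false = refl

  sign-suc : ∀ k → sign (suc k) ≡ ℤ.- sign k
  sign-suc zero          = refl
  sign-suc (suc zero)    = refl
  sign-suc (suc (suc k)) = sign-suc k

  subset-card : ∀ {n} (x y : Subset n) → subsetᵇ x y ≡ true → card x ℕ.≤ card y
  subset-card []          []          _ = ℕ.z≤n
  subset-card (true ∷ x)  (true ∷ y)  s = ℕ.s≤s (subset-card x y s)
  subset-card (false ∷ x) (true ∷ y)  s = ℕₚ.m≤n⇒m≤1+n (subset-card x y s)
  subset-card (false ∷ x) (false ∷ y) s = subset-card x y s

  alternating-sum : ∀ {r} (S : Vec Bool r) (g : Vec Bool r → ℤ) →
    sumIf (λ T → subsetᵇ T S) (λ T → sign (card S ℕ.∸ card T) ℤ.* g T) (allSubsets r) ≡ alternating S g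
  alternating-sum [] g = trans (ℤₚ.+-identityʳ _) (ℤₚ.*-identityˡ _)
  alternating-sum {suc r} (x ∷ S) g = trans (sumIf-++ p G (map (false ∷_) xs) (map (true ∷_) xs))
    (trans (cong₂ ℤ._+_ (sumIf-map p G (false ∷_) xs) (sumIf-map p G (true ∷_) xs)) (cases x refl))
    where
    xs = allSubsets r
    p : Vec Bool (suc r) → Bool
    p T = subsetᵇ T (x ∷ S)
    G : Vec Bool (suc r) → ℤ
    G T = sign (card (x ∷ S) ℕ.∸ card T) ℤ.* g T
    cases : ∀ x′ → x′ ≡ x → sumIf (λ T → p (false ∷ T)) (λ T → G (false ∷ T)) xs ℤ.+ sumIf (λ T → p (true ∷ T)) (λ T → G (true ∷ T)) xs
      ≡ alternating (x ∷ S) g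
    cases false refl = trans (cong₂ ℤ._+_ (alternating-sum S (λ T → g (false ∷ T))) (sumIf-false _ xs)) (ℤₚ.+-identityʳ _)
    cases true  refl = trans (cong₂ ℤ._+_
      (trans (sumIf-cong xs (λ _ → refl) flipped) (trans (sumIf-neg (λ T → subsetᵇ T S) (λ T → sign (card S ℕ.∸ card T) ℤ.* g (false ∷ T)) xs)
        (cong ℤ.-_ (alternating-sum S (λ T → g (false ∷ T))))))
      (alternating-sum S (λ T → g (true ∷ T))))
      (ℤₚ.+-comm (ℤ.- alternating S (λ T → g (false ∷ T))) (alternating S (λ T → g (true ∷ T))))
      where
      flipped : ∀ T → subsetᵇ T S ≡ true → sign (suc (card S) ℕ.∸ card T) ℤ.* g (false ∷ T) ≡ ℤ.- (sign (card S ℕ.∸ card T) ℤ.* g (false ∷ T))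
      flipped T sub = trans (cong (ℤ._* g (false ∷ T)) (trans (cong sign (ℕₚ.+-∸-assoc 1 (subset-card T S sub))) (sign-suc (card S ℕ.∸ card T))))
        (sym (ℤₚ.neg-distribˡ-* (sign (card S ℕ.∸ card T)) (g (false ∷ T))))

  flagH-alternating : ∀ r (S : Vec Bool r) → flagH r S ≡ alternating S (λ T → + flagF r T)
  flagH-alternating r S = trans (sumIf-filter (λ T → subsetᵇ T S) _ (allSubsets r)) (alternating-sum S (λ T → + flagF r T))

  alternating-cong : ∀ {r} (S : Vec Bool r) {g h : Vec Bool r → ℤ} → (∀ T → g T ≡ h T) → alternating S g ≡ alternating S h
  alternating-cong []          e = e []
  alternating-cong (false ∷ S) e = alternating-cong S (λ T → e (false ∷ T))
  alternating-cong (true ∷ S)  e = cong₂ ℤ._-_ (alternating-cong S (λ T → e (true ∷ T))) (alternating-cong S (λ T → e (false ∷ T)))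

  alternating-* : ∀ {r} (S : Vec Bool r) k (g : Vec Bool r → ℤ) → alternating S (λ T → k ℤ.* g T) ≡ k ℤ.* alternating S g
  alternating-* []          k g = refl
  alternating-* (false ∷ S) k g = alternating-* S k (λ T → g (false ∷ T))
  alternating-* (true ∷ S)  k g = trans (cong₂ ℤ._-_ (alternating-* S k (λ T → g (true ∷ T))) (alternating-* S k (λ T → g (false ∷ T))))
    (distrib k _ _)
    where
    distrib : ∀ k x y → k ℤ.* x ℤ.- k ℤ.* y ≡ k ℤ.* (x ℤ.- y)
    distrib = solveℤ

  alternating-false : ∀ k {s} (S : Vec Bool s) (g : Vec Bool (k ℕ.+ s) → ℤ) →
    alternating (replicate k false ++ S) g ≡ alternating S (λ T → g (replicate k false ++ T))
  alternating-false zero    S g = refl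
  alternating-false (suc k) S g = alternating-false k S (λ T → g (false ∷ T))

  flagH-empty : ∀ r → flagH r (replicate r false) ≡ + 1
  flagH-empty r = trans (flagH-alternating r (replicate r false)) (trans (all r (λ T → + flagF r T)) (cong +_ (flagF-empty r)))
    where
    all : ∀ r (g : Vec Bool r → ℤ) → alternating (replicate r false) g ≡ g (replicate r false)
    all zero    g = refl
    all (suc r) g = all r (λ T → g (false ∷ T))

  -- Adding the h-number of the set without rank k + 1 cancels the chains that avoid this rank.
  -- Those through it split there, and as no smaller rank is prescribed, the lower interval
  -- contributes only the choice of its top.
  flagH-first : ∀ k s (S : Vec Bool s) →
    flagH (k ℕ.+ suc s) (replicate k false ++ true ∷ S) ≡
    + choose (suc k ℕ.+ suc s) (suc k) ℤ.* flagH s S ℤ.- flagH (k ℕ.+ suc s) (replicate k false ++ false ∷ S)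
  flagH-first k s S = trans (flagH-alternating (k ℕ.+ suc s) (replicate k false ++ true ∷ S))
    (trans (alternating-false k (true ∷ S) g)
    (cong₂ ℤ._-_
      (trans (alternating-cong S λ T → trans (cong +_ (flagF-first k s T)) (ℤₚ.pos-* (choose (suc k ℕ.+ suc s) (suc k)) (flagF s T)))
        (trans (alternating-* S (+ choose (suc k ℕ.+ suc s) (suc k)) (λ T → + flagF s T)) (cong (λ t → + choose (suc k ℕ.+ suc s) (suc k) ℤ.* t) (sym (flagH-alternating s S)))))
      (trans (sym (alternating-false k (false ∷ S) g)) (sym (flagH-alternating (k ℕ.+ suc s) (replicate k false ++ false ∷ S))))))
    where
    g : Vec Bool (k ℕ.+ suc s) → ℤ
    g T = + flagF (k ℕ.+ suc s) T

-- Identification of f with the normalised cd-coefficients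

module CDIndex where

  open import Defs
  open SealedRational
  open Coefficient
  open Bounds
  open Balance using (word)
  open FlagVector
  open import Data.Bool using (Bool; true; false; if_then_else_; not)
  open import Data.Nat as ℕ using (ℕ; zero; suc; _!)
  import Data.Nat.Properties as ℕₚ
  open import Data.Nat.Tactic.RingSolver using () renaming (solve-∀ to solveℕ)
  open import Data.Integer as ℤ using (ℤ; +_)
  open import Data.Integer.Tactic.RingSolver using () renaming (solve-∀ to solveℤ)
  open import Data.Rational using (ℚ; 0ℚ; 1ℚ; _<_)
  open import Data.Rational.Properties using (<-≤-trans)
  open import Data.List as List using (List; []; _∷_; map; _ʳ++_; reverse)
  import Data.List.Properties as Listₚ
  open import Data.Vec using (Vec; []; _∷_; replicate; _++_; toList)
  open import Relation.Binary.PropositionalEquality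
  open import Tactic.RingSolver using (solve-∀)

  sumWords : (CDWord → ℚ) → List CDWord → ℚ
  sumWords g []       = 0ℚ
  sumWords g (w ∷ ws) = g w + sumWords g ws

  sumWords-++ : ∀ g xs ys → sumWords g (xs List.++ ys) ≡ sumWords g xs + sumWords g ys
  sumWords-++ g []       ys = sym (+-identityˡ _)
  sumWords-++ g (x ∷ xs) ys = trans (+-congˡ (sumWords-++ g xs ys)) (sym (+-assoc _ _ _))

  sumWords-map : ∀ g h xs → sumWords g (map h xs) ≡ sumWords (λ w → g (h w)) xs
  sumWords-map g h []       = refl
  sumWords-map g h (x ∷ xs) = +-congˡ (sumWords-map g h xs)

  sumWords-cong : ∀ {g h} xs → (∀ w → g w ≡ h w) → sumWords g xs ≡ sumWords h xs
  sumWords-cong []       e = refl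
  sumWords-cong (x ∷ xs) e = cong₂ _+_ (e x) (sumWords-cong xs e)

  sumWords-+ : ∀ g h xs → sumWords (λ w → g w + h w) xs ≡ sumWords g xs + sumWords h xs
  sumWords-+ g h []       = sym (+-identityˡ 0ℚ)
  sumWords-+ g h (x ∷ xs) = trans (+-congˡ (sumWords-+ g h xs)) (r _ _ _ _)
    where
    opaque
      unfolding _+_
      r : ∀ a b c d → (a + b) + (c + d) ≡ (a + c) + (b + d)
      r = solve-∀ ring

  sumWords-* : ∀ x g xs → sumWords (λ w → x * g w) xs ≡ x * sumWords g xs
  sumWords-* x g []       = sym (*-zeroʳ x)
  sumWords-* x g (w ∷ ws) = trans (+-congˡ (sumWords-* x g ws)) (sym (*-distribˡ-+ x _ _))

  -- the coefficient of the ab-word u in Σ_w g(w) w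
  abCoeff : ∀ {r} → (CDWord → ℚ) → Vec Bool r → ℚ
  abCoeff {r} g u = sumWords (λ w → g w * ι (expand w (toList u))) (cdWords r)

  abCoeff-cong : ∀ {r} {g h : CDWord → ℚ} (u : Vec Bool r) → (∀ w → g w ≡ h w) → abCoeff g u ≡ abCoeff h u
  abCoeff-cong {r} u e = sumWords-cong (cdWords r) λ w → *-congʳ (e w)

  abCoeff-+ : ∀ {r} (g h : CDWord → ℚ) (u : Vec Bool r) → abCoeff (λ w → g w + h w) u ≡ abCoeff g u + abCoeff h u
  abCoeff-+ {r} g h u = trans (sumWords-cong (cdWords r) λ w → rdist _ _ _) (sumWords-+ _ _ (cdWords r))
    where
    opaque
      unfolding _+_
      rdist : ∀ x y z → (x + y) * z ≡ x * z + y * z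
      rdist = solve-∀ ring

  abCoeff-* : ∀ {r} x (g : CDWord → ℚ) (u : Vec Bool r) → abCoeff (λ w → x * g w) u ≡ x * abCoeff g u
  abCoeff-* {r} x g u = trans (sumWords-cong (cdWords r) λ w → *-assoc _ _ _) (sumWords-* x _ (cdWords r))

  *ι0 : ∀ x → x * ι 0 ≡ 0ℚ
  *ι0 x = trans (*-congˡ ιℤ-0) (*-zeroʳ x)

  sumWords-ι0 : ∀ (g : CDWord → ℚ) xs → sumWords (λ w → g w * ι 0) xs ≡ 0ℚ
  sumWords-ι0 g []       = refl
  sumWords-ι0 g (x ∷ xs) = trans (cong₂ _+_ (*ι0 (g x)) (sumWords-ι0 g xs)) (+-identityˡ 0ℚ)

  unequal : Bool → Bool → Bool
  unequal x y = if x then not y else y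

  abCoeff-∷ : ∀ {r} g x y (u : Vec Bool r) →
    abCoeff g (x ∷ y ∷ u) ≡ abCoeff (λ w → g (c ∷ w)) (y ∷ u) + (if unequal x y then abCoeff (λ w → g (d ∷ w)) u else 0ℚ)
  abCoeff-∷ {r} g x y u = trans (sumWords-++ _ (map (c ∷_) (cdWords (suc r))) (map (d ∷_) (cdWords r)))
    (cong₂ _+_ (sumWords-map _ (c ∷_) (cdWords (suc r))) (trans (sumWords-map _ (d ∷_) (cdWords r)) (byCase (unequal x y))))
    where
    byCase : ∀ b → sumWords (λ w → g (d ∷ w) * ι (if b then expand w (toList u) else 0)) (cdWords r)
      ≡ (if b then abCoeff (λ w → g (d ∷ w)) u else 0ℚ)
    byCase true  = refl
    byCase false = sumWords-ι0 (λ w → g (d ∷ w)) (cdWords r)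

  abCoeff-[x] : ∀ g x → abCoeff g (x ∷ []) ≡ g (c ∷ [])
  abCoeff-[x] g x = trans (+-identityʳ _) (trans (*-congˡ ιℤ-1) (*-identityʳ _))

  abCoeff-[] : ∀ g → abCoeff g [] ≡ g []
  abCoeff-[] g = trans (+-identityʳ _) (trans (*-congˡ ιℤ-1) (*-identityʳ _))

  -- An ab-word with two equal initial letters receives nothing from words beginning with d, so it
  -- isolates those beginning with c. Once their contribution is known to agree, the initial letters
  -- ba isolate those beginning with d.
  abCoeff-injective : ∀ {g h : CDWord → ℚ} w → (∀ (u : Vec Bool (degree w)) → abCoeff g u ≡ abCoeff h u) → g w ≡ h w
  abCoeff-injective {g} {h} []          e = trans (sym (abCoeff-[] g)) (trans (e []) (abCoeff-[] h))
  abCoeff-injective {g} {h} (c ∷ [])    e = trans (sym (abCoeff-[x] g true)) (trans (e (true ∷ [])) (abCoeff-[x] h true))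
  abCoeff-injective {g} {h} (c ∷ c ∷ w) e = abCoeff-injective (c ∷ w) λ { (y ∷ u) → repeat g h y u (e (y ∷ y ∷ u)) }
    where
    repeat : ∀ {r} g h y (u : Vec Bool r) → abCoeff g (y ∷ y ∷ u) ≡ abCoeff h (y ∷ y ∷ u) →
      abCoeff (λ w → g (c ∷ w)) (y ∷ u) ≡ abCoeff (λ w → h (c ∷ w)) (y ∷ u)
    repeat g h true  u e = trans (sym (trans (abCoeff-∷ g true true u) (+-identityʳ _))) (trans e (trans (abCoeff-∷ h true true u) (+-identityʳ _)))
    repeat g h false u e = trans (sym (trans (abCoeff-∷ g false false u) (+-identityʳ _))) (trans e (trans (abCoeff-∷ h false false u) (+-identityʳ _)))
  abCoeff-injective {g} {h} (c ∷ d ∷ w) e = abCoeff-injective (d ∷ w) λ { (y ∷ u) → repeat g h y u (e (y ∷ y ∷ u)) }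
    where
    repeat : ∀ {r} g h y (u : Vec Bool r) → abCoeff g (y ∷ y ∷ u) ≡ abCoeff h (y ∷ y ∷ u) →
      abCoeff (λ w → g (c ∷ w)) (y ∷ u) ≡ abCoeff (λ w → h (c ∷ w)) (y ∷ u)
    repeat g h true  u e = trans (sym (trans (abCoeff-∷ g true true u) (+-identityʳ _))) (trans e (trans (abCoeff-∷ h true true u) (+-identityʳ _)))
    repeat g h false u e = trans (sym (trans (abCoeff-∷ g false false u) (+-identityʳ _))) (trans e (trans (abCoeff-∷ h false false u) (+-identityʳ _)))
  abCoeff-injective {g} {h} (d ∷ w)     e = abCoeff-injective w λ u →
    cancel _ _ _ _ (trans (sym (abCoeff-∷ g true false u)) (trans (e (true ∷ false ∷ u)) (abCoeff-∷ h true false u)))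
      (trans (sym (trans (abCoeff-∷ g false false u) (+-identityʳ _))) (trans (e (false ∷ false ∷ u)) (trans (abCoeff-∷ h false false u) (+-identityʳ _))))
    where
    cancel : ∀ x y x′ y′ → x + y ≡ x′ + y′ → x ≡ x′ → y ≡ y′
    cancel x y x′ y′ p refl = diff-0 (trans (r x y y′) (0-diff p))
      where
      opaque
        unfolding _+_
        r : ∀ x y y′ → y - y′ ≡ (x + y) - (x + y′)
        r = solve-∀ ring

  -- The dual of the coproduct of cd-words at a prefix cᵏ: a letter of rank k + 1 is either a c,
  -- or the second or the first half of a d.
  joinBefore : (CDWord → ℚ) → ℕ → CDWord → ℚ
  joinBefore g zero    y = 0ℚ
  joinBefore g (suc k) y = g (List.replicate k c List.++ d ∷ y)

  joinAfter : (CDWord → ℚ) → ℕ → CDWord → ℚ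
  joinAfter g k (c ∷ y) = g (List.replicate k c List.++ d ∷ y)
  joinAfter g k _       = 0ℚ

  join : (CDWord → ℚ) → ℕ → CDWord → ℚ
  join g k y = 2ℚ * g (List.replicate (suc k) c List.++ y) + (joinBefore g k y + joinAfter g k y)

  -- The coefficients of c times the polynomial of g; the first ab-letter of such a product is free.
  afterC : (CDWord → ℚ) → CDWord → ℚ
  afterC g (c ∷ y) = g y
  afterC g _       = 0ℚ

  abCoeff-afterC : ∀ {r} g x (v : Vec Bool r) → abCoeff (afterC g) (x ∷ v) ≡ abCoeff g v
  abCoeff-afterC g x []      = trans (abCoeff-[x] (afterC g) x) (sym (abCoeff-[] g))
  abCoeff-afterC g x (y ∷ v) = trans (abCoeff-∷ (afterC g) x y v) (trans (+-congˡ (dZero (unequal x y))) (+-identityʳ _))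
    where
    dZero : ∀ b → (if b then abCoeff (λ w → afterC g (d ∷ w)) v else 0ℚ) ≡ 0ℚ
    dZero true  = trans (abCoeff-cong {g = λ _ → 0ℚ} v (λ _ → sym (*-zeroˡ 0ℚ))) (trans (abCoeff-* 0ℚ (λ _ → 0ℚ) v) (*-zeroˡ _))
    dZero false = refl

  star₀ : ∀ {s} g (v : Vec Bool s) → abCoeff g (false ∷ v) + abCoeff g (true ∷ v) ≡ abCoeff (join g 0) v
  star₀ g []      = trans (cong₂ _+_ (abCoeff-[x] g false) (abCoeff-[x] g true)) (trans (r _) (sym (abCoeff-[] (join g 0))))
    where
    opaque
      unfolding _+_
      r : ∀ x → x + x ≡ 2ℚ * x + (0ℚ + 0ℚ)
      r = solve-∀ ring
  star₀ g (y ∷ v) = trans (cong₂ _+_ (abCoeff-∷ g false y v) (abCoeff-∷ g true y v)) (trans (byCase y) (sym rhs))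
    where
    G = λ y → abCoeff (λ w → g (c ∷ w)) (y ∷ v)
    opaque
      unfolding _+_
      r₁ : ∀ x z → (x + z) + (x + 0ℚ) ≡ 2ℚ * x + z
      r₁ = solve-∀ ring
    opaque
      unfolding _+_
      r₂ : ∀ x z → (x + 0ℚ) + (x + z) ≡ 2ℚ * x + z
      r₂ = solve-∀ ring
    byCase : ∀ y → (G y + (if unequal false y then abCoeff (λ w → g (d ∷ w)) v else 0ℚ)) + (G y + (if unequal true y then abCoeff (λ w → g (d ∷ w)) v else 0ℚ))
      ≡ 2ℚ * G y + abCoeff (λ w → g (d ∷ w)) v
    byCase true  = r₁ _ _
    byCase false = r₂ _ _
    shape : ∀ w → join g 0 w ≡ 2ℚ * g (c ∷ w) + afterC (λ w → g (d ∷ w)) w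
    shape []      = +-congˡ (+-identityˡ 0ℚ)
    shape (c ∷ w) = +-congˡ (+-identityˡ _)
    shape (d ∷ w) = +-congˡ (+-identityˡ 0ℚ)
    rhs : abCoeff (join g 0) (y ∷ v) ≡ 2ℚ * G y + abCoeff (λ w → g (d ∷ w)) v
    rhs = trans (abCoeff-cong (y ∷ v) shape) (trans (abCoeff-+ (λ w → 2ℚ * g (c ∷ w)) (afterC (λ w → g (d ∷ w))) (y ∷ v))
      (cong₂ _+_ (abCoeff-* 2ℚ (λ w → g (c ∷ w)) (y ∷ v)) (abCoeff-afterC (λ w → g (d ∷ w)) y v)))

  -- No d expands to aa, so the prefix of k letters a comes from letters c, apart from a d that
  -- straddles its end. Summing over the next letter counts a c there twice and a d, whichever half
  -- of it lies there, once.
  star : ∀ k {s} g (v : Vec Bool s) →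
    abCoeff g (replicate k false ++ false ∷ v) + abCoeff g (replicate k false ++ true ∷ v) ≡ abCoeff (join g k) v
  star zero          g v = star₀ g v
  star (suc zero)    g v = trans (cong₂ _+_ (abCoeff-∷ g false false v) (abCoeff-∷ g false true v))
    (trans (r _ _ _) (trans (+-congʳ (star₀ (λ w → g (c ∷ w)) v))
      (trans (sym (abCoeff-+ (join (λ w → g (c ∷ w)) 0) (λ w → g (d ∷ w)) v)) (abCoeff-cong v shape))))
    where
    opaque
      unfolding _+_
      r : ∀ x y z → (x + 0ℚ) + (y + z) ≡ (x + y) + z
      r = solve-∀ ring
    opaque
      unfolding _+_
      r₂ : ∀ x a b → (x + (0ℚ + a)) + b ≡ x + (b + a)
      r₂ = solve-∀ ring
    shape : ∀ w → join (λ w → g (c ∷ w)) 0 w + g (d ∷ w) ≡ join g 1 w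
    shape []      = r₂ _ _ _
    shape (c ∷ w) = r₂ _ _ _
    shape (d ∷ w) = r₂ _ _ _
  star (suc (suc k)) g v = trans (cong₂ _+_ (trans (abCoeff-∷ g false false (replicate k false ++ false ∷ v)) (+-identityʳ _))
      (trans (abCoeff-∷ g false false (replicate k false ++ true ∷ v)) (+-identityʳ _)))
    (trans (star (suc k) (λ w → g (c ∷ w)) v) (abCoeff-cong v shape))
    where
    shape : ∀ w → join (λ w → g (c ∷ w)) (suc k) w ≡ join g (suc (suc k)) w
    shape []      = refl
    shape (c ∷ w) = refl
    shape (d ∷ w) = refl

  abCoeff-empty : ∀ r g → abCoeff g (replicate r false) ≡ g (List.replicate r c)
  abCoeff-empty zero          g = abCoeff-[] g
  abCoeff-empty (suc zero)    g = abCoeff-[x] g false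
  abCoeff-empty (suc (suc r)) g = trans (abCoeff-∷ g false false (replicate r false)) (trans (+-identityʳ _) (abCoeff-empty (suc r) (λ w → g (c ∷ w))))

  headExp : CDWord → ℕ
  headExp []      = 0
  headExp (c ∷ w) = suc (headExp w)
  headExp (d ∷ w) = 0

  tailExp : CDWord → List ℕ
  tailExp []      = []
  tailExp (c ∷ w) = tailExp w
  tailExp (d ∷ w) = headExp w ∷ tailExp w

  headExp-c : ∀ p w → headExp (List.replicate p c List.++ w) ≡ p ℕ.+ headExp w
  headExp-c zero    w = refl
  headExp-c (suc p) w = cong suc (headExp-c p w)

  tailExp-c : ∀ p w → tailExp (List.replicate p c List.++ w) ≡ tailExp w
  tailExp-c zero    w = refl
  tailExp-c (suc p) w = tailExp-c p w

  degree-exp : ∀ w → degree w ≡ headExp w ℕ.+ wt (tailExp w)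
  degree-exp []      = refl
  degree-exp (c ∷ w) = cong suc (degree-exp w)
  degree-exp (d ∷ w) = cong (λ n → suc (suc n)) (degree-exp w)

  value : CDWord → ℚ
  value w = f [] (headExp w) (tailExp w)

  value-c : ∀ p w → value (List.replicate p c List.++ w) ≡ f [] (p ℕ.+ headExp w) (tailExp w)
  value-c p w = cong₂ (f []) (headExp-c p w) (tailExp-c p w)

  value-cd : ∀ p w → value (List.replicate p c List.++ d ∷ w) ≡ f [] p (headExp w ∷ tailExp w)
  value-cd p w = trans (value-c p (d ∷ w)) (cong (λ j → f [] j (headExp w ∷ tailExp w)) (ℕₚ.+-identityʳ p))

  -- This is the product rule with empty A: `joinBefore` lowers the exponent k on the left of the
  -- cut, `joinAfter` lowers the leading exponent of y.
  join-value : ∀ k y → join value k y ≡ e k * value y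
  join-value k y = trans (cong₂ (λ u v → 2ℚ * u + v) (value-c (suc k) y) (cong₂ _+_ (before k) (after y)))
    (trans (sym (product-rule [] k B q)) (*-congˡ (f-rev B q [])))
    where
    q = headExp y
    B = tailExp y
    before : ∀ k → joinBefore value k y ≡ low (λ z → f [] z (q ∷ B)) k
    before zero    = refl
    before (suc k) = value-cd k y
    after : ∀ y → joinAfter value k y ≡ low (λ z → f (tailExp y) z (k ∷ [])) (headExp y)
    after []      = refl
    after (c ∷ y) = trans (value-cd k y) (sym (f-rev (tailExp y) (headExp y) (k ∷ [])))
    after (d ∷ y) = refl

  data FirstTrue : ∀ {r} → Vec Bool r → Set where
    none : ∀ r → FirstTrue (replicate r false)
    at   : ∀ k {s} (v : Vec Bool s) → FirstTrue (replicate k false ++ true ∷ v)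

  firstTrue : ∀ {r} (u : Vec Bool r) → FirstTrue u
  firstTrue []          = none 0
  firstTrue (true ∷ u)  = at 0 u
  firstTrue (false ∷ u) with firstTrue u
  ... | none r = none (suc r)
  ... | at k v = at (suc k) v

  card-replicate : ∀ k {s} (v : Vec Bool s) → card (replicate k false ++ v) ≡ card v
  card-replicate zero    v = refl
  card-replicate (suc k) v = card-replicate k v

  e-! : ∀ r → ι (suc r !) * e r ≡ 1ℚ
  e-! zero    = trans (*-congʳ ιℤ-1) (trans (*-identityˡ _) e-zero)
  e-! (suc r) = trans (*-congʳ (trans (cong ι (ℕₚ.*-comm (suc (suc r)) (suc r !))) (ι-* (suc r !) (suc (suc r)))))
    (trans (*-assoc _ _ _) (trans (*-congˡ (e-suc r)) (e-! r)))

  value-cs : ∀ r → value (List.replicate r c) ≡ e r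
  value-cs r = trans (cong value (sym (Listₚ.++-identityʳ (List.replicate r c))))
    (trans (value-c r []) (cong e (ℕₚ.+-identityʳ r)))

  private
    -- Induction on the number of letters b. Changing the first b into a, or cutting there and
    -- keeping the tail, leaves one b fewer. Flag numbers and cd-expansion obey the same relation
    -- between these three words, and the word without b has the value 1 on both sides.
    flag-value′ : ∀ m {r} (u : Vec Bool r) → card u ℕ.≤ m → ιℤ (flagH r u) ≡ ι (suc r !) * abCoeff value u
    flag-value′ m u le with firstTrue u
    ... | none r = trans (cong ιℤ (flagH-empty r)) (trans ιℤ-1
      (sym (trans (*-congˡ (trans (abCoeff-empty r value) (value-cs r))) (e-! r))))
    flag-value′ zero    _ le | at k v with trans (sym (ℕₚ.n≤0⇒n≡0 le)) (card-replicate k (true ∷ v))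
    ... | ()
    flag-value′ (suc m) _ le | at k {s} v = solveFor
      (trans (sym (ιℤ-+ (flagH R ub) (flagH R ua))) (trans (cong ιℤ total) (ιℤ-* (+ choose (suc k ℕ.+ suc s) (suc k)) (flagH s v))))
      (flag-value′ m ua (subst (ℕ._≤ m) (sym (card-replicate k (false ∷ v))) smaller))
      (flag-value′ m v smaller)
      (trans (star k value v) (trans (abCoeff-cong v (join-value k)) (abCoeff-* (e k) value v)))
      (trans (*-congʳ (trans (cong ι (sym (choose-! (suc k) (suc s)))) (trans (ι-* _ (suc k ! ℕ.* suc s !)) (*-congˡ (ι-* (suc k !) (suc s !))))))
        (trans (regroup _ _ _ _) (trans (*-congˡ (e-! k)) (*-identityʳ _))))
      where
      R = k ℕ.+ suc s
      ua = replicate k false ++ false ∷ v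
      ub = replicate k false ++ true ∷ v
      smaller : card v ℕ.≤ m
      smaller = ℕₚ.≤-pred (subst (ℕ._≤ suc m) (card-replicate k (true ∷ v)) le)
      total : flagH R ub ℤ.+ flagH R ua ≡ + choose (suc k ℕ.+ suc s) (suc k) ℤ.* flagH s v
      total = trans (cong (λ z → z ℤ.+ flagH R ua) (flagH-first k s v)) (r _ _)
        where
        r : ∀ x y → x ℤ.- y ℤ.+ y ≡ x
        r = solveℤ
      opaque
        unfolding _+_
        regroup : ∀ x y z w → x * (y * z) * w ≡ x * z * (y * w)
        regroup = solve-∀ ring
      -- hb, ha and hv are the flag numbers with b, with a, and of the tail; Cb, Ca and Cv are the
      -- matching ab-coefficients. K = (R + 1)!, S = (s + 1)!, B is the binomial coefficient and E =
      -- 1 / (k + 1)!.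
      solveFor : ∀ {hb ha hv B K S Ca Cb Cv E} → hb + ha ≡ B * hv → ha ≡ K * Ca → hv ≡ S * Cv →
        Ca + Cb ≡ E * Cv → K * E ≡ B * S → hb ≡ K * Cb
      solveFor {hb} {B = B} {K} {S} {Ca} {Cb} {Cv} {E} p refl refl q s = diff-0
        (trans (r₁ hb K Ca Cb) (trans (cong₂ (λ x y → x - K * y) p q)
          (trans (r₂ B S Cv K E) (trans (cong (λ t → (t - K * E) * Cv) (sym s)) (r₃ (K * E) Cv)))))
        where
        opaque
          unfolding _+_
          r₁ : ∀ hb K Ca Cb → hb - K * Cb ≡ (hb + K * Ca) - K * (Ca + Cb)
          r₁ = solve-∀ ring
        opaque
          unfolding _+_
          r₂ : ∀ B S Cv K E → B * (S * Cv) - K * (E * Cv) ≡ (B * S - K * E) * Cv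
          r₂ = solve-∀ ring
        opaque
          unfolding _+_
          r₃ : ∀ x y → (x - x) * y ≡ 0ℚ
          r₃ = solve-∀ ring

  flag-value : ∀ r (u : Vec Bool r) → ιℤ (flagH r u) ≡ ι (suc r !) * abCoeff value u
  flag-value r u = flag-value′ _ u ℕₚ.≤-refl

  listWord-exp : ∀ p B → (headExp (listWord (p ∷ B)) ≡ p)
  listWord-exp p []      = trans (cong headExp (sym (Listₚ.++-identityʳ (List.replicate p c)))) (trans (headExp-c p []) (ℕₚ.+-identityʳ p))
  listWord-exp p (q ∷ B) = trans (headExp-c p (d ∷ listWord (q ∷ B))) (ℕₚ.+-identityʳ p)

  listWord-tail : ∀ p B → tailExp (listWord (p ∷ B)) ≡ B
  listWord-tail p []      = trans (cong tailExp (sym (Listₚ.++-identityʳ (List.replicate p c)))) (tailExp-c p [])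
  listWord-tail p (q ∷ B) = trans (tailExp-c p (d ∷ listWord (q ∷ B))) (cong₂ _∷_ (listWord-exp q B) (listWord-tail q B))

  wt-++ : ∀ A B → wt (A List.++ B) ≡ wt A ℕ.+ wt B
  wt-++ []      B = refl
  wt-++ (a ∷ A) B = cong (λ j → suc (suc j)) (trans (cong (λ j → a ℕ.+ j) (wt-++ A B)) (sym (ℕₚ.+-assoc a (wt A) (wt B))))

  wt-word : ∀ M m L n N → wt (word M m L n N) ≡ 4 ℕ.+ (m ℕ.+ n) ℕ.+ (wt M ℕ.+ (wt L ℕ.+ wt N))
  wt-word M m L n N = trans (wt-++ M (m ∷ L List.++ n ∷ N)) (trans (cong (λ j → wt M ℕ.+ suc (suc (m ℕ.+ j))) (wt-++ L (n ∷ N)))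
    (r (wt M) m (wt L) n (wt N)))
    where
    r : ∀ a m b n d → a ℕ.+ suc (suc (m ℕ.+ (b ℕ.+ suc (suc (n ℕ.+ d))))) ≡ 4 ℕ.+ (m ℕ.+ n) ℕ.+ (a ℕ.+ (b ℕ.+ d))
    r = solveℕ

  ι-!>0 : ∀ k → 0ℚ < ι (k !)
  ι-!>0 k = <-≤-trans (ι>0 0) (ι-mono (ℕₚ.1≤n! k))

  -- β as a factorial multiple of f

  module Index (ψ : ℕ → CDWord → ℤ) (isIndex : IsBooleanCDIndex ψ) where

    ιℤ-sum : ∀ r (u : List Bool) ws → ιℤ (sumℤ (map (λ w → ψ r w ℤ.* + expand w u) ws)) ≡ sumWords (λ w → ιℤ (ψ r w) * ι (expand w u)) ws
    ιℤ-sum r u []       = ιℤ-0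
    ιℤ-sum r u (w ∷ ws) = trans (ιℤ-+ _ _) (cong₂ _+_ (ιℤ-* (ψ r w) (+ expand w u)) (ιℤ-sum r u ws))

    ψ-value : ∀ w → ιℤ (ψ (degree w) w) ≡ ι (suc (degree w) !) * value w
    ψ-value w = abCoeff-injective {λ w′ → ιℤ (ψ r w′)} {λ w′ → ι (suc r !) * value w′} w λ u →
      trans (sym (ιℤ-sum r (toList u) (cdWords r))) (trans (cong ιℤ (isIndex r u))
        (trans (flag-value r u) (sym (abCoeff-* (ι (suc r !)) value u))))
      where r = degree w

    -- β is defined through a local function; solving for `loop` by unification gives access to it.
    mutual
      loop : List ℤ → List ℤ → List ℕ → ℤ
      loop = _

      β-loop : ∀ n zs → β ψ (+ n ∷ zs) ≡ loop (+ n ∷ zs) zs (n ∷ [])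
      β-loop n zs with + n List.∷ zs | n List.∷ List.[]
      ... | _ | _ = refl

    loop-ℕ : ∀ zs xs acc → loop zs (map +_ xs) acc ≡ βw ψ (listWord (reverse (xs ʳ++ acc)))
    loop-ℕ zs []       acc = refl
    loop-ℕ zs (x ∷ xs) acc = loop-ℕ zs xs (x ∷ acc)

    β-listWord : ∀ p B → β ψ (map +_ (p ∷ B)) ≡ βw ψ (listWord (p ∷ B))
    β-listWord p B = trans (loop-ℕ (map +_ (p ∷ B)) B (p ∷ [])) (cong (λ w → βw ψ (listWord w)) (Listₚ.reverse-involutive (p ∷ B)))

    -- `wt` counts the first entry as if a d preceded it and so gives r + 2; the predecessor is the
    -- r + 1 of the factorial.
    β-value : ∀ p B → ιℤ (β ψ (map +_ (p ∷ B))) ≡ ι (ℕ.pred (wt (p ∷ B)) !) * fw (p ∷ B)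
    β-value p B = trans (cong ιℤ (β-listWord p B)) (trans (ψ-value (listWord (p ∷ B)))
      (cong₂ (λ k x → ι (suc k !) * x) (trans (degree-exp (listWord (p ∷ B))) (cong₂ (λ q C → q ℕ.+ wt C) h t)) (cong₂ (f []) h t)))
      where
      h = listWord-exp p B
      t = listWord-tail p B

    β-word : ∀ M m L n N → ιℤ (β ψ (map +_ M List.++ (+ m ∷ map +_ L List.++ (+ n ∷ map +_ N)))) ≡
      ι (ℕ.pred (4 ℕ.+ (m ℕ.+ n) ℕ.+ (wt M ℕ.+ (wt L ℕ.+ wt N))) !) * fw (word M m L n N)
    β-word M m L n N = trans (cong (λ z → ιℤ (β ψ z)) (sym spread)) (trans (byCase M) (cong (λ k → ι (ℕ.pred k !) * fw (word M m L n N)) (wt-word M m L n N)))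
      where
      spread : map +_ (word M m L n N) ≡ map +_ M List.++ (+ m ∷ map +_ L List.++ (+ n ∷ map +_ N))
      spread = trans (Listₚ.map-++ +_ M (m ∷ L List.++ n ∷ N)) (cong (λ z → map +_ M List.++ + m ∷ z) (Listₚ.map-++ +_ L (n ∷ N)))
      byCase : ∀ M → ιℤ (β ψ (map +_ (word M m L n N))) ≡ ι (ℕ.pred (wt (word M m L n N)) !) * fw (word M m L n N)
      byCase []      = β-value m (L List.++ n ∷ N)
      byCase (x ∷ M) = β-value x (M List.++ m ∷ L List.++ n ∷ N)

    module _ (m₁ n₁ m₂ n₂ : ℕ) (L M N : List ℕ) (eq : m₁ ℕ.+ n₁ ≡ m₂ ℕ.+ n₂) where

      private
        size : ℕ → ℕ
        size j = ℕ.pred (4 ℕ.+ j ℕ.+ (wt M ℕ.+ (wt L ℕ.+ wt N)))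

        second : ιℤ (β ψ (map +_ M List.++ (+ m₂ ∷ map +_ L List.++ (+ n₂ ∷ map +_ N)))) ≡ ι (size (m₁ ℕ.+ n₁) !) * fw (word M m₂ L n₂ N)
        second = trans (β-word M m₂ L n₂ N) (cong (λ j → ι (size j !) * fw (word M m₂ L n₂ N)) (sym eq))

      -- Equal sums of the two exponents give equal degrees, so both sides carry the same positive
      -- factorial.
      fw⇒β : fw (word M m₂ L n₂ N) < fw (word M m₁ L n₁ N) →
        β ψ (map +_ M List.++ (+ m₂ ∷ map +_ L List.++ (+ n₂ ∷ map +_ N))) ℤ.< β ψ (map +_ M List.++ (+ m₁ ∷ map +_ L List.++ (+ n₁ ∷ map +_ N)))
      fw⇒β lt = ιℤ-cancel-< (subst₂ _<_ (sym second) (sym (β-word M m₁ L n₁ N)) (*-monoˡ-< (ι (size (m₁ ℕ.+ n₁) !)) (ι-!>0 (size (m₁ ℕ.+ n₁))) lt))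

      β⇒fw : β ψ (map +_ M List.++ (+ m₂ ∷ map +_ L List.++ (+ n₂ ∷ map +_ N))) ℤ.< β ψ (map +_ M List.++ (+ m₁ ∷ map +_ L List.++ (+ n₁ ∷ map +_ N))) →
        fw (word M m₂ L n₂ N) < fw (word M m₁ L n₁ N)
      β⇒fw lt = cancel-< (ι (size (m₁ ℕ.+ n₁) !)) (ι-!>0 (size (m₁ ℕ.+ n₁))) (subst₂ _<_ second (β-word M m₁ L n₁ N) (ιℤ-mono-< lt))

-- Transfer of assumption and conclusion between β and f

open import Defs
open import Data.Nat using (ℕ; _+_; _≤_; _<_; ∣_-_∣)
open import Data.Integer using (ℤ; +_; _-_; _>_)
open import Data.List using (List; _∷_; []; _++_; map)
open import Relation.Binary.PropositionalEquality using (_≡_; trans; cong; sym; subst)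
import Data.Nat.Properties as ℕₚ
import Data.Rational as ℚ
open Coefficient using (fw)
open Balance using (word; module Chain)
open CDIndex using (module Index)

theorem7p13 : (ψ : ℕ → CDWord → ℤ) → IsBooleanCDIndex ψ →
    ((m n : ℕ) (L M : List ℕ) → n ≤ m →
    β ψ (map +_ M ++ (+ m ∷ map +_ L ++ (+ n ∷ [])))
    > β ψ (map +_ M ++ ((+ n - + 1) ∷ map +_ L ++ (+ (m + 1) ∷ [])))) →
    (m₁ n₁ m₂ n₂ : ℕ) (L M N : List ℕ) → m₁ + n₁ ≡ m₂ + n₂ →
    ∣ m₁ - n₁ ∣ < ∣ m₂ - n₂ ∣ →
    β ψ (map +_ M ++ (+ m₁ ∷ map +_ L ++ (+ n₁ ∷ map +_ N)))
    > β ψ (map +_ M ++ (+ m₂ ∷ map +_ L ++ (+ n₂ ∷ map +_ N)))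
theorem7p13 ψ isIndex hyp m₁ n₁ m₂ n₂ L M N eq lt =
  fw⇒β m₁ n₁ m₂ n₂ L M N eq (balanced L M N m₁ n₁ m₂ n₂ eq lt)
  where
  open Index ψ isIndex
  -- The smaller exponent is written as a successor, so that the lowered entry of the assumption
  -- computes to the natural number n.
  hyp′ : ∀ m n L M → ℕ.suc n ≤ m → fw (word M n L (ℕ.suc m) []) ℚ.< fw (word M m L (ℕ.suc n) [])
  hyp′ m n L M n<m = β⇒fw m (ℕ.suc n) n (ℕ.suc m) L M []
    (trans (ℕₚ.+-suc m n) (trans (cong ℕ.suc (ℕₚ.+-comm m n)) (sym (ℕₚ.+-suc n m))))
    (subst (λ j → β ψ (map +_ M ++ (+ m ∷ map +_ L ++ (+ ℕ.suc n ∷ [])))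
                    > β ψ (map +_ M ++ (+ n ∷ map +_ L ++ (+ j ∷ []))))
      (ℕₚ.+-comm m 1) (hyp m (ℕ.suc n) L M n<m))
  open Chain hyp′
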